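{- Let $t\geq1$, let $k_1\geq k_2\geq t+2$ with $(k_1,k_2)\neq(3,3)$, and let $n\geq 2L(k_1,t)$, where $L(k,t)=(t+1)+(k-t+1)\log_2\big((t+1)(k-t+1)\big)$. Suppose $\mathcal{F}_1\subseteq\Pi_{k_1}(n)$ and $\mathcal{F}_2\subseteq\Pi_{k_2}(n)$ are non-trivial cross $t$-intersecting families such that $|\mathcal{F}_1||\mathcal{F}_2|$ is maximum among all pairs of non-trivial cross $t$-intersecting families in $\Pi_{k_1}(n)\times\Pi_{k_2}(n)$. Then $(\mathcal{F}_1,\mathcal{F}_2)$ is isomorphic to one of $(\mathcal{A}(k_1,k_2,t),\mathcal{B}(k_2,t))$, $(\mathcal{B}(k_1,t),\mathcal{A}(k_2,k_1,t))$, $(\mathcal{C}(k_1,t),\mathcal{D}(k_2,t))$ and $(\mathcal{D}(k_1,t),\mathcal{C}(k_2,t))$.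
   Context: $[n]=\{1,\ldots,n\}$, $[i,j]=\{i,\ldots,j\}$. A partition is a set of pairwise disjoint non-empty sets (blocks); a $k$-partition has $k$ blocks; $\Pi_k(n)$ is the set of $k$-partitions of $[n]$ (blocks with union $[n]$). For partitions $P,Q$, $P\cap Q$ is the set of common blocks, $|P|$ the number of blocks, $\cup P$ the union of its blocks. For a family $\mathcal{F}$ of partitions, $\cap\mathcal{F}$ is the set of blocks common to all members. $\mathcal{F}_1\subseteq\Pi_{k_1}(n)$, $\mathcal{F}_2\subseteq\Pi_{k_2}(n)$ are cross $t$-intersecting if $|F_1\cap F_2|\geq t$ for all $F_1\in\mathcal{F}_1,F_2\in\mathcal{F}_2$; they are non-trivial if $|(\cap\mathcal{F}_1)\cap(\cap\mathcal{F}_2)|<t$. Two pairs of families are isomorphic if one is obtained from the other by applying a single permutation of $[n]$ to both. Let $[[m]]=\{\{1\},\ldots,\{m\}\}$. For an $\ell$-partition $M$ (not necessarily of $[n]$) and $X\subseteq M$ with $|X|=t$: $\mathcal{A}(k,X,M)=\{F\in\Pi_k(n):X\subseteq F,\ F\cap(M\setminus X)\neq\emptyset\}$ and $\mathcal{B}(\ell,X,M)=\{F\in\Pi_\ell(n):X\subseteq F\}\cup\{(M\setminus\{B\})\cup\{B\cup([n]\setminus\cup M)\}:B\in X\}$; $\mathcal{A}(k,\ell,t)=\mathcal{A}(k,[[t]],[[\ell]])$, $\mathcal{B}(\ell,t)=\mathcal{B}(\ell,[[t]],[[\ell]])$. For a $(t+1)$-partition $T$: $\mathcal{C}(k,T)=\{F\in\Pi_k(n):T\subseteq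 F\}$, $\mathcal{D}(\ell,T)=\{F\in\Pi_\ell(n):|T\cap F|\geq t\}$; $\mathcal{C}(k,t)=\mathcal{C}(k,[[t+1]])$, $\mathcal{D}(\ell,t)=\mathcal{D}(\ell,[[t+1]])$. -}

module Defs where

open import Data.Nat.Base using (ℕ; zero; suc; _≤_; _<_; _≡ᵇ_; _+_)
open import Data.Bool.Base using (Bool; true; false; _∧_; _∨_; not; if_then_else_)
open import Data.Fin.Base using (Fin; toℕ)
open import Data.Vec.Base using (Vec; []; _∷_; lookup; tabulate; zipWith; replicate)
open import Data.List.Base using (List; []; _∷_; _++_; map; length; filterᵇ; allFin; upTo; foldr)
open import Data.Bool.ListAction using (all; any)
open import Data.List.Membership.Propositional using (_∈_)
open import Data.List.Relation.Unary.All using (All)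
open import Data.List.Relation.Unary.Any using (Any)
open import Data.List.Relation.Unary.Unique.Propositional using (Unique)
open import Data.Fin.Permutation using (Permutation′; _⟨$⟩ʳ_)
open import Data.Product.Base using (_×_; ∃)
open import Data.Sum.Base using (_⊎_)
open import Function.Bundles using (_⇔_)
open import Relation.Nullary.Negation using (¬_)
open import Relation.Binary.PropositionalEquality using (_≡_)

-- Ground set [n] is modelled as Fin n (0-based: element i of Fin n is
-- the paper's element i+1).  A block (subset of [n]) is a Vec Bool n.

Block : ℕ → Set
Block n = Vec Bool n

_==ᵛ_ : {n : ℕ} → Block n → Block n → Bool
[] ==ᵛ [] = true
(a ∷ as) ==ᵛ (b ∷ bs) = (if a then b else not b) ∧ (as ==ᵛ bs)

nonempty : {n : ℕ} → Block n → Bool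
nonempty []       = false
nonempty (b ∷ bs) = b ∨ nonempty bs

allSubsets : (n : ℕ) → List (Block n)
allSubsets zero    = [] ∷ []
allSubsets (suc n) = map (true ∷_) (allSubsets n) ++ map (false ∷_) (allSubsets n)

count : {A : Set} → (A → Bool) → List A → ℕ
count p xs = length (filterᵇ p xs)

-- A partition of [n] is represented canonically by its equivalence
-- relation matrix: entry (i , j) is true iff i and j lie in the same
-- block.  Row i is then the block containing i.

Part : ℕ → Set
Part n = Vec (Vec Bool n) n

rel : {n : ℕ} → Part n → Fin n → Fin n → Bool
rel P i j = lookup (lookup P i) j

IsPartition : {n : ℕ} → Part n → Set
IsPartition {n} P =
  (∀ i → rel P i i ≡ true) ×
  (∀ i j → rel P i j ≡ rel P j i) ×
  (∀ i j l → rel P i j ≡ true → rel P j l ≡ true → rel P i l ≡ true)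

_∈ᵇ_ : {n : ℕ} → Block n → Part n → Bool
_∈ᵇ_ {n} B P = any (λ i → lookup P i ==ᵛ B) (allFin n)

#blocks : {n : ℕ} → Part n → ℕ
#blocks {n} P = count (λ B → B ∈ᵇ P) (allSubsets n)

IsKPartition : {n : ℕ} → ℕ → Part n → Set
IsKPartition k P = IsPartition P × #blocks P ≡ k

#common : {n : ℕ} → Part n → Part n → ℕ
#common {n} P Q = count (λ B → (B ∈ᵇ P) ∧ (B ∈ᵇ Q)) (allSubsets n)

-- Families of partitions: duplicate-free lists, |F| = length F.

Family : ℕ → Set
Family n = List (Part n)

FamilyIn : {n : ℕ} → ℕ → Family n → Set
FamilyIn k F = Unique F × All (IsKPartition k) F

CrossInt : {n : ℕ} → ℕ → Family n → Family n → Set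
CrossInt t F₁ F₂ = ∀ P Q → P ∈ F₁ → Q ∈ F₂ → t ≤ #common P Q

#commonAll : {n : ℕ} → Family n → Family n → ℕ
#commonAll {n} F₁ F₂ =
  count (λ B → nonempty B ∧ all (λ P → B ∈ᵇ P) F₁ ∧ all (λ P → B ∈ᵇ P) F₂)
        (allSubsets n)

NonTrivial : {n : ℕ} → ℕ → Family n → Family n → Set
NonTrivial t F₁ F₂ = #commonAll F₁ F₂ < t

NTCross : (n k₁ k₂ t : ℕ) → Family n → Family n → Set
NTCross n k₁ k₂ t F₁ F₂ =
  FamilyIn k₁ F₁ × FamilyIn k₂ F₂ × CrossInt t F₁ F₂ × NonTrivial t F₁ F₂

act : {n : ℕ} → Permutation′ n → Part n → Part n
act σ P = tabulate (λ i → tabulate (λ j → rel P (σ ⟨$⟩ʳ i) (σ ⟨$⟩ʳ j)))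

FamPred : ℕ → Set₁
FamPred n = Part n → Set

IsoPair : {n : ℕ} → Family n → Family n → FamPred n → FamPred n → Set
IsoPair {n} F₁ F₂ G₁ G₂ =
  ∃ λ (σ : Permutation′ n) →
    (∀ P → (P ∈ F₁) ⇔ G₁ (act σ P)) × (∀ P → (P ∈ F₂) ⇔ G₂ (act σ P))

_∪ᵇ_ : {n : ℕ} → Block n → Block n → Block n
_∪ᵇ_ = zipWith _∨_

⋃ : {n : ℕ} → List (Block n) → Block n
⋃ {n} = foldr _∪ᵇ_ (replicate n false)

compl : {n : ℕ} → Block n → Block n
compl = Data.Vec.Base.map not
  where import Data.Vec.Base

-- the singleton {j+1} (paper numbering) i.e. {j} in Fin n (0-based)
single : {n : ℕ} → ℕ → Block n
single j = tabulate (λ i → toℕ i ≡ᵇ j)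

[[_]] : {n : ℕ} → ℕ → List (Block n)
[[ m ]] = map single (upTo m)

HasBlocks : {n : ℕ} → Part n → List (Block n) → Set
HasBlocks {n} P L = IsPartition P × (∀ (C : Block n) → ((C ∈ᵇ P) ≡ true) ⇔ (C ∈ L))

remove : {n : ℕ} → Block n → List (Block n) → List (Block n)
remove B M = filterᵇ (λ C → not (C ==ᵛ B)) M

𝒜 : {n : ℕ} → ℕ → List (Block n) → List (Block n) → FamPred n
𝒜 k X M P =
  IsKPartition k P × All (λ B → (B ∈ᵇ P) ≡ true) X ×
  Any (λ B → ((B ∈ᵇ P) ≡ true) × ¬ (B ∈ X)) M

ℬ : {n : ℕ} → ℕ → List (Block n) → List (Block n) → FamPred n
ℬ ℓ X M P =
  (IsKPartition ℓ P × All (λ B → (B ∈ᵇ P) ≡ true) X) ⊎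
  Any (λ B → HasBlocks P ((B ∪ᵇ compl (⋃ M)) ∷ remove B M)) X

𝒞 : {n : ℕ} → ℕ → List (Block n) → FamPred n
𝒞 k T P = IsKPartition k P × All (λ B → (B ∈ᵇ P) ≡ true) T

-- 𝒟(ℓ,T) = {F ∈ Π_ℓ(n) : |T ∩ F| ≥ t}   (t given explicitly; T duplicate-free)
𝒟 : {n : ℕ} → ℕ → ℕ → List (Block n) → FamPred n
𝒟 ℓ t T P = IsKPartition ℓ P × t ≤ count (λ B → B ∈ᵇ P) T

𝒜std : (n k ℓ t : ℕ) → FamPred n
𝒜std n k ℓ t = 𝒜 k ([[_]] {n} t) ([[_]] {n} ℓ)

ℬstd : (n ℓ t : ℕ) → FamPred n
ℬstd n ℓ t = ℬ ℓ ([[_]] {n} t) ([[_]] {n} ℓ)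

𝒞std : (n k t : ℕ) → FamPred n
𝒞std n k t = 𝒞 k ([[_]] {n} (t + 1))

𝒟std : (n ℓ t : ℕ) → FamPred n
𝒟std n ℓ t = 𝒟 ℓ t ([[_]] {n} (t + 1))

{-# OPTIONS --safe #-}

-- A t-cover of a family is a set of blocks that meets every member in at least t blocks.  Every member
-- of G containing a set T of blocks that is not a t-cover of H contains one of ℓ − t + 1 further blocks of
-- some member of H.  So if r and s are the least sizes of t-covers of G and H, then
--   |G| ≤ (t + 1)^(r − t) (ℓ − t + 1)^(s − t) S(n − s, k − s),
-- and S(m, j) ≥ (2^((m − 1)/(j − 1)) − 1) S(m − 1, j − 1) makes large covers expensive.  At the maximum
-- exactly one family, say G, has t common blocks Z.  Call B a petal if Z ∪ {B} is a t-cover of H: a single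
-- petal leads to 𝒞 and 𝒟, all ℓ − t possible petals lead to 𝒜 and ℬ, and any other number is too small.
-- Finally, the product decreases strictly unless the blocks in question are singletons.

module Submission where

open import Defs
open import Data.Nat.Base hiding (NonTrivial)
open import Data.Nat.Properties
open import Data.Nat.Tactic.RingSolver using (solve-∀)
open import Data.Bool.Base using (Bool; true; false; _∧_; _∨_; not; if_then_else_; T; _xor_)
open import Data.List.Base using (List; []; _∷_; _++_; map; length; filterᵇ; concatMap; allFin; drop; take; upTo; applyUpTo)
open import Data.Product.Base using (_×_; _,_; ∃; proj₁; proj₂)
open import Data.List.Membership.Propositional using (_∈_; lose; find)
open import Data.List.Relation.Unary.Any using (Any; here; there)
open import Data.List.Relation.Unary.All as All using (All; []; _∷_)
open import Data.List.Relation.Unary.AllPairs as AllPairs using (AllPairs; []; _∷_)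
open import Data.List.Relation.Unary.Unique.Propositional using (Unique)
open import Data.Bool.ListAction using (all; any)
open import Relation.Binary.PropositionalEquality hiding (J)
open import Relation.Nullary.Negation using (¬_; contradiction)
open import Data.Bool.Properties using (∨-zeroʳ; ∧-zeroʳ; ∧-comm) renaming (_≟_ to _≟ᵇ_)
open import Data.Empty using (⊥; ⊥-elim)
open import Data.Sum.Base using (_⊎_; inj₁; inj₂)
open import Function.Base using (_∘_)
open import Data.List.Properties using (length-map; length-drop; length-++; take++drop≡id; length-upTo; length-take; map-++; ∷-injective)
open import Data.List.Membership.Propositional.Properties using (∈-map⁻; ∈-allFin; ∈-map⁺; ∈-++⁺ˡ; ∈-++⁺ʳ; ∈-++⁻)
open import Data.Vec.Base as Vec using (Vec; []; _∷_; lookup; zipWith; replicate)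
open import Data.Fin.Base using (Fin; zero; suc; toℕ; fromℕ<)
open import Data.Vec.Properties using (lookup-zipWith; lookup-map; lookup-replicate; lookup∘tabulate; ≡-dec)
open import Data.List.Relation.Unary.Unique.Propositional.Properties as Uniqueₚ using ()
open import Data.List.Relation.Binary.Sublist.Propositional using (_⊆_; []; _∷_; _∷ʳ_; minimum)
open import Relation.Nullary.Decidable.Core using (yes; no)
open import Data.Nat.DivMod using (m*n/n≡m; /-monoˡ-≤; m/n*n≤m)
open import Data.Fin.Properties using (toℕ-fromℕ<; toℕ-injective) renaming (_≟_ to _≟ᶠ_)
open import Data.Fin.Permutation as Perm using (Permutation′; _⟨$⟩ʳ_; _⟨$⟩ˡ_; _∘ₚ_; inverseˡ; inverseʳ)
open import Function.Bundles using (mk⇔; Equivalence)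

-- The scale is X = (t + 1)(k₁ - t + 1). In the product of the two bounds a least cover of t + d
-- blocks costs (t + 1)^d in one factor and (k - t + 1)^d in the other, at most X^d together, while
-- each further fixed block divides a Stirling number by at least X² - 1; the 2 in n ≥ 2L pays for
-- this square. The maximum is never computed, nor are the two kinds of extremal pair compared. Let
-- p count the k-partitions with t + 1 prescribed singletons, q the ℓ-partitions with t of them.
-- Bonferroni gives explicit pairs with products at least (t + 1 - 1/16)pq and, for k ≥ t + 3, (ℓ -
-- t - 1/8)pq. Every wrong configuration falls below one of these; the rest is contained in the
-- right shape, and maximality fills it up. The obstacle is size t + 2, where t + 1 blocks determine
-- a partition and fixing more gains nothing. For k = ℓ = t + 2 a direct argument compares 2 with t
-- + 15/16, hence needs t ≥ 2 and loses (3, 3). For unequal sizes with t blocks common to the family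
-- of size t + 2, an upper bound on ratios of Stirling numbers shows that the product is too small.

private variable
  𝑨 𝑩 : Set
  n : ℕ

-- Linear-arithmetic certificate: u ≤ v is a combination of the hypotheses, and the ring identity shows the goal.
≤-cert : ∀ {L R u v} c → u ≤ v → R + u ≡ L + v + c → L ≤ R
≤-cert {L} {R} {u} {v} c u≤v e = +-cancelʳ-≤ u L R (begin
  L + u     ≤⟨ +-monoʳ-≤ L u≤v ⟩
  L + v     ≤⟨ m≤m+n (L + v) c ⟩
  L + v + c ≡⟨ e ⟨
  R + u     ∎)
  where open ≤-Reasoning

-- Finite sums, counting, union bound and Bonferroni inequality.

⟦_⟧ : Bool → ℕ
⟦ b ⟧ = if b then 1 else 0

∑ : List 𝑨 → (𝑨 → ℕ) → ℕ
∑ []       f = 0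
∑ (x ∷ xs) f = f x + ∑ xs f

count-∑ : ∀ (p : 𝑨 → Bool) xs → count p xs ≡ ∑ xs (λ x → ⟦ p x ⟧)
count-∑ p []       = refl
count-∑ p (x ∷ xs) with p x
... | true  = cong suc (count-∑ p xs)
... | false = count-∑ p xs

count-∷ : ∀ (p : 𝑨 → Bool) x xs → count p (x ∷ xs) ≡ ⟦ p x ⟧ + count p xs
count-∷ p x xs with p x
... | true  = refl
... | false = refl

∑-mono : ∀ (xs : List 𝑨) {f g : 𝑨 → ℕ} → (∀ x → x ∈ xs → f x ≤ g x) → ∑ xs f ≤ ∑ xs g
∑-mono []       h = z≤n
∑-mono (x ∷ xs) h = +-mono-≤ (h x (here refl)) (∑-mono xs (λ y y∈ → h y (there y∈)))

∑-cong : ∀ (xs : List 𝑨) {f g : 𝑨 → ℕ} → (∀ x → x ∈ xs → f x ≡ g x) → ∑ xs f ≡ ∑ xs g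
∑-cong []       h = refl
∑-cong (x ∷ xs) h = cong₂ _+_ (h x (here refl)) (∑-cong xs (λ y y∈ → h y (there y∈)))

∑-const : ∀ (xs : List 𝑨) c → ∑ xs (λ _ → c) ≡ length xs * c
∑-const []       c = refl
∑-const (x ∷ xs) c = cong (c +_) (∑-const xs c)

∑-+ : ∀ (xs : List 𝑨) (f g : 𝑨 → ℕ) → ∑ xs (λ x → f x + g x) ≡ ∑ xs f + ∑ xs g
∑-+ []       f g = refl
∑-+ (x ∷ xs) f g rewrite ∑-+ xs f g = lem (f x) (g x) (∑ xs f) (∑ xs g)
  where lem : ∀ a b c d → a + b + (c + d) ≡ a + c + (b + d)
        lem = solve-∀

∑-*ˡ : ∀ c (xs : List 𝑨) (f : 𝑨 → ℕ) → ∑ xs (λ x → c * f x) ≡ c * ∑ xs f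
∑-*ˡ c []       f = sym (*-zeroʳ c)
∑-*ˡ c (x ∷ xs) f rewrite ∑-*ˡ c xs f = sym (*-distribˡ-+ c (f x) (∑ xs f))

∑-++ : ∀ (xs ys : List 𝑨) (f : 𝑨 → ℕ) → ∑ (xs ++ ys) f ≡ ∑ xs f + ∑ ys f
∑-++ []       ys f = refl
∑-++ (x ∷ xs) ys f rewrite ∑-++ xs ys f = sym (+-assoc (f x) _ _)

∑-map : ∀ (g : 𝑨 → 𝑩) xs (f : 𝑩 → ℕ) → ∑ (map g xs) f ≡ ∑ xs (λ x → f (g x))
∑-map g []       f = refl
∑-map g (x ∷ xs) f = cong (f (g x) +_) (∑-map g xs f)

∑-concatMap : ∀ (g : 𝑨 → List 𝑩) xs (f : 𝑩 → ℕ) → ∑ (concatMap g xs) f ≡ ∑ xs (λ x → ∑ (g x) f)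
∑-concatMap g []       f = refl
∑-concatMap g (x ∷ xs) f rewrite ∑-++ (g x) (concatMap g xs) f = cong (∑ (g x) f +_) (∑-concatMap g xs f)

∑-swap : ∀ (xs : List 𝑨) (ys : List 𝑩) (f : 𝑨 → 𝑩 → ℕ) →
         ∑ xs (λ x → ∑ ys (f x)) ≡ ∑ ys (λ y → ∑ xs (λ x → f x y))
∑-swap []       ys f = sym (trans (∑-const ys 0) (*-zeroʳ (length ys)))
∑-swap (x ∷ xs) ys f rewrite ∑-swap xs ys f = sym (∑-+ ys (f x) _)

⟦⟧≤1 : ∀ b → ⟦ b ⟧ ≤ 1
⟦⟧≤1 true  = ≤-refl
⟦⟧≤1 false = z≤n

⟦⟧-mono : ∀ {b c} → (b ≡ true → c ≡ true) → ⟦ b ⟧ ≤ ⟦ c ⟧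
⟦⟧-mono {false} h = z≤n
⟦⟧-mono {true} {true} h = ≤-refl
⟦⟧-mono {true} {false} h with () ← h refl

count-mono : ∀ {p q : 𝑨 → Bool} (xs : List 𝑨) → (∀ x → x ∈ xs → p x ≡ true → q x ≡ true) →
             count p xs ≤ count q xs
count-mono {p = p} {q} xs h = subst₂ _≤_ (sym (count-∑ p xs)) (sym (count-∑ q xs))
  (∑-mono xs (λ x x∈ → ⟦⟧-mono (h x x∈)))

count-≤length : ∀ (p : 𝑨 → Bool) xs → count p xs ≤ length xs
count-≤length p []       = z≤n
count-≤length p (x ∷ xs) rewrite count-∷ p x xs = +-mono-≤ (⟦⟧≤1 (p x)) (count-≤length p xs)

count-++ : ∀ (p : 𝑨 → Bool) xs ys → count p (xs ++ ys) ≡ count p xs + count p ys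
count-++ p xs ys rewrite count-∑ p (xs ++ ys) | count-∑ p xs | count-∑ p ys = ∑-++ xs ys _

count-map : ∀ (p : 𝑩 → Bool) (g : 𝑨 → 𝑩) xs → count p (map g xs) ≡ count (p ∘ g) xs
count-map p g xs rewrite count-∑ p (map g xs) | count-∑ (p ∘ g) xs = ∑-map g xs _

count-cong : ∀ {p q : 𝑨 → Bool} (xs : List 𝑨) → (∀ x → x ∈ xs → p x ≡ q x) → count p xs ≡ count q xs
count-cong {p = p} {q} xs h rewrite count-∑ p xs | count-∑ q xs = ∑-cong xs (λ x x∈ → cong ⟦_⟧ (h x x∈))

count-all : ∀ {p : 𝑨 → Bool} (xs : List 𝑨) → (∀ x → x ∈ xs → p x ≡ true) → count p xs ≡ length xs
count-all {p = p} xs h = trans (count-∑ p xs) (trans (∑-cong xs (λ x x∈ → cong ⟦_⟧ (h x x∈)))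
  (trans (∑-const xs 1) (*-identityʳ _)))

count-none : ∀ {p : 𝑨 → Bool} (xs : List 𝑨) → (∀ x → x ∈ xs → p x ≡ false) → count p xs ≡ 0
count-none {p = p} xs h = trans (count-∑ p xs) (trans (∑-cong xs (λ x x∈ → cong ⟦_⟧ (h x x∈)))
  (trans (∑-const xs 0) (*-zeroʳ (length xs))))

count-∃ : ∀ (p : 𝑨 → Bool) xs → 1 ≤ count p xs → ∃ λ x → x ∈ xs × p x ≡ true
count-∃ p (x ∷ xs) h with p x in e
... | true  = x , here refl , e
... | false with y , y∈ , py ← count-∃ p xs h = y , there y∈ , py

count-pos : ∀ (p : 𝑨 → Bool) {xs x} → x ∈ xs → p x ≡ true → 1 ≤ count p xs
count-pos p {y ∷ xs} (here refl) px rewrite px = s≤s z≤n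
count-pos p {y ∷ xs} (there x∈) px rewrite count-∷ p y xs = ≤-trans (count-pos p x∈ px) (m≤n+m _ ⟦ p y ⟧)

count-not : ∀ (p : 𝑨 → Bool) xs → count p xs + count (not ∘ p) xs ≡ length xs
count-not p []       = refl
count-not p (x ∷ xs) rewrite count-∷ p x xs | count-∷ (not ∘ p) x xs with p x
... | true  = cong suc (count-not p xs)
... | false = trans (+-suc _ _) (cong suc (count-not p xs))

count-full : ∀ (p : 𝑨 → Bool) xs → length xs ≤ count p xs → ∀ x → x ∈ xs → p x ≡ true
count-full p xs h x x∈ with p x in e
... | true  = refl
... | false = contradiction h (<⇒≱ (≤-trans (≤-trans (≤-reflexive (+-comm 1 _))
                (+-monoʳ-≤ (count p xs) (count-pos (not ∘ p) x∈ (cong not e)))) (≤-reflexive (count-not p xs))))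

count-filter : ∀ (p q : 𝑨 → Bool) xs → count p (filterᵇ q xs) ≡ count (λ x → q x ∧ p x) xs
count-filter p q []       = refl
count-filter p q (x ∷ xs) with q x
... | false = count-filter p q xs
... | true rewrite count-∷ p x (filterᵇ q xs) with p x
...   | true  = cong suc (count-filter p q xs)
...   | false = count-filter p q xs

∈-filterᵇ⁺ : ∀ (p : 𝑨 → Bool) {xs x} → x ∈ xs → p x ≡ true → x ∈ filterᵇ p xs
∈-filterᵇ⁺ p {y ∷ xs} (here refl) px rewrite px = here refl
∈-filterᵇ⁺ p {y ∷ xs} (there x∈) px with p y
... | true  = there (∈-filterᵇ⁺ p x∈ px)
... | false = ∈-filterᵇ⁺ p x∈ px

∈-filterᵇ⁻ : ∀ (p : 𝑨 → Bool) {xs x} → x ∈ filterᵇ p xs → x ∈ xs × p x ≡ true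
∈-filterᵇ⁻ p {y ∷ xs} x∈ with p y in e
∈-filterᵇ⁻ p {y ∷ xs} (here refl) | true = here refl , e
∈-filterᵇ⁻ p {y ∷ xs} (there x∈) | true with a , b ← ∈-filterᵇ⁻ p x∈ = there a , b
∈-filterᵇ⁻ p {y ∷ xs} x∈ | false with a , b ← ∈-filterᵇ⁻ p x∈ = there a , b

Unique-filterᵇ : ∀ (p : 𝑨 → Bool) {xs} → Unique xs → Unique (filterᵇ p xs)
Unique-filterᵇ p {[]} [] = []
Unique-filterᵇ p {x ∷ xs} (a ∷ u) with p x
... | true  = All.tabulate (λ y∈ → All.lookup a (proj₁ (∈-filterᵇ⁻ p y∈))) ∷ Unique-filterᵇ p u
... | false = Unique-filterᵇ p u

∈-remove : ∀ {ys : List 𝑨} {x} (x∈ : x ∈ ys) → ∃ λ zs → suc (length zs) ≡ length ys ×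
           (∀ {y} → y ∈ ys → ¬ x ≡ y → y ∈ zs)
∈-remove {ys = x ∷ ys} (here refl) = ys , refl , λ { (here e) ne → contradiction (sym e) ne ; (there y∈) _ → y∈ }
∈-remove {ys = y ∷ ys} (there x∈) with zs , e , h ← ∈-remove x∈ =
  y ∷ zs , cong suc e , λ { (here e) _ → here e ; (there y∈) ne → there (h y∈ ne) }

Unique-⊆⇒length≤ : ∀ {xs ys : List 𝑨} → Unique xs → (∀ x → x ∈ xs → x ∈ ys) → length xs ≤ length ys
Unique-⊆⇒length≤ [] h = z≤n
Unique-⊆⇒length≤ {xs = x ∷ xs} (a ∷ u) h with zs , e , g ← ∈-remove (h x (here refl)) =
  ≤-trans (s≤s (Unique-⊆⇒length≤ u (λ y y∈ → g (h y (there y∈)) (All.lookup a y∈)))) (≤-reflexive e)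

∧-true : ∀ {a b} → a ∧ b ≡ true → a ≡ true × b ≡ true
∧-true {true} {true} _ = refl , refl

∧-intro : ∀ {a b} → a ≡ true → b ≡ true → a ∧ b ≡ true
∧-intro refl refl = refl

∨-true : ∀ {a b} → a ∨ b ≡ true → a ≡ true ⊎ b ≡ true
∨-true {true} _ = inj₁ refl
∨-true {false} h = inj₂ h

not⇒¬ : ∀ {b} → not b ≡ true → ¬ b ≡ true
not⇒¬ {false} _ ()

∉⇒All≢ : ∀ {xs : List 𝑨} {x} → ¬ x ∈ xs → All (λ y → ¬ x ≡ y) xs
∉⇒All≢ {xs = xs} h = All.tabulate (λ y∈ e → h (subst (_∈ xs) (sym e) y∈))

all-∈ : ∀ (p : 𝑨 → Bool) {xs} → all p xs ≡ true → ∀ {x} → x ∈ xs → p x ≡ true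
all-∈ p h (here refl) = proj₁ (∧-true h)
all-∈ p {y ∷ xs} h (there x∈) = all-∈ p (proj₂ (∧-true {p y} h)) x∈

∈-all : ∀ (p : 𝑨 → Bool) xs → (∀ {x} → x ∈ xs → p x ≡ true) → all p xs ≡ true
∈-all p []       h = refl
∈-all p (x ∷ xs) h = ∧-intro (h (here refl)) (∈-all p xs (h ∘ there))

any-∈ : ∀ (p : 𝑨 → Bool) xs → any p xs ≡ true → ∃ λ x → x ∈ xs × p x ≡ true
any-∈ p (x ∷ xs) h with ∨-true {p x} h
... | inj₁ px = x , here refl , px
... | inj₂ h′ with y , y∈ , py ← any-∈ p xs h′ = y , there y∈ , py

∈-any : ∀ (p : 𝑨 → Bool) {xs x} → x ∈ xs → p x ≡ true → any p xs ≡ true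
∈-any p (here refl) px rewrite px = refl
∈-any p {y ∷ xs} (there x∈) px rewrite ∈-any p x∈ px = ∨-zeroʳ (p y)

≡false : ∀ {b} → ¬ b ≡ true → b ≡ false
≡false {true}  h = contradiction refl h
≡false {false} h = refl

union-bound : ∀ (p : 𝑨 → Bool) (E : 𝑩 → 𝑨 → Bool) (L : List 𝑩) (w : 𝑩 → ℕ) xs →
              (∀ x → x ∈ xs → p x ≡ true → ∃ λ b → b ∈ L × E b x ≡ true) →
              (∀ b → b ∈ L → count (E b) xs ≤ w b) → count p xs ≤ ∑ L w
union-bound p E L w xs cov bnd = begin
  count p xs                              ≡⟨ count-∑ p xs ⟩
  ∑ xs (λ x → ⟦ p x ⟧)                    ≤⟨ ∑-mono xs pt ⟩
  ∑ xs (λ x → ∑ L (λ b → ⟦ E b x ⟧))      ≡⟨ ∑-swap xs L _ ⟩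
  ∑ L (λ b → ∑ xs (λ x → ⟦ E b x ⟧))      ≡⟨ ∑-cong L (λ b _ → count-∑ (E b) xs) ⟨
  ∑ L (λ b → count (E b) xs)              ≤⟨ ∑-mono L bnd ⟩
  ∑ L w                                   ∎
  where
  open ≤-Reasoning
  pt : ∀ x → x ∈ xs → ⟦ p x ⟧ ≤ ∑ L (λ b → ⟦ E b x ⟧)
  pt x x∈ with p x in e
  ... | false = z≤n
  ... | true with b , b∈ , Eb ← cov x x∈ e =
    ≤-trans (count-pos (λ b → E b x) b∈ Eb) (≤-reflexive (count-∑ _ L))

tri : ℕ → ℕ
tri zero    = 0
tri (suc r) = tri r + r

count-∨∧ : ∀ (p q : 𝑨 → Bool) xs →
           count p xs + count q xs ≡ count (λ x → p x ∨ q x) xs + count (λ x → p x ∧ q x) xs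
count-∨∧ p q xs rewrite count-∑ p xs | count-∑ q xs | count-∑ (λ x → p x ∨ q x) xs | count-∑ (λ x → p x ∧ q x) xs
  = trans (sym (∑-+ xs _ _)) (trans (∑-cong xs (λ x _ → lem (p x) (q x))) (∑-+ xs _ _))
  where lem : ∀ a b → ⟦ a ⟧ + ⟦ b ⟧ ≡ ⟦ a ∨ b ⟧ + ⟦ a ∧ b ⟧
        lem true true = refl
        lem true false = refl
        lem false true = refl
        lem false false = refl

-- Induction on `L`: the new event overlaps the union of the later ones in at most `length L` pairs
-- of weight `w`, so the loss adds up to `tri`, the number of pairs. This truncated
-- inclusion-exclusion gives the lower bounds for `𝒟f` and `𝒜f`.
bonferroni : ∀ (E : 𝑩 → 𝑨 → Bool) (L : List 𝑩) v w xs →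
             (∀ b → b ∈ L → v ≤ count (E b) xs) →
             AllPairs (λ b b′ → count (λ x → E b x ∧ E b′ x) xs ≤ w) L →
             length L * v ≤ count (λ x → any (λ b → E b x) L) xs + tri (length L) * w
bonferroni E [] v w xs lo [] = z≤n
bonferroni E (b ∷ L) v w xs lo (a ∷ ps) = begin
  v + length L * v                     ≤⟨ +-mono-≤ (lo b (here refl)) (bonferroni E L v w xs (λ b b∈ → lo b (there b∈)) ps) ⟩
  cb + (cL + tri (length L) * w)       ≡⟨ +-assoc cb cL _ ⟨
  cb + cL + tri (length L) * w         ≡⟨ cong (_+ tri (length L) * w) (count-∨∧ (E b) _ xs) ⟩
  c∨ + c∧ + tri (length L) * w         ≤⟨ +-monoˡ-≤ (tri (length L) * w) (+-monoʳ-≤ c∨ c∧≤) ⟩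
  c∨ + length L * w + tri (length L) * w ≡⟨ lem c∨ (length L) w (tri (length L)) ⟩
  c∨ + (tri (length L) + length L) * w ∎
  where
  open ≤-Reasoning
  cb = count (E b) xs
  cL = count (λ x → any (λ b → E b x) L) xs
  c∨ = count (λ x → E b x ∨ any (λ b → E b x) L) xs
  c∧ = count (λ x → E b x ∧ any (λ b → E b x) L) xs
  c∧≤ : c∧ ≤ length L * w
  c∧≤ = ≤-trans (union-bound _ (λ b′ x → E b x ∧ E b′ x) L (λ _ → w) xs
    (λ x _ h → let b′ , b′∈ , e = any-∈ (λ b → E b x) L (proj₂ (∧-true {E b x} h)) in
               b′ , b′∈ , ∧-intro (proj₁ (∧-true {E b x} h)) e)
    (λ b′ b′∈ → All.lookup a b′∈)) (≤-reflexive (∑-const L w))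
  lem : ∀ c l w r → c + l * w + r * w ≡ c + (r + l) * w
  lem = solve-∀

-- Stirling numbers of the second kind

S : ℕ → ℕ → ℕ
S zero    zero    = 1
S zero    (suc k) = 0
S (suc n) zero    = 0
S (suc n) (suc k) = suc k * S n (suc k) + S n k

-- With c = n − k, A c j is the number of k-partitions of [n] containing k − 1 − j given singletons.
A : ℕ → ℕ → ℕ
A c j = S (suc (c + j)) (suc j)

S-monoˡ : ∀ {m n} j → m ≤ n → S m (suc j) ≤ S n (suc j)
S-monoˡ {m} {n} j m≤n with d , refl ← m≤n⇒∃[o]m+o≡n m≤n = go m d
  where
  go : ∀ m d → S m (suc j) ≤ S (m + d) (suc j)
  go m zero    = ≤-reflexive (cong (λ x → S x (suc j)) (sym (+-identityʳ m)))
  go m (suc d) = ≤-trans (go m d) (≤-trans (≤-trans (m≤m+n _ (j * S (m + d) (suc j))) (m≤m+n _ (S (m + d) j)))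
    (≤-reflexive (cong (λ x → S x (suc j)) (sym (+-suc m d)))))

S-zero : ∀ {n k} → n < k → S n k ≡ 0
S-zero {zero}  {suc k} _         = refl
S-zero {suc n} {suc k} (s≤s n<k) rewrite S-zero {n} {suc k} (m<n⇒m<1+n n<k) | S-zero {n} {k} n<k | *-zeroʳ k = refl

S-diag : ∀ n → S n n ≡ 1
S-diag zero    = refl
S-diag (suc n) rewrite S-zero {n} {suc n} ≤-refl | S-diag n | *-zeroʳ n = refl

S-one : ∀ n → S (suc n) 1 ≡ 1
S-one zero    = refl
S-one (suc n) rewrite S-one n = refl

A-zero : ∀ c → A c 0 ≡ 1
A-zero c = S-one (c + 0)

A-pos : ∀ c j → 1 ≤ A c j
A-pos c j = ≤-trans (≤-reflexive (sym (S-diag (suc j)))) (S-monoˡ j (s≤s (m≤n+m j c)))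

-- The inequality of arithmetic and geometric means.

private
  2ab≤a²+b²′ : ∀ a d → 2 * (a * (a + d)) ≤ a * a + (a + d) * (a + d)
  2ab≤a²+b²′ a d = ≤-cert (d * d) (z≤n {0}) (lem a d)
    where lem : ∀ a d → a * a + (a + d) * (a + d) + 0 ≡ 2 * (a * (a + d)) + 0 + d * d
          lem = solve-∀

2ab≤a²+b² : ∀ a b → 2 * (a * b) ≤ a * a + b * b
2ab≤a²+b² a b with ≤-total a b
... | inj₁ a≤b with d , refl ← m≤n⇒∃[o]m+o≡n a≤b = 2ab≤a²+b²′ a d
... | inj₂ b≤a with d , refl ← m≤n⇒∃[o]m+o≡n b≤a =
  ≤-trans (≤-reflexive (cong (2 *_) (*-comm (b + d) b))) (≤-trans (2ab≤a²+b²′ b d) (≤-reflexive (+-comm (b * b) _)))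

-- Weighted AM-GM of one `p` against k copies of `q`. The step adds p times the previous inequality
-- to (k + 1) q^k times 2pq ≤ p² + q².
young : ∀ p q k → suc k * (p * q ^ k) ≤ p ^ suc k + k * q ^ suc k
young p q zero    = ≤-reflexive (trans (+-identityʳ _) (sym (+-identityʳ _)))
young p q (suc k) = ≤-cert 0 (+-mono-≤ (*-monoʳ-≤ (suc k * q ^ k) (2ab≤a²+b² p q)) (*-monoʳ-≤ p (young p q k)))
    (lem p q k (q ^ k) (p ^ suc k))
  where
  lem : ∀ p q k Q P → p * P + suc k * (q * (q * Q)) + (suc k * Q * (2 * (p * q)) + p * (suc k * (p * Q)))
        ≡ suc (suc k) * (p * (q * Q)) + (suc k * Q * (p * p + q * q) + p * (P + k * (q * Q))) + 0
  lem = solve-∀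

^-distribʳ-* : ∀ k a b → (a * b) ^ k ≡ a ^ k * b ^ k
^-distribʳ-* zero    a b = refl
^-distribʳ-* (suc k) a b rewrite ^-distribʳ-* k a b = [m*n]*[o*p]≡[m*o]*[n*p] a b (a ^ k) (b ^ k)

^-nonZero : ∀ m n → 1 ≤ m → NonZero (m ^ n)
^-nonZero m n h = >-nonZero (≤-trans (≤-reflexive (sym (^-zeroˡ n))) (^-monoˡ-≤ n h))

^-cancelˡ-≤ : ∀ {a b} k → a ^ suc k ≤ b ^ suc k → a ≤ b
^-cancelˡ-≤ {a} {b} k h with ≤-<-connex a b
... | inj₁ a≤b = a≤b
... | inj₂ b<a = contradiction h (<⇒≱ (^-monoˡ-< (suc k) b<a))

prodV : ∀ {k} → Vec ℕ k → ℕ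
prodV []      = 1
prodV (x ∷ v) = x * prodV v

am-gm : ∀ {k} (v : Vec ℕ k) → k ^ k * prodV v ≤ Vec.sum v ^ k
am-gm []          = ≤-refl
am-gm (x ∷ [])    = ≤-reflexive (lem x)
  where lem : ∀ x → 1 * 1 * (x * 1) ≡ (x + 0) * 1
        lem = solve-∀
am-gm {suc k@(suc _)} (x ∷ v) =
  *-cancelˡ-≤ (k ^ k) ⦃ ^-nonZero k k (s≤s z≤n) ⦄ (*-cancelˡ-≤ k (≤-cert 0
    (+-mono-≤ (young p q k) (*-monoʳ-≤ (k * (suc k ^ suc k) * x) (am-gm v)))
    (trans (cong₂ (λ X Y → k * (k ^ k * (x + s) ^ suc k) + (suc k * (p * X) + Y)) (^-distribʳ-* k (suc k) s) refl)
    (trans (lem k x (suc k ^ k) (s ^ k) (k ^ k) s ((x + s) ^ suc k) (prodV v))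
      (cong₂ (λ X Y → k * (k ^ k * (suc k ^ suc k * (x * prodV v))) + (X + k * Y + k * suc k ^ suc k * x * s ^ k) + 0)
        (sym (^-distribʳ-* (suc k) k (x + s))) (sym (^-distribʳ-* (suc k) (suc k) s)))))))
  where
  s = Vec.sum v
  -- `p ≡ q` exactly when x is the mean s / k of the other entries, the equality case. Clearing
  -- denominators leaves the factor k · k^k that is cancelled above.
  p = k * (x + s)
  q = suc k * s
  lem : ∀ k x K Sk Kk s XS pv → k * (Kk * XS) + (suc k * (k * (x + s) * (K * Sk)) + k * (suc k * K) * x * (Kk * pv))
      ≡ k * (Kk * (suc k * K * (x * pv))) + (k * Kk * XS + k * (suc k * K * (s * Sk)) + k * (suc k * K) * x * Sk) + 0
  lem = solve-∀

prod≥⇒sum≥ : ∀ {k} (v : Vec ℕ k) Y → Y ^ k ≤ prodV v → k * Y ≤ Vec.sum v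
prod≥⇒sum≥ {zero}  v Y h = z≤n
prod≥⇒sum≥ {suc k} v Y h = ^-cancelˡ-≤ k (≤-trans (≤-reflexive (^-distribʳ-* (suc k) (suc k) Y))
  (≤-trans (*-monoʳ-≤ (suc k ^ suc k) h) (am-gm v)))

-- Ratios of consecutive Stirling numbers along a diagonal.

incs : ∀ {k} → Vec ℕ k → List (Vec ℕ k)
incs []      = []
incs (x ∷ v) = (suc x ∷ v) ∷ map (x ∷_) (incs v)

-- The sum of φ over the block-size vectors of all k-partitions of [n], blocks being ordered by their maxima.
E : (n k : ℕ) → (Vec ℕ k → ℕ) → ℕ
E zero    zero    φ = φ []
E zero    (suc k) φ = 0
E (suc n) zero    φ = 0
E (suc n) (suc k) φ = E n (suc k) (λ v → ∑ (incs v) φ) + E n k (λ v → φ (1 ∷ v))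

E-cong : ∀ n k {φ ψ : Vec ℕ k → ℕ} → (∀ v → φ v ≡ ψ v) → E n k φ ≡ E n k ψ
E-cong zero    zero    h = h []
E-cong zero    (suc k) h = refl
E-cong (suc n) zero    h = refl
E-cong (suc n) (suc k) h =
  cong₂ _+_ (E-cong n (suc k) (λ v → ∑-cong (incs v) (λ w _ → h w))) (E-cong n k (λ v → h (1 ∷ v)))

E-+ : ∀ n k (φ ψ : Vec ℕ k → ℕ) → E n k (λ v → φ v + ψ v) ≡ E n k φ + E n k ψ
E-+ zero    zero    φ ψ = refl
E-+ zero    (suc k) φ ψ = refl
E-+ (suc n) zero    φ ψ = refl
E-+ (suc n) (suc k) φ ψ
  rewrite E-cong n (suc k) (λ v → ∑-+ (incs v) φ ψ)
        | E-+ n (suc k) (λ v → ∑ (incs v) φ) (λ v → ∑ (incs v) ψ)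
        | E-+ n k (λ v → φ (1 ∷ v)) (λ v → ψ (1 ∷ v))
  = lem (E n (suc k) (λ v → ∑ (incs v) φ)) _ (E n k (λ v → φ (1 ∷ v))) _
  where lem : ∀ a b c d → a + b + (c + d) ≡ a + c + (b + d)
        lem = solve-∀

E-*ˡ : ∀ c n k (φ : Vec ℕ k → ℕ) → E n k (λ v → c * φ v) ≡ c * E n k φ
E-*ˡ c zero    zero    φ = refl
E-*ˡ c zero    (suc k) φ = sym (*-zeroʳ c)
E-*ˡ c (suc n) zero    φ = sym (*-zeroʳ c)
E-*ˡ c (suc n) (suc k) φ
  rewrite E-cong n (suc k) (λ v → ∑-*ˡ c (incs v) φ)
        | E-*ˡ c n (suc k) (λ v → ∑ (incs v) φ) | E-*ˡ c n k (λ v → φ (1 ∷ v)) = sym (*-distribˡ-+ c _ _)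

length-incs : ∀ {k} (v : Vec ℕ k) → length (incs v) ≡ k
length-incs []      = refl
length-incs (x ∷ v) = cong suc (trans (length-map (x ∷_) (incs v)) (length-incs v))

sum-incs : ∀ {k} (v w : Vec ℕ k) → w ∈ incs v → Vec.sum w ≡ suc (Vec.sum v)
sum-incs (x ∷ v) w (here refl) = refl
sum-incs (x ∷ v) w (there w∈) with u , u∈ , refl ← ∈-map⁻ (x ∷_) w∈ =
  trans (cong (x +_) (sum-incs v u u∈)) (+-suc x _)

E-const : ∀ n k c → E n k (λ _ → c) ≡ c * S n k
E-const zero    zero    c = sym (*-identityʳ c)
E-const zero    (suc k) c = sym (*-zeroʳ c)
E-const (suc n) zero    c = sym (*-zeroʳ c)
E-const (suc n) (suc k) c
  rewrite E-cong n (suc k) (λ v → trans (∑-const (incs v) c) (cong (_* c) (length-incs v)))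
        | E-const n (suc k) (suc k * c) | E-const n k c = lem k c (S n (suc k)) (S n k)
  where lem : ∀ k c a b → (c + k * c) * a + c * b ≡ c * (a + k * a + b)
        lem = solve-∀

E-lower : ∀ n k {φ : Vec ℕ k → ℕ} c → (∀ v → Vec.sum v ≡ n → c ≤ φ v) → c * S n k ≤ E n k φ
E-lower zero    zero    c h = ≤-trans (≤-reflexive (*-identityʳ c)) (h [] refl)
E-lower zero    (suc k) c h = ≤-reflexive (*-zeroʳ c)
E-lower (suc n) zero    c h = ≤-reflexive (*-zeroʳ c)
E-lower (suc n) (suc k) {φ} c h = ≤-trans (≤-reflexive (lem k c (S n (suc k)) (S n k)))
    (+-mono-≤ (E-lower n (suc k) (suc k * c) step) (E-lower n k c (λ v e → h (1 ∷ v) (cong suc e))))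
  where
  lem : ∀ k c a b → c * (a + k * a + b) ≡ (c + k * c) * a + c * b
  lem = solve-∀
  step : ∀ v → Vec.sum v ≡ n → suc k * c ≤ ∑ (incs v) φ
  step v e = ≤-trans (≤-reflexive (sym (trans (∑-const (incs v) c) (cong (_* c) (length-incs v)))))
    (∑-mono (incs v) (λ w w∈ → h w (trans (sum-incs v w w∈) (cong suc e))))

pow2 : ∀ {k} → Vec ℕ k → ℕ
pow2 v = Vec.sum (Vec.map (2 ^_) v)

-- Incrementing an entry adds its own power of two, so the k increments together contribute `pow2 v`
-- once more.
∑-incs-pow2 : ∀ {k} (v : Vec ℕ k) → ∑ (incs v) pow2 ≡ suc k * pow2 v
∑-incs-pow2 []              = refl
∑-incs-pow2 {suc k} (x ∷ v)
  rewrite ∑-map (x ∷_) (incs v) pow2 | ∑-+ (incs v) (λ _ → 2 ^ x) pow2 | ∑-const (incs v) (2 ^ x)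
        | length-incs v | ∑-incs-pow2 v = lem k (2 ^ x) (pow2 v)
  where lem : ∀ k a b → a + (a + 0) + b + (k * a + suc k * b) ≡ suc (suc k) * (a + b)
        lem = solve-∀

-- Double counting: splitting a subset E ≠ ∅ off a block B and replacing B by (B ∖ E) ∪ {n} turns a
-- k-partition of [n − 1] into a (k + 1)-partition of [n]; each of the latter arises k times.
E-pow2 : ∀ n k → E n k pow2 ≡ k * (S (suc n) (suc k) + S n k)
E-pow2 zero    zero    = refl
E-pow2 zero    (suc k) = sym (trans (cong (suc k *_) (lem k)) (*-zeroʳ k))
  where lem : ∀ k → k * 0 + 0 + 0 ≡ 0
        lem = solve-∀
E-pow2 (suc n) zero    = refl
E-pow2 (suc n) (suc k)
  rewrite E-cong n (suc k) ∑-incs-pow2 | E-*ˡ (suc (suc k)) n (suc k) pow2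
        | E-+ n k (λ _ → 2) pow2 | E-const n k 2 | E-pow2 n (suc k) | E-pow2 n k = lem k (S n (suc (suc k))) (S n (suc k)) (S n k)
  where
  lem : ∀ k a b c → suc (suc k) * (suc k * (suc (suc k) * a + b + b)) + (2 * c + k * (suc k * b + c + c))
      ≡ suc k * (suc (suc k) * (suc (suc k) * a + b) + (suc k * b + c) + (suc k * b + c))
  lem = solve-∀

prod-pow2 : ∀ {k} (v : Vec ℕ k) → prodV (Vec.map (2 ^_) v) ≡ 2 ^ Vec.sum v
prod-pow2 []      = refl
prod-pow2 (x ∷ v) = trans (cong (2 ^ x *_) (prod-pow2 v)) (sym (^-distribˡ-+-* 2 x (Vec.sum v)))

-- By `E-pow2`, r + 1 times the right side is the sum of 2^|B| over all blocks of all (r +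
-- 1)-partitions of N = c + r + 1 points. In each partition the product of these powers is 2^N ≥
-- Y^(r + 1), so by AM-GM their sum is at least (r + 1)Y.
A-ratio : ∀ c r Y → Y ^ suc r ≤ 2 ^ (c + suc r) → Y * A c r ≤ A c (suc r) + A c r
A-ratio c r Y h = *-cancelˡ-≤ (suc r) (begin
  suc r * (Y * A c r)           ≡⟨ cong (λ x → suc r * (Y * S x (suc r))) (sym (+-suc c r)) ⟩
  suc r * (Y * S N (suc r))     ≡⟨ *-assoc (suc r) Y _ ⟨
  suc r * Y * S N (suc r)       ≤⟨ E-lower N (suc r) (suc r * Y) big ⟩
  E N (suc r) pow2              ≡⟨ E-pow2 N (suc r) ⟩
  suc r * (A c (suc r) + S N (suc r)) ≡⟨ cong (λ x → suc r * (A c (suc r) + S x (suc r))) (+-suc c r) ⟩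
  suc r * (A c (suc r) + A c r) ∎)
  where
  open ≤-Reasoning
  N = c + suc r
  big : ∀ v → Vec.sum v ≡ N → suc r * Y ≤ pow2 v
  big v e = prod≥⇒sum≥ (Vec.map (2 ^_) v) Y
    (≤-trans h (≤-reflexive (trans (cong (2 ^_) (sym e)) (sym (prod-pow2 v)))))

-- Unrolling the recursion, A c (r + 1) is the sum over a ≤ c of (r + 2)^a A (c - a) r, and (r +
-- 1)^a A (c - a) r ≤ A c r. `D` is the resulting geometric sum, in closed form in `D-eq`.
A-ratio-upper : ∀ c r → A c (suc r) * suc r ^ c ≤ suc (suc r) ^ suc c * A c r
A-ratio-upper c r = ≤-trans (go c) (*-monoˡ-≤ (A c r) (≤-trans (m≤m+n (D c) _) (≤-reflexive (D-eq c))))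
  where
  D : ℕ → ℕ
  D zero    = 1
  D (suc d) = suc (suc r) * D d + suc r ^ suc d
  D-eq : ∀ d → D d + suc r ^ suc d ≡ suc (suc r) ^ suc d
  D-eq zero    = lem r where lem : ∀ r → 1 + (1 + r) * 1 ≡ (2 + r) * 1
                             lem = solve-∀
  D-eq (suc d) rewrite sym (D-eq d) = lem r (D d) (suc r ^ suc d)
    where lem : ∀ r D x → (2 + r) * D + x + (1 + r) * x ≡ (2 + r) * (D + x)
          lem = solve-∀
  go : ∀ d → A d (suc r) * suc r ^ d ≤ D d * A d r
  go zero    = ≤-reflexive (trans (*-identityʳ _) (trans (S-diag (suc (suc r))) (sym (trans (+-identityʳ _) (S-diag (suc r))))))
  go (suc d) = ≤-cert 0 (+-mono-≤ (*-monoʳ-≤ (suc (suc r) * suc r) (go d)) (*-monoʳ-≤ (suc (suc r) * D d) V′≥))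
      (trans (cong (λ x → (suc (suc r) * D d + suc r ^ suc d) * V′ + (suc (suc r) * suc r * (S x (suc (suc r)) * suc r ^ d) + suc (suc r) * D d * (suc r * V)))
                 (cong suc (+-suc d r)))
        (trans (lem r (D d) (suc r ^ d) U V V′)
        (cong₂ (λ x y → (suc (suc r) * S x (suc (suc r)) + S x (suc r)) * (suc r * suc r ^ d) + y + 0)
          (cong suc (sym (+-suc d r))) refl)))
    where
    V  = A d r
    U  = S (suc (suc (d + r))) (suc (suc r))
    V′ = S (suc (suc (d + r))) (suc r)
    V′≥ : suc r * V ≤ V′
    V′≥ = m≤m+n _ _
    lem : ∀ r D x U V V′ → (suc (suc r) * D + suc r * x) * V′ + (suc (suc r) * suc r * (U * x) + suc (suc r) * D * (suc r * V))
        ≡ (suc (suc r) * U + V′) * (suc r * x) + (suc (suc r) * suc r * (D * V) + suc (suc r) * D * V′) + 0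
    lem = solve-∀

-- What the largeness of n gives for Stirling numbers.

^-suc² : ∀ X m → X ^ (2 * suc m + 4) ≡ X * X * X ^ (2 * m + 4)
^-suc² X m = trans (cong (X ^_) (lem m)) (sym (*-assoc X X _))
  where lem : ∀ m → 2 * suc m + 4 ≡ suc (suc (2 * m + 4))
        lem = solve-∀

-- Lowering the index by one takes X² off the left side but only a factor 2 off the right.
pow-down : ∀ {X} c d j → 2 ≤ X → X ^ (2 * (d + j) + 4) ≤ 2 ^ (c + (d + j)) → X ^ (2 * j + 4) ≤ 2 ^ (c + j)
pow-down c zero j h g = g
pow-down {X} c (suc d) j h g = pow-down c d j h (*-cancelˡ-≤ 2 (begin
  2 * X ^ (2 * (d + j) + 4)     ≤⟨ *-monoˡ-≤ (X ^ (2 * (d + j) + 4)) (≤-trans h (m≤m*n X X ⦃ >-nonZero (≤-trans (s≤s z≤n) h) ⦄)) ⟩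
  X * X * X ^ (2 * (d + j) + 4) ≡⟨ ^-suc² X (d + j) ⟨
  X ^ (2 * suc (d + j) + 4)     ≤⟨ g ⟩
  2 ^ (c + suc (d + j))         ≡⟨ cong (2 ^_) (+-suc c (d + j)) ⟩
  2 * 2 ^ (c + (d + j))         ∎))
  where open ≤-Reasoning

^-double : ∀ X j → X ^ (2 * j) ≡ (X * X) ^ j
^-double X j = trans (sym (^-*-assoc X 2 j)) (cong (_^ j) (cong (X *_) (*-identityʳ X)))

-- The form in which most estimates use that n is large. Since A c 1 = 2^(c + 1) - 1, the field
-- `big` says X⁶ ≤ 2^(c + 1); it takes over where the index has reached 0 and `ratio` has nothing
-- left to divide.
record Good (X c J : ℕ) : Set where
  field
    ratio : ∀ j → j < J → X * X * A c j ≤ A c (suc j) + A c j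
    big   : X ^ 6 ≤ A c 1 + 1

good : ∀ {X} c J → 2 ≤ X → 1 ≤ J → X ^ (2 * J + 4) ≤ 2 ^ (c + J) → Good X c J
good {X} c J h 1≤J g = record { ratio = rat ; big = bigg }
  where
  inst = >-nonZero (≤-trans (s≤s z≤n) h)
  down : ∀ j → j ≤ J → X ^ (2 * j + 4) ≤ 2 ^ (c + j)
  down j j≤J with d , refl ← m≤n⇒∃[o]m+o≡n j≤J =
    pow-down c d j h (subst (λ e → X ^ (2 * e + 4) ≤ 2 ^ (c + e)) (+-comm j d) g)
  rat : ∀ j → j < J → X * X * A c j ≤ A c (suc j) + A c j
  rat j j<J = A-ratio c j (X * X) (≤-trans (≤-reflexive (sym (^-double X (suc j))))
    (≤-trans (^-monoʳ-≤ X ⦃ inst ⦄ (m≤m+n (2 * suc j) 4)) (down (suc j) j<J)))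
  bigg : X ^ 6 ≤ A c 1 + 1
  bigg = ≤-trans (down 1 1≤J) (≤-trans (≤-reflexive (sym (trans (cong (2 ^ (c + 1) *_) (A-zero c)) (*-identityʳ _))))
    (≤-trans (A-ratio c 0 (2 ^ (c + 1)) (≤-reflexive (*-identityʳ _))) (≤-reflexive (cong (A c 1 +_) (A-zero c)))))

module _ {X c J : ℕ} (G : Good X c J) (2≤X : 2 ≤ X) where
  open Good G

  A-step : ∀ j → j < J → X * A c j ≤ A c (suc j)
  A-step j j<J = ≤-cert 0 (+-mono-≤ (ratio j j<J) (*-monoˡ-≤ (A c j) X+1≤XX))
      (lem X (A c j) (A c (suc j)))
    where
    X+1≤XX : X + 1 ≤ X * X
    X+1≤XX with d , refl ← m≤n⇒∃[o]m+o≡n 2≤X = ≤-cert (1 + 3 * d + d * d) (z≤n {0}) (lem′ d)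
      where lem′ : ∀ d → (2 + d) * (2 + d) + 0 ≡ 2 + d + 1 + 0 + (1 + 3 * d + d * d)
            lem′ = solve-∀
    lem : ∀ X a b → b + (X * X * a + (X + 1) * a) ≡ X * a + (b + a + X * X * a) + 0
    lem = solve-∀

  X^6≤ : ∀ m → m ≤ 5 → X ^ m ≤ A c 1
  X^6≤ m m≤5 = +-cancelʳ-≤ 1 (X ^ m) _ (≤-trans (≤-trans (≤-trans (+-mono-≤ (^-monoʳ-≤ X ⦃ inst ⦄ m≤5) (m^n>0 X ⦃ inst ⦄ 5))
      (≤-reflexive (lem (X ^ 5)))) (*-monoˡ-≤ (X ^ 5) 2≤X)) big)
    where inst = >-nonZero (≤-trans (s≤s z≤n) 2≤X)
          lem : ∀ x → x + x ≡ 2 * x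
          lem = solve-∀

  -- X^d A(J − d) bounds the number of members of a family whose transversal covers have t + d blocks.
  cover-dec : ∀ e d → d + e ≤ J → X ^ (d + e) * A c (J ∸ (d + e)) ≤ X ^ d * A c (J ∸ d)
  cover-dec zero    d h rewrite +-identityʳ d = ≤-refl
  cover-dec (suc e) d h rewrite +-suc d e = ≤-trans (≤-trans (≤-reflexive (lem X (X ^ (d + e)) _))
      (*-monoʳ-≤ (X ^ (d + e)) (≤-trans (A-step (J ∸ suc (d + e)) (∸-monoʳ-< {J} {suc (d + e)} {0} (s≤s z≤n) h))
        (≤-reflexive (cong (A c) (sym (+-∸-assoc 1 h)))))))
      (cover-dec e d (<⇒≤ h))
    where lem : ∀ X y a → X * y * a ≡ y * (X * a)
          lem = solve-∀

module _ {X c m : ℕ} (G : Good X c (2 + m)) (2≤X : 2 ≤ X) where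
  open Good G

  private
    J = 2 + m

    -- The end case d = 1 + J: the cover consists of all k blocks of a member and `J ∸ d` truncates
    -- to 0. The two factors X in excess of X^(1 + m) are paid for by A c 1 ≥ X².
    last : X ^ (1 + J) * A c (J ∸ (1 + J)) ≤ X ^ (1 + m) * A c (J ∸ (1 + m))
    last = ≤-trans (≤-reflexive (trans (cong (X ^ (1 + J) *_) (trans (cong (A c) (m≤n⇒m∸n≡0 (n≤1+n m))) (A-zero c)))
        (lem X (X ^ (1 + m)))))
      (*-monoʳ-≤ (X ^ (1 + m)) (≤-trans (X^6≤ G 2≤X 2 (s≤s (s≤s z≤n))) (≤-reflexive (cong (A c) (sym (m+n∸n≡m 1 m))))))
      where lem : ∀ X y → X * (X * y) * 1 ≡ y * (X * (X * 1))
            lem = solve-∀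

    downTo : ∀ d₀ d → d₀ ≤ d → d ≤ J → X ^ d * A c (J ∸ d) ≤ X ^ d₀ * A c (J ∸ d₀)
    downTo d₀ d d₀≤d d≤J with e , refl ← m≤n⇒∃[o]m+o≡n d₀≤d = cover-dec G 2≤X e d₀ d≤J

  cover₁ : ∀ d → 1 ≤ d → d ≤ 1 + J → X ^ d * A c (J ∸ d) ≤ X * A c (1 + m)
  cover₁ d 1≤d d≤ = ≤-trans (go (m≤n⇒m<n∨m≡n d≤)) (≤-reflexive (cong (_* A c (1 + m)) (*-identityʳ X)))
    where
    go : d < 1 + J ⊎ d ≡ 1 + J → X ^ d * A c (J ∸ d) ≤ X ^ 1 * A c (1 + m)
    go (inj₁ (s≤s d≤J)) = downTo 1 d 1≤d d≤J
    go (inj₂ refl)      = ≤-trans last (downTo 1 (1 + m) (s≤s z≤n) (n≤1+n _))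

  cover₂ : ∀ d → 2 ≤ d → d ≤ 1 + J → X ^ d * A c (J ∸ d) ≤ A c (1 + m) + A c m
  cover₂ d 2≤d d≤ = go (m≤n⇒m<n∨m≡n d≤)
    where
    end : X ^ 2 * A c m ≤ A c (1 + m) + A c m
    end = ≤-trans (≤-reflexive (cong (λ x → X * x * A c m) (*-identityʳ X))) (ratio m (n≤1+n _))
    lastₘ : ∀ m′ → m ≡ m′ → X ^ (3 + m) * A c (J ∸ (3 + m)) ≤ A c (1 + m) + A c m
    -- Here d = 3, and the descent from `last` would end at d = 1, below the allowed range; X³ ≤ A c
    -- 1 is used instead.
    lastₘ zero refl = ≤-trans (≤-reflexive (trans (cong (X ^ 3 *_) (A-zero c)) (*-identityʳ _)))
      (≤-trans (X^6≤ G 2≤X 3 (s≤s (s≤s (s≤s z≤n)))) (m≤m+n _ _))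
    lastₘ (suc m′) e = ≤-trans last (≤-trans (downTo 2 (1 + m) (s≤s (≤-trans (s≤s z≤n) (≤-reflexive (sym e)))) (n≤1+n _)) end)
    go : d < 1 + J ⊎ d ≡ 1 + J → X ^ d * A c (J ∸ d) ≤ A c (1 + m) + A c m
    go (inj₁ (s≤s d≤J)) = ≤-trans (downTo 2 d 2≤d d≤J) end
    go (inj₂ refl)      = lastₘ m refl

-- Fifth powers serve because (3/4)⁵ < 1/4.
A-upper : ∀ {X} c r q → 8 ≤ X → 2 + r ≤ X → 1 ≤ r → X ^ (2 * suc r + 4) ≤ 2 ^ (c + suc r) →
          2 ^ (c + suc r) ≤ q + 1 → X * X * A c (suc r) ≤ A c r * q
A-upper {X} c r q 8≤X r≤X 1≤r g hq = *-cancelˡ-≤ (2 ^ c) ⦃ m^n≢0 2 c ⦄ (*-cancelˡ-≤ (suc r ^ c) ⦃ m^n≢0 (suc r) c ⦄ (begin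
  ρ * (2 ^ c * (X * X * A c (suc r)))        ≡⟨ lem1 ρ (2 ^ c) X (A c (suc r)) ⟩
  X * X * 2 ^ c * (A c (suc r) * ρ)          ≤⟨ *-monoʳ-≤ (X * X * 2 ^ c) (A-ratio-upper c r) ⟩
  X * X * 2 ^ c * (suc (suc r) ^ suc c * A c r) ≡⟨ lem2 X (2 ^ c) (suc (suc r)) (suc (suc r) ^ c) (A c r) ⟩
  X * X * suc (suc r) * (2 ^ c * suc (suc r) ^ c) * A c r ≤⟨ *-monoˡ-≤ (A c r) (*-mono-≤ (*-monoʳ-≤ (X * X) r≤X) r23) ⟩
  X * X * X * (3 ^ c * ρ) * A c r            ≡⟨ lem3 X (3 ^ c) ρ (A c r) ⟩
  ρ * (X * X * X * 3 ^ c) * A c r            ≤⟨ *-monoˡ-≤ (A c r) (*-monoʳ-≤ ρ X³3ᶜ) ⟩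
  ρ * (2 ^ c * q) * A c r                    ≡⟨ lem4 ρ (2 ^ c) q (A c r) ⟩
  ρ * (2 ^ c * (A c r * q))                  ∎))
  where
  open ≤-Reasoning
  J = suc r
  ρ = suc r ^ c
  Z = 2 ^ (c + J)
  lem1 : ∀ ρ t X a → ρ * (t * (X * X * a)) ≡ X * X * t * (a * ρ)
  lem1 = solve-∀
  lem2 : ∀ X t s y a → X * X * t * (s * y * a) ≡ X * X * s * (t * y) * a
  lem2 = solve-∀
  lem3 : ∀ X t ρ a → X * X * X * (t * ρ) * a ≡ ρ * (X * X * X * t) * a
  lem3 = solve-∀
  lem4 : ∀ ρ t q a → ρ * (t * q) * a ≡ ρ * (t * (a * q))
  lem4 = solve-∀
  -- From r ≥ 1 follows (r + 2)/(r + 1) ≤ 3/2, so A c (r + 1) exceeds A c r by a factor of at most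
  -- (r + 2)(3/2)^c, against q + 1 ≥ 2^(c + r + 1). For r = 0 the base would be 2 and nothing would
  -- be gained.
  r23 : 2 ^ c * suc (suc r) ^ c ≤ 3 ^ c * suc r ^ c
  r23 = ≤-trans (≤-reflexive (sym (^-distribʳ-* c 2 (suc (suc r))))) (≤-trans (^-monoˡ-≤ c base)
    (≤-reflexive (^-distribʳ-* c 3 (suc r))))
    where
    lemb : ∀ r → 3 * suc r + 1 ≡ 2 * suc (suc r) + r + 0
    lemb = solve-∀
    base : 2 * suc (suc r) ≤ 3 * suc r
    base = ≤-cert 0 1≤r (lemb r)
  X¹⁶≤ : X ^ 16 ≤ Z * Z
  X¹⁶≤ = ≤-trans (≤-reflexive (^-distribˡ-+-* X 8 8)) (*-mono-≤ X⁸≤ X⁸≤)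
    where
    lemx : ∀ r → 2 * suc r + 4 + 2 * 1 ≡ 8 + 2 * r + 0
    lemx = solve-∀
    X⁸≤ : X ^ 8 ≤ Z
    X⁸≤ = ≤-trans (^-monoʳ-≤ X ⦃ >-nonZero (≤-trans (s≤s z≤n) 8≤X) ⦄ (≤-cert {8} {2 * suc r + 4} {2 * 1} {2 * r} 0 (*-monoʳ-≤ 2 1≤r) (lemx r))) g
  fifth : (2 * (X * X * X * 3 ^ c)) ^ 5 ≤ (4 ^ c * 2 ^ J) ^ 5
  fifth = begin
    (2 * (X * X * X * 3 ^ c)) ^ 5         ≡⟨ lemf X (3 ^ c) ⟩
    32 * X ^ 15 * (3 ^ c) ^ 5             ≡⟨ cong (32 * X ^ 15 *_) (trans (^-*-assoc 3 c 5) (trans (cong (3 ^_) (*-comm c 5)) (sym (^-*-assoc 3 5 c)))) ⟩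
    32 * X ^ 15 * 243 ^ c                 ≤⟨ *-mono-≤ 32≤ (^-monoˡ-≤ c (m≤m+n 243 13)) ⟩
    X ^ 16 * 8 ^ J * 256 ^ c              ≤⟨ *-monoˡ-≤ (256 ^ c) (*-monoˡ-≤ (8 ^ J) X¹⁶≤) ⟩
    Z * Z * 8 ^ J * 256 ^ c               ≡⟨ cong₂ (λ z w → z * z * 8 ^ J * w) (^-distribˡ-+-* 2 c J) (^-distribʳ-* c 16 16) ⟩
    2 ^ c * 2 ^ J * (2 ^ c * 2 ^ J) * 8 ^ J * (16 ^ c * 16 ^ c) ≡⟨ cong₂ (λ z w → 2 ^ c * 2 ^ J * (2 ^ c * 2 ^ J) * z * (w * w)) (p8 J) (p16 c) ⟩
    2 ^ c * 2 ^ J * (2 ^ c * 2 ^ J) * (2 ^ J * (2 ^ J * 2 ^ J)) * (2 ^ c * 2 ^ c * (2 ^ c * 2 ^ c) * (2 ^ c * 2 ^ c * (2 ^ c * 2 ^ c))) ≡⟨ lemg (2 ^ c) (2 ^ J) ⟩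
    (2 ^ c * 2 ^ c * 2 ^ J) ^ 5           ≡⟨ cong (λ z → (z * 2 ^ J) ^ 5) (^-distribʳ-* c 2 2) ⟨
    (4 ^ c * 2 ^ J) ^ 5                   ∎
    where
    lemf : ∀ X t → (2 * (X * X * X * t)) ^ 5 ≡ 32 * X ^ 15 * t ^ 5
    lemf X t = trans (^-distribʳ-* 5 2 (X * X * X * t)) (trans (cong (32 *_) (^-distribʳ-* 5 (X * X * X) t))
      (trans (sym (*-assoc 32 ((X * X * X) ^ 5) (t ^ 5))) (cong (λ y → 32 * y * t ^ 5)
        (trans (cong (_^ 5) (lemc X)) (^-*-assoc X 3 5)))))
      where lemc : ∀ X → X * X * X ≡ X * (X * (X * 1))
            lemc = solve-∀
    lemg : ∀ a b → a * b * (a * b) * (b * (b * b)) * (a * a * (a * a) * (a * a * (a * a)))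
           ≡ (a * a * b) * ((a * a * b) * ((a * a * b) * ((a * a * b) * ((a * a * b) * 1))))
    lemg = solve-∀
    p8 : ∀ j → 8 ^ j ≡ 2 ^ j * (2 ^ j * 2 ^ j)
    p8 j = trans (^-distribʳ-* j 2 4) (cong (2 ^ j *_) (^-distribʳ-* j 2 2))
    p16 : ∀ j → 16 ^ j ≡ 2 ^ j * 2 ^ j * (2 ^ j * 2 ^ j)
    p16 j = trans (^-distribʳ-* j 4 4) (cong₂ _*_ (^-distribʳ-* j 2 2) (^-distribʳ-* j 2 2))
    32≤ : 32 * X ^ 15 ≤ X ^ 16 * 8 ^ J
    32≤ = ≤-trans (*-mono-≤ {32} {X * 8} (≤-trans (m≤m+n 32 32) (*-monoˡ-≤ 8 8≤X)) (≤-refl {X ^ 15}))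
      (≤-trans (≤-reflexive (lemh X (X ^ 15))) (*-monoʳ-≤ (X ^ 16) (^-monoʳ-≤ 8 {1} {J} (s≤s z≤n))))
      where lemh : ∀ X y → X * 8 * y ≡ X * y * 8
            lemh = solve-∀
  X³3ᶜ : X * X * X * 3 ^ c ≤ 2 ^ c * q
  X³3ᶜ = *-cancelˡ-≤ 2 (begin
    2 * (X * X * X * 3 ^ c) ≤⟨ ^-cancelˡ-≤ 4 fifth ⟩
    4 ^ c * 2 ^ J           ≡⟨ trans (cong (_* 2 ^ J) (^-distribʳ-* c 2 2)) (*-assoc (2 ^ c) (2 ^ c) (2 ^ J)) ⟩
    2 ^ c * (2 ^ c * 2 ^ J) ≡⟨ cong (2 ^ c *_) (^-distribˡ-+-* 2 c J) ⟨
    2 ^ c * Z               ≤⟨ *-monoʳ-≤ (2 ^ c) (≤-trans hq (+-monoʳ-≤ q 1≤q)) ⟩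
    2 ^ c * (q + q)         ≡⟨ lemq (2 ^ c) q ⟩
    2 * (2 ^ c * q)         ∎)
    where
    lemq : ∀ a q → a * (q + q) ≡ 2 * (a * q)
    lemq = solve-∀
    1≤q : 1 ≤ q
    1≤q = +-cancelʳ-≤ 1 1 q (≤-trans (^-monoʳ-≤ 2 {1} {c + J} (≤-trans (s≤s z≤n) (m≤n+m J c))) hq)

-- Blocks, partitions and their enumeration.

bool-ext : ∀ {a b} → (a ≡ true → b ≡ true) → (b ≡ true → a ≡ true) → a ≡ b
bool-ext {true}  {b}     f g = sym (f refl)
bool-ext {false} {true}  f g = g refl
bool-ext {false} {false} f g = refl

vec-ext : ∀ {X : Set} {u v : Vec X n} → (∀ i → lookup u i ≡ lookup v i) → u ≡ v
vec-ext {u = []}    {[]}    h = refl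
vec-ext {u = x ∷ u} {y ∷ v} h = cong₂ _∷_ (h zero) (vec-ext (h ∘ suc))

==ᵛ⇒≡ : (B C : Block n) → B ==ᵛ C ≡ true → B ≡ C
==ᵛ⇒≡ []          []          h = refl
==ᵛ⇒≡ (true ∷ B)  (true ∷ C)  h = cong (true ∷_) (==ᵛ⇒≡ B C h)
==ᵛ⇒≡ (false ∷ B) (false ∷ C) h = cong (false ∷_) (==ᵛ⇒≡ B C h)

==ᵛ-refl : (B : Block n) → B ==ᵛ B ≡ true
==ᵛ-refl []          = refl
==ᵛ-refl (true ∷ B)  = ==ᵛ-refl B
==ᵛ-refl (false ∷ B) = ==ᵛ-refl B

≢⇒==ᵛ : {B C : Block n} → ¬ B ≡ C → B ==ᵛ C ≡ false
≢⇒==ᵛ {B = B} {C} h = ≡false (h ∘ ==ᵛ⇒≡ B C)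

≡⇒==ᵛ : {B C : Block n} → B ≡ C → B ==ᵛ C ≡ true
≡⇒==ᵛ {B = B} refl = ==ᵛ-refl B

==ᵛ-false⇒≢ : {B C : Block n} → B ==ᵛ C ≡ false → ¬ B ≡ C
==ᵛ-false⇒≢ {B = B} h refl with () ← trans (sym (==ᵛ-refl B)) h

infix 4 _∋_
_∋_ : Block n → Fin n → Set
B ∋ i = lookup B i ≡ true

zeros : Block n
zeros = replicate _ false

zeros∌ : ∀ {i : Fin n} → ¬ zeros ∋ i
zeros∌ {i = i} h with () ← trans (sym (lookup-replicate i false)) h

inhabited? : (B : Block n) → (∃ λ i → B ∋ i) ⊎ B ≡ zeros
inhabited? []          = inj₂ refl
inhabited? (true ∷ B)  = inj₁ (zero , refl)
inhabited? (false ∷ B) with inhabited? B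
... | inj₁ (i , h) = inj₁ (suc i , h)
... | inj₂ refl    = inj₂ refl

∈-allSubsets : (B : Block n) → B ∈ allSubsets n
∈-allSubsets []          = here refl
∈-allSubsets (true ∷ B)  = ∈-++⁺ˡ (∈-map⁺ (true ∷_) (∈-allSubsets B))
∈-allSubsets (false ∷ B) = ∈-++⁺ʳ (map (true ∷_) (allSubsets _)) (∈-map⁺ (false ∷_) (∈-allSubsets B))

Unique-allSubsets : ∀ n → Unique (allSubsets n)
Unique-allSubsets zero    = [] ∷ []
Unique-allSubsets (suc n) = Uniqueₚ.++⁺ (Uniqueₚ.map⁺ (cong Vec.tail) (Unique-allSubsets n))
    (Uniqueₚ.map⁺ (cong Vec.tail) (Unique-allSubsets n)) disj
  where
  disj : ∀ {v} → v ∈ map (true ∷_) (allSubsets n) × v ∈ map (false ∷_) (allSubsets n) → ⊥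
  disj (a , b) with _ , _ , refl ← ∈-map⁻ (true ∷_) a | _ , _ , () ← ∈-map⁻ (false ∷_) b

∈ᵇ⇒row : {B : Block n} (P : Part n) → B ∈ᵇ P ≡ true → ∃ λ i → lookup P i ≡ B
∈ᵇ⇒row {n} {B} P h with i , _ , e ← any-∈ (λ i → lookup P i ==ᵛ B) (allFin n) h = i , ==ᵛ⇒≡ _ _ e

row⇒∈ᵇ : ∀ {B : Block n} (P : Part n) i → lookup P i ≡ B → B ∈ᵇ P ≡ true
row⇒∈ᵇ P i refl = ∈-any (λ i → lookup P i ==ᵛ _) (∈-allFin i) (==ᵛ-refl (lookup P i))

blocks : Part n → List (Block n)
blocks {n} P = filterᵇ (_∈ᵇ P) (allSubsets n)

∈-blocks⁺ : {B : Block n} (P : Part n) → B ∈ᵇ P ≡ true → B ∈ blocks P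
∈-blocks⁺ {B = B} P h = ∈-filterᵇ⁺ (_∈ᵇ P) (∈-allSubsets B) h

∈-blocks⁻ : {B : Block n} (P : Part n) → B ∈ blocks P → B ∈ᵇ P ≡ true
∈-blocks⁻ P h = proj₂ (∈-filterᵇ⁻ (_∈ᵇ P) {allSubsets _} h)

Unique-blocks : (P : Part n) → Unique (blocks P)
Unique-blocks {n} P = Unique-filterᵇ (_∈ᵇ P) (Unique-allSubsets n)

module _ (P : Part n) (isP : IsPartition P) where
  private
    rf = proj₁ isP
    sm = proj₁ (proj₂ isP)
    tr = proj₂ (proj₂ isP)

  row-eq : ∀ {i j} → rel P i j ≡ true → lookup P i ≡ lookup P j
  row-eq {i} {j} h = vec-ext (λ l → bool-ext (tr j i l (trans (sm j i) h)) (tr i j l h))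

  block≡row : {B : Block n} → B ∈ᵇ P ≡ true → ∀ {i} → B ∋ i → B ≡ lookup P i
  block≡row h {i} b with j , refl ← ∈ᵇ⇒row P h = row-eq b

  block-inhabited : {B : Block n} → B ∈ᵇ P ≡ true → ∃ λ i → B ∋ i
  block-inhabited h with j , refl ← ∈ᵇ⇒row P h = j , rf j

  block-unique : {B C : Block n} → B ∈ᵇ P ≡ true → C ∈ᵇ P ≡ true → ∀ {i} → B ∋ i → C ∋ i → B ≡ C
  block-unique hB hC b c = trans (block≡row hB b) (sym (block≡row hC c))

  row∈ᵇ : ∀ i → lookup P i ∈ᵇ P ≡ true
  row∈ᵇ i = row⇒∈ᵇ P i refl

  row∋ : ∀ i → lookup P i ∋ i
  row∋ = rf

-- Partitions of {0, …, n} from partitions P of {1, …, n}: the block of 0 is {0} ∪ B, where B = ∅ or B ∈ P.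

ext : Part n → Block n → Part (suc n)
ext P B = (true ∷ B) ∷ zipWith _∷_ B P

enum : ∀ n → List (Part n)
enum zero    = [] ∷ []
enum (suc n) = concatMap (λ P → map (ext P) (zeros ∷ blocks P)) (enum n)

Extends : Part n → Block n → Set
Extends P B = B ≡ zeros ⊎ B ∈ᵇ P ≡ true

row-ext : (P : Part n) (B : Block n) → ∀ i → lookup (ext P B) (suc i) ≡ lookup B i ∷ lookup P i
row-ext P B i = lookup-zipWith _∷_ i B P

module _ (P : Part n) (isP : IsPartition P) (B : Block n) (eB : Extends P B) where
  private
    rf = proj₁ isP
    sm = proj₁ (proj₂ isP)
    tr = proj₂ (proj₂ isP)

  B≡row : ∀ {i} → B ∋ i → B ≡ lookup P i
  B≡row {i} h = go eB
    where
    go : Extends P B → B ≡ lookup P i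
    go (inj₁ e) = ⊥-elim (zeros∌ {i = i} (subst (_∋ i) e h))
    go (inj₂ m) = block≡row P isP m h

  ext-true : ∀ C → (true ∷ C) ∈ᵇ ext P B ≡ (C ==ᵛ B)
  ext-true C = bool-ext (λ h → to (∈ᵇ⇒row (ext P B) h))
      (λ h → row⇒∈ᵇ (ext P B) zero (cong (true ∷_) (sym (==ᵛ⇒≡ C B h))))
    where
    to : (∃ λ i → lookup (ext P B) i ≡ true ∷ C) → C ==ᵛ B ≡ true
    to (zero , refl) = ==ᵛ-refl B
    to (suc i , e) with e′ ← trans (sym (row-ext P B i)) e =
      ≡⇒==ᵛ (trans (sym (cong Vec.tail e′)) (sym (B≡row (cong Vec.head e′))))

  ext-false : ∀ C → (false ∷ C) ∈ᵇ ext P B ≡ (C ∈ᵇ P) ∧ not (C ==ᵛ B)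
  ext-false C = bool-ext (λ h → to (∈ᵇ⇒row (ext P B) h)) from
    where
    to : (∃ λ i → lookup (ext P B) i ≡ false ∷ C) → (C ∈ᵇ P) ∧ not (C ==ᵛ B) ≡ true
    to (suc i , e) with e′ ← trans (sym (row-ext P B i)) e =
      ∧-intro (row⇒∈ᵇ P i (cong Vec.tail e′)) (cong not (≢⇒==ᵛ λ C≡B →
        contradiction (trans (sym (rf i)) (trans (cong (λ D → lookup D i) (trans (cong Vec.tail e′) C≡B)) (cong Vec.head e′))) (λ ())))
    from : (C ∈ᵇ P) ∧ not (C ==ᵛ B) ≡ true → (false ∷ C) ∈ᵇ ext P B ≡ true
    from h with h₁ , h₂ ← ∧-true h with i , refl ← ∈ᵇ⇒row P h₁ =
      row⇒∈ᵇ (ext P B) (suc i) (trans (row-ext P B i) (cong (_∷ lookup P i) (≡false (λ b →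
        contradiction (trans (sym (cong not (≡⇒==ᵛ (sym (B≡row b))))) h₂) (λ ())))))

  ext-isPartition : IsPartition (ext P B)
  ext-isPartition = rf′ , sm′ , tr′
    where
    R = rel (ext P B)
    Rs0 : ∀ i → R (suc i) zero ≡ lookup B i
    Rs0 i = cong (λ v → lookup v zero) (row-ext P B i)
    Rss : ∀ i j → R (suc i) (suc j) ≡ rel P i j
    Rss i j = cong (λ v → lookup v (suc j)) (row-ext P B i)
    via : ∀ {i j} → B ∋ i → lookup B j ≡ rel P i j
    via {i} {j} b = cong (λ v → lookup v j) (B≡row b)
    rf′ : ∀ i → R i i ≡ true
    rf′ zero    = refl
    rf′ (suc i) = trans (Rss i i) (rf i)
    sm′ : ∀ i j → R i j ≡ R j i
    sm′ zero    zero    = refl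
    sm′ zero    (suc j) = sym (Rs0 j)
    sm′ (suc i) zero    = Rs0 i
    sm′ (suc i) (suc j) = trans (Rss i j) (trans (sm i j) (sym (Rss j i)))
    tr′ : ∀ i j l → R i j ≡ true → R j l ≡ true → R i l ≡ true
    tr′ zero    zero    l       a b = b
    tr′ zero    (suc j) zero    a b = refl
    tr′ zero    (suc j) (suc l) a b = trans (via a) (trans (sym (Rss j l)) b)
    tr′ (suc i) zero    zero    a b = a
    tr′ (suc i) zero    (suc l) a b = trans (Rss i l) (trans (sym (via (trans (sym (Rs0 i)) a))) b)
    tr′ (suc i) (suc j) zero    a b = trans (Rs0 i) (trans (via {j} b′) (trans (sm j i) (trans (sym (Rss i j)) a)))
      where b′ = trans (sym (Rs0 j)) b
    tr′ (suc i) (suc j) (suc l) a b = trans (Rss i l) (tr i j l (trans (sym (Rss i j)) a) (trans (sym (Rss j l)) b))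

∈-concatMap-inv : ∀ {X Y : Set} (f : X → List Y) xs {y} → y ∈ concatMap f xs → ∃ λ x → x ∈ xs × y ∈ f x
∈-concatMap-inv f (x ∷ xs) h with ∈-++⁻ (f x) h
... | inj₁ a = x , here refl , a
... | inj₂ b with z , z∈ , r ← ∈-concatMap-inv f xs b = z , there z∈ , r

∈-concatMap-intro : ∀ {X Y : Set} (f : X → List Y) {xs x y} → x ∈ xs → y ∈ f x → y ∈ concatMap f xs
∈-concatMap-intro f (here refl) r = ∈-++⁺ˡ r
∈-concatMap-intro f {x ∷ xs} (there q) r = ∈-++⁺ʳ (f x) (∈-concatMap-intro f q r)

enum-sound : ∀ n (P : Part n) → P ∈ enum n → IsPartition P
enum-sound zero    [] _ = (λ ()) , (λ ()) , (λ ())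
enum-sound (suc n) P  h with ∈-concatMap-inv (λ P → map (ext P) (zeros ∷ blocks P)) (enum n) h
... | Q , Q∈ , P∈ with ∈-map⁻ (ext Q) P∈
... | B , here refl , refl = ext-isPartition Q (enum-sound n Q Q∈) zeros (inj₁ refl)
... | B , there B∈ , refl = ext-isPartition Q (enum-sound n Q Q∈) B (inj₂ (∈-blocks⁻ Q B∈))

enum-complete : ∀ n (P : Part n) → IsPartition P → P ∈ enum n
enum-complete zero    []                _                = here refl
enum-complete (suc n) ((h ∷ r) ∷ rows) isP@(rf , sm , tr) =
    subst (_∈ enum (suc n)) (sym P≡) (∈-concatMap-intro (λ P → map (ext P) (zeros ∷ blocks P)) (enum-complete n Q isQ) (∈-map⁺ (ext Q) r∈))
  where
  P = (h ∷ r) ∷ rows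
  Q = Vec.map Vec.tail rows
  tail-lookup : ∀ (v : Vec Bool (suc n)) j → lookup (Vec.tail v) j ≡ lookup v (suc j)
  tail-lookup (_ ∷ v) j = refl
  relQ : ∀ i j → rel Q i j ≡ rel P (suc i) (suc j)
  relQ i j = trans (cong (λ v → lookup v j) (lookup-map i Vec.tail rows)) (tail-lookup (lookup rows i) j)
  isQ : IsPartition Q
  isQ = (λ i → trans (relQ i i) (rf (suc i))) ,
        (λ i j → trans (relQ i j) (trans (sm (suc i) (suc j)) (sym (relQ j i)))) ,
        (λ i j l a b → trans (relQ i l) (tr (suc i) (suc j) (suc l) (trans (sym (relQ i j)) a) (trans (sym (relQ j l)) b)))
  η : ∀ (v : Vec Bool (suc n)) → v ≡ lookup v zero ∷ Vec.tail v
  η (_ ∷ _) = refl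
  P≡ : P ≡ ext Q r
  P≡ = cong₂ _∷_ (cong (_∷ r) (rf zero)) (vec-ext λ i → trans (η (lookup rows i))
    (trans (cong₂ _∷_ (sm (suc i) zero) (sym (lookup-map i Vec.tail rows))) (sym (lookup-zipWith _∷_ i r Q))))
  r∈ : r ∈ zeros ∷ blocks Q
  r∈ with inhabited? r
  ... | inj₂ e = here e
  ... | inj₁ (i , ri) = there (∈-blocks⁺ Q (row⇒∈ᵇ Q i (vec-ext λ j → trans (relQ i j)
          (cong (λ v → lookup v (suc j)) (sym (row-eq P isP {zero} {suc i} ri))))))

ext-injective : {P Q : Part n} {B C : Block n} → ext P B ≡ ext Q C → P ≡ Q × B ≡ C
ext-injective {P = P} {Q} {B} {C} e = vec-ext (λ i → cong Vec.tail (trans (sym (row-ext P B i))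
    (trans (cong (λ R → lookup R (suc i)) e) (row-ext Q C i)))) , cong (Vec.tail ∘ Vec.head) e

Unique-concatMap : ∀ {X Y : Set} (f : X → List Y) {xs} → Unique xs → (∀ x → x ∈ xs → Unique (f x)) →
                   (∀ {x y z} → z ∈ f x → z ∈ f y → x ≡ y) → Unique (concatMap f xs)
Unique-concatMap f [] u d = []
Unique-concatMap f {x ∷ xs} (a ∷ uxs) u d =
  Uniqueₚ.++⁺ (u x (here refl)) (Unique-concatMap f uxs (λ y y∈ → u y (there y∈)) d) λ (p , q) → go a p q
  where
  go : ∀ {ys z} → All (λ y → ¬ x ≡ y) ys → z ∈ f x → z ∈ concatMap f ys → ⊥
  go {y ∷ ys} (n ∷ ns) p q with ∈-++⁻ (f y) q
  ... | inj₁ q′ = n (d p q′)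
  ... | inj₂ q′ = go ns p q′

zeros∉ᵇ : (P : Part n) → IsPartition P → {B : Block n} → B ∈ᵇ P ≡ true → ¬ B ≡ zeros
zeros∉ᵇ P isP h refl with i , z ← block-inhabited P isP h = zeros∌ {i = i} z

Unique-enum : ∀ n → Unique (enum n)
Unique-enum zero    = [] ∷ []
Unique-enum (suc n) = Unique-concatMap _ (Unique-enum n)
  (λ P P∈ → Uniqueₚ.map⁺ (proj₂ ∘ ext-injective)
    (All.tabulate (λ B∈ e → zeros∉ᵇ P (enum-sound n P P∈) (∈-blocks⁻ P B∈) (sym e)) ∷ Unique-blocks P))
  same
  where
  same : ∀ {P Q : Part n} {z} → z ∈ map (ext P) (zeros ∷ blocks P) → z ∈ map (ext Q) (zeros ∷ blocks Q) → P ≡ Q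
  same {P} {Q} p q with _ , _ , e ← ∈-map⁻ (ext P) p | _ , _ , e′ ← ∈-map⁻ (ext Q) q =
    proj₁ (ext-injective (trans (sym e) e′))

-- Counting the partitions that contain given blocks.

memᵇ : Block n → List (Block n) → Bool
memᵇ B T = any (_==ᵛ B) T

memᵇ⇒∈ : ∀ (B : Block n) T → memᵇ B T ≡ true → B ∈ T
memᵇ⇒∈ B T h with C , C∈ , e ← any-∈ (_==ᵛ B) T h = subst (_∈ T) (==ᵛ⇒≡ C B e) C∈

∈⇒memᵇ : ∀ (B : Block n) {T} → B ∈ T → memᵇ B T ≡ true
∈⇒memᵇ B B∈ = ∈-any (_==ᵛ B) B∈ (==ᵛ-refl B)

∉⇒memᵇ : ∀ (B : Block n) {T} → ¬ B ∈ T → memᵇ B T ≡ false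
∉⇒memᵇ B {T} h = ≡false (h ∘ memᵇ⇒∈ B T)

_⊑ᵇ_ : List (Block n) → Part n → Bool
T ⊑ᵇ P = all (_∈ᵇ P) T

record WF (T : List (Block n)) : Set where
  field
    uniq : Unique T
    disj : ∀ {B C} → B ∈ T → C ∈ T → ∀ {i} → B ∋ i → C ∋ i → B ≡ C
    inh  : ∀ {B} → B ∈ T → ∃ λ i → B ∋ i

⊑-WF : ∀ {T : List (Block n)} P → IsPartition P → Unique T → T ⊑ᵇ P ≡ true → WF T
⊑-WF P isP u h = record { uniq = u
  ; disj = λ b c → block-unique P isP (all-∈ (_∈ᵇ P) h b) (all-∈ (_∈ᵇ P) h c)
  ; inh = λ b → block-inhabited P isP (all-∈ (_∈ᵇ P) h b) }

size : Block n → ℕ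
size []      = 0
size (b ∷ B) = ⟦ b ⟧ + size B

usize : List (Block n) → ℕ
usize T = ∑ T size

size-zeros : ∀ n → size (zeros {n}) ≡ 0
size-zeros zero    = refl
size-zeros (suc n) = size-zeros n

size-pos : (B : Block n) → ∀ i → B ∋ i → 1 ≤ size B
size-pos (true ∷ B) zero    h = s≤s z≤n
size-pos (b ∷ B)    (suc i) h = ≤-trans (size-pos B i h) (m≤n+m (size B) ⟦ b ⟧)

hd⁺ hd⁻ : List (Block (suc n)) → List (Block n)
hd⁺ []                = []
hd⁺ ((true ∷ B) ∷ T)  = B ∷ hd⁺ T
hd⁺ ((false ∷ B) ∷ T) = hd⁺ T
hd⁻ []                = []
hd⁻ ((true ∷ B) ∷ T)  = hd⁻ T
hd⁻ ((false ∷ B) ∷ T) = B ∷ hd⁻ T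

hd⁺-∈ : ∀ (T : List (Block (suc n))) {B} → B ∈ hd⁺ T → (true ∷ B) ∈ T
hd⁺-∈ ((true ∷ B) ∷ T)  (here refl) = here refl
hd⁺-∈ ((true ∷ B) ∷ T)  (there h)   = there (hd⁺-∈ T h)
hd⁺-∈ ((false ∷ B) ∷ T) h           = there (hd⁺-∈ T h)

hd⁻-∈ : ∀ (T : List (Block (suc n))) {B} → B ∈ hd⁻ T → (false ∷ B) ∈ T
hd⁻-∈ ((true ∷ B) ∷ T)  h           = there (hd⁻-∈ T h)
hd⁻-∈ ((false ∷ B) ∷ T) (here refl) = here refl
hd⁻-∈ ((false ∷ B) ∷ T) (there h)   = there (hd⁻-∈ T h)

∈-hd⁺ : ∀ {T : List (Block (suc n))} {B} → (true ∷ B) ∈ T → B ∈ hd⁺ T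
∈-hd⁺ (here refl) = here refl
∈-hd⁺ {T = (true ∷ B) ∷ T} (there h) = there (∈-hd⁺ h)
∈-hd⁺ {T = (false ∷ B) ∷ T} (there h) = ∈-hd⁺ h

∈-hd⁻ : ∀ {T : List (Block (suc n))} {B} → (false ∷ B) ∈ T → B ∈ hd⁻ T
∈-hd⁻ (here refl) = here refl
∈-hd⁻ {T = (true ∷ B) ∷ T} (there h) = ∈-hd⁻ h
∈-hd⁻ {T = (false ∷ B) ∷ T} (there h) = there (∈-hd⁻ h)

Unique-hd⁺ : ∀ {T : List (Block (suc n))} → Unique T → Unique (hd⁺ T)
Unique-hd⁺ [] = []
Unique-hd⁺ {T = (true ∷ B) ∷ T} (a ∷ u) = All.tabulate (λ h e → All.lookup a (hd⁺-∈ T h) (cong (true ∷_) e)) ∷ Unique-hd⁺ u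
Unique-hd⁺ {T = (false ∷ B) ∷ T} (a ∷ u) = Unique-hd⁺ u

Unique-hd⁻ : ∀ {T : List (Block (suc n))} → Unique T → Unique (hd⁻ T)
Unique-hd⁻ [] = []
Unique-hd⁻ {T = (true ∷ B) ∷ T} (a ∷ u) = Unique-hd⁻ u
Unique-hd⁻ {T = (false ∷ B) ∷ T} (a ∷ u) = All.tabulate (λ h e → All.lookup a (hd⁻-∈ T h) (cong (false ∷_) e)) ∷ Unique-hd⁻ u

length-hd : ∀ (T : List (Block (suc n))) → length T ≡ length (hd⁺ T) + length (hd⁻ T)
length-hd []                = refl
length-hd ((true ∷ B) ∷ T)  = cong suc (length-hd T)
length-hd ((false ∷ B) ∷ T) = trans (cong suc (length-hd T)) (sym (+-suc (length (hd⁺ T)) _))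

usize-hd : ∀ (T : List (Block (suc n))) → usize T ≡ length (hd⁺ T) + (usize (hd⁺ T) + usize (hd⁻ T))
usize-hd []                = refl
usize-hd ((true ∷ B) ∷ T)  rewrite usize-hd T = cong suc (lem (size B) (length (hd⁺ T)) (usize (hd⁺ T)) (usize (hd⁻ T)))
  where lem : ∀ a b c d → a + (b + (c + d)) ≡ b + (a + c + d)
        lem = solve-∀
usize-hd ((false ∷ B) ∷ T) rewrite usize-hd T = lem (size B) (length (hd⁺ T)) (usize (hd⁺ T)) (usize (hd⁻ T))
  where lem : ∀ a b c d → a + (b + (c + d)) ≡ b + (c + (a + d))
        lem = solve-∀

-- The ways in which `T` can meet the point 0: not at all, in the block {0}, or in a block {0} ∪ B
-- with B non-empty. They decide which of the extensions `ext P B` in `enum` can contain `T`.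
data Split {n} (T : List (Block (suc n))) : Set where
  free : hd⁺ T ≡ [] → WF (hd⁻ T) → Split T
  sing : hd⁺ T ≡ zeros ∷ [] → WF (hd⁻ T) → Split T
  join : ∀ B → (∃ λ i → B ∋ i) → hd⁺ T ≡ B ∷ [] → WF (B ∷ hd⁻ T) → Split T

WF-hd⁻ : {T : List (Block (suc n))} → WF T → WF (hd⁻ T)
WF-hd⁻ {T = T} w = record { uniq = Unique-hd⁻ (WF.uniq w)
  ; disj = λ b c {i} bi ci → cong Vec.tail (WF.disj w (hd⁻-∈ T b) (hd⁻-∈ T c) {suc i} bi ci)
  ; inh = λ b → inh′ (WF.inh w (hd⁻-∈ T b)) }
  where inh′ : ∀ {B : Block _} → (∃ λ i → (false ∷ B) ∋ i) → ∃ λ i → B ∋ i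
        inh′ (suc i , h) = i , h

split : (T : List (Block (suc n))) → WF T → Split T
split T w with hd⁺ T in e
... | [] = free e (WF-hd⁻ w)
... | B ∷ C ∷ R with T⁺ ← Unique-hd⁺ (WF.uniq w) | B∈ ← hd⁺-∈ T {B} (subst (B ∈_) (sym e) (here refl))
                    | C∈ ← hd⁺-∈ T {C} (subst (C ∈_) (sym e) (there (here refl))) =
  ⊥-elim (go (subst Unique e T⁺) (cong Vec.tail (WF.disj w B∈ C∈ {zero} refl refl)))
  where go : Unique (B ∷ C ∷ R) → B ≡ C → ⊥
        go ((B≢C ∷ _) ∷ _) B≡C = B≢C B≡C
... | B ∷ [] with inhabited? B
...   | inj₂ refl = sing e (WF-hd⁻ w)
...   | inj₁ (i , Bi) = join B (i , Bi) e (record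
        { uniq = All.tabulate (λ C∈ B≡C → clash C∈ (i , Bi) (subst (_∋ i) B≡C Bi)) ∷ WF.uniq w⁻
        ; disj = λ { (here refl) (here refl) _ _ → refl
                   ; (here refl) (there c) {j} b c′ → ⊥-elim (clash c (j , b) c′)
                   ; (there c) (here refl) {j} c′ b → ⊥-elim (clash c (j , b) c′)
                   ; (there b) (there c) → WF.disj w⁻ b c }
        ; inh = λ { (here refl) → i , Bi ; (there b) → WF.inh w⁻ b } })
  where
  w⁻ = WF-hd⁻ w
  clash : ∀ {C} → C ∈ hd⁻ T → (b : ∃ λ i → B ∋ i) → C ∋ proj₁ b → ⊥
  clash C∈ (j , b) c with () ← cong Vec.head (WF.disj w (hd⁺-∈ T {B} (subst (B ∈_) (sym e) (here refl))) (hd⁻-∈ T C∈) {suc j} b c)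

usize≤ : ∀ n (T : List (Block n)) → WF T → usize T ≤ n
usize≤ zero [] w = z≤n
usize≤ zero (B ∷ T) w with () ← proj₁ (WF.inh w (here refl))
usize≤ (suc n) T w with split T w
... | free e w′ rewrite usize-hd T | e = m≤n⇒m≤1+n (usize≤ n _ w′)
... | sing e w′ rewrite usize-hd T | e | size-zeros n = s≤s (usize≤ n _ w′)
... | join B _ e w′ rewrite usize-hd T | e | +-identityʳ (size B) = s≤s (usize≤ n _ w′)

length≤usize : ∀ (T : List (Block n)) → (∀ {B} → B ∈ T → ∃ λ i → B ∋ i) → length T ≤ usize T
length≤usize []      h = z≤n
length≤usize (B ∷ T) h = +-mono-≤ (size-pos B _ (proj₂ (h (here refl)))) (length≤usize T (h ∘ there))

⊑-ext : ∀ (P : Part n) → IsPartition P → ∀ B → Extends P B → ∀ T →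
        T ⊑ᵇ ext P B ≡ all (_==ᵛ B) (hd⁺ T) ∧ ((hd⁻ T ⊑ᵇ P) ∧ not (memᵇ B (hd⁻ T)))
⊑-ext P isP B eB T = bool-ext to from
  where
  to : T ⊑ᵇ ext P B ≡ true → _
  to h = ∧-intro (∈-all (_==ᵛ B) (hd⁺ T) (λ {C} c → trans (sym (ext-true P isP B eB C)) (all-∈ (_∈ᵇ ext P B) h (hd⁺-∈ T c))))
    (∧-intro (∈-all (_∈ᵇ P) (hd⁻ T) (λ {C} c → proj₁ (fls c)))
      (cong not (∉⇒memᵇ B (λ c → contradiction (trans (sym (cong not (==ᵛ-refl B))) (proj₂ (fls c))) (λ ())))))
    where fls : ∀ {C} → C ∈ hd⁻ T → C ∈ᵇ P ≡ true × not (C ==ᵛ B) ≡ true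
          fls {C} c = ∧-true (trans (sym (ext-false P isP B eB C)) (all-∈ (_∈ᵇ ext P B) h (hd⁻-∈ T c)))
  from : all (_==ᵛ B) (hd⁺ T) ∧ ((hd⁻ T ⊑ᵇ P) ∧ not (memᵇ B (hd⁻ T))) ≡ true → T ⊑ᵇ ext P B ≡ true
  from h with h₁ , h₂₃ ← ∧-true {all (_==ᵛ B) (hd⁺ T)} h with h₂ , h₃ ← ∧-true {hd⁻ T ⊑ᵇ P} h₂₃ = ∈-all (_∈ᵇ ext P B) T mem
    where
    mem : ∀ {D} → D ∈ T → D ∈ᵇ ext P B ≡ true
    mem {true ∷ C}  d = trans (ext-true P isP B eB C) (all-∈ (_==ᵛ B) h₁ (∈-hd⁺ d))
    mem {false ∷ C} d = trans (ext-false P isP B eB C) (∧-intro (all-∈ (_∈ᵇ P) h₂ (∈-hd⁻ d))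
      (cong not (≢⇒==ᵛ {B = C} {B} λ { refl → not⇒¬ h₃ (∈⇒memᵇ C (∈-hd⁻ d)) })))

count-≡ : ∀ {xs : List (Block n)} {B} → Unique xs → B ∈ xs → count (_==ᵛ B) xs ≡ 1
count-≡ {xs = xs} {B} u B∈ = ≤-antisym
  (Unique-⊆⇒length≤ {ys = B ∷ []} (Unique-filterᵇ (_==ᵛ B) u) (λ C C∈ → here (==ᵛ⇒≡ C B (proj₂ (∈-filterᵇ⁻ (_==ᵛ B) {xs} C∈)))))
  (count-pos (_==ᵛ B) B∈ (==ᵛ-refl B))

#blocks-ext : ∀ (P : Part n) → IsPartition P → ∀ B → Extends P B →
              #blocks (ext P B) ≡ 1 + count (λ C → (C ∈ᵇ P) ∧ not (C ==ᵛ B)) (allSubsets n)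
#blocks-ext {n} P isP B eB = trans (count-++ (_∈ᵇ ext P B) (map (true ∷_) (allSubsets n)) (map (false ∷_) (allSubsets n)))
  (cong₂ _+_ (trans (count-map (_∈ᵇ ext P B) (true ∷_) (allSubsets n))
               (trans (count-cong (allSubsets n) (λ C _ → ext-true P isP B eB C)) (count-≡ (Unique-allSubsets n) (∈-allSubsets B))))
             (trans (count-map (_∈ᵇ ext P B) (false ∷_) (allSubsets n)) (count-cong (allSubsets n) (λ C _ → ext-false P isP B eB C))))

#blocks-zeros : ∀ (P : Part n) → IsPartition P → #blocks (ext P zeros) ≡ suc (#blocks P)
#blocks-zeros {n} P isP = trans (#blocks-ext P isP zeros (inj₁ refl)) (cong suc (count-cong (allSubsets n) (λ C _ → bool-ext
  (λ h → proj₁ (∧-true h)) (λ h → ∧-intro h (cong not (≢⇒==ᵛ {B = C} (zeros∉ᵇ P isP h)))))))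

#blocks-join : ∀ (P : Part n) → IsPartition P → ∀ B → B ∈ᵇ P ≡ true → #blocks (ext P B) ≡ #blocks P
#blocks-join {n} P isP B B∈ = trans (#blocks-ext P isP B (inj₂ B∈))
  (trans (cong₂ _+_ (sym (count-≡ (Unique-blocks P) (∈-blocks⁺ P B∈))) (sym (count-filter (not ∘ (_==ᵛ B)) (_∈ᵇ P) (allSubsets n))))
    (count-not (_==ᵛ B) (blocks P)))

ind : ℕ → List (Block n) → Part n → ℕ
ind k T P = ⟦ (#blocks P ≡ᵇ k) ∧ (T ⊑ᵇ P) ⟧

cnt : ∀ n → ℕ → List (Block n) → ℕ
cnt n k T = ∑ (enum n) (ind k T)

cnt-suc : ∀ n k (T : List (Block (suc n))) → cnt (suc n) k T ≡ ∑ (enum n) (λ P → ind k T (ext P zeros) + ∑ (blocks P) (λ B → ind k T (ext P B)))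
cnt-suc n k T = trans (∑-concatMap _ (enum n) (ind k T)) (∑-cong (enum n) (λ P _ → ∑-map (ext P) (zeros ∷ blocks P) (ind k T)))

count-mem : ∀ (P : Part n) {T} → Unique T → T ⊑ᵇ P ≡ true → count (λ B → memᵇ B T) (blocks P) ≡ length T
count-mem P {T} u h = ≤-antisym
  (Unique-⊆⇒length≤ (Unique-filterᵇ (λ B → memᵇ B T) (Unique-blocks P))
    (λ B B∈ → memᵇ⇒∈ B T (proj₂ (∈-filterᵇ⁻ (λ B → memᵇ B T) {blocks P} B∈))))
  (Unique-⊆⇒length≤ u (λ B B∈ → ∈-filterᵇ⁺ (λ B → memᵇ B T) (∈-blocks⁺ P (all-∈ (_∈ᵇ P) h B∈)) (∈⇒memᵇ B B∈)))

⊑-length : ∀ (P : Part n) {T} → Unique T → T ⊑ᵇ P ≡ true → length T ≤ #blocks P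
⊑-length P {T} u h = ≤-trans (≤-reflexive (sym (count-mem P u h))) (count-≤length (λ B → memᵇ B T) (blocks P))

≡ᵇ-true : ∀ {m k} → (m ≡ᵇ k) ≡ true → m ≡ k
≡ᵇ-true {m} {k} h = ≡ᵇ⇒≡ m k (subst T (sym h) _)

≡ᵇ-refl : ∀ m → (m ≡ᵇ m) ≡ true
≡ᵇ-refl zero    = refl
≡ᵇ-refl (suc m) = ≡ᵇ-refl m

-- Joining 0 to a block of `T` would destroy that block, so of the k blocks of P only the k - |T| =
-- j others are available.
free-blocks : ∀ (P : Part n) T k j → Unique T → length T + j ≡ k →
              ∑ (blocks P) (λ B → ⟦ (#blocks P ≡ᵇ k) ∧ ((T ⊑ᵇ P) ∧ not (memᵇ B T)) ⟧) ≡ j * ind k T P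
free-blocks P T k j u e with #blocks P ≡ᵇ k in ek | T ⊑ᵇ P in eT
... | false | _     = trans (trans (∑-const (blocks P) 0) (*-zeroʳ (length (blocks P)))) (sym (*-zeroʳ j))
... | true  | false = trans (trans (∑-const (blocks P) 0) (*-zeroʳ (length (blocks P)))) (sym (*-zeroʳ j))
... | true  | true  = trans (sym (count-∑ (λ B → not (memᵇ B T)) (blocks P))) (trans (+-cancelˡ-≡ (length T) _ _ (trans
      (trans (cong (_+ count (λ B → not (memᵇ B T)) (blocks P)) (sym (count-mem P u eT))) (count-not (λ B → memᵇ B T) (blocks P)))
      (trans (≡ᵇ-true ek) (sym e)))) (sym (*-identityʳ j)))

-- The r points outside `T` are split freely into the j remaining blocks. Induction on the ground
-- set: if 0 is uncovered, the two kinds of extension reproduce the recursion of `S r j`; if it is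
-- covered, deleting it from `T` changes neither r nor j.
cnt-exact : ∀ n k (T : List (Block n)) r j → WF T → usize T + r ≡ n → length T + j ≡ k → cnt n k T ≡ S r j
cnt-exact zero k (B ∷ T) r j w _ _ with () ← proj₁ (WF.inh w (here refl))
cnt-exact zero zero    [] zero .zero    w refl refl = refl
cnt-exact zero (suc k) [] zero .(suc k) w refl refl = refl
cnt-exact (suc n) k T r j w eu el with split T w
... | free e w′ rewrite usize-hd T | length-hd T | e = trans (cnt-suc n k T) (main r j k eu el)
  where
  T⁻ = hd⁻ T
  zero-term : ∀ P → P ∈ enum n → ∀ k → ind k T (ext P zeros) ≡ ⟦ (suc (#blocks P) ≡ᵇ k) ∧ (T⁻ ⊑ᵇ P) ⟧
  zero-term P P∈ k = trans (cong₂ (λ x y → ⟦ (x ≡ᵇ k) ∧ y ⟧) (#blocks-zeros P isP)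
      (trans (⊑-ext P isP zeros (inj₁ refl) T) (cong (λ z → all (_==ᵛ zeros) z ∧ ((T⁻ ⊑ᵇ P) ∧ not (memᵇ zeros T⁻))) e)))
      (cong (λ b → ⟦ (suc (#blocks P) ≡ᵇ k) ∧ b ⟧) (bool-ext (λ h → proj₁ (∧-true h)) (λ h → ∧-intro h
        (cong not (∉⇒memᵇ zeros (λ z → zeros∌ {i = proj₁ (WF.inh w′ z)} (proj₂ (WF.inh w′ z))))))))
    where isP = enum-sound n P P∈
  block-terms : ∀ P → P ∈ enum n → ∀ k j → length T⁻ + j ≡ k → ∑ (blocks P) (λ B → ind k T (ext P B)) ≡ j * ind k T⁻ P
  block-terms P P∈ k j el = trans (∑-cong (blocks P) (λ B B∈ → cong₂ (λ x y → ⟦ (x ≡ᵇ k) ∧ y ⟧) (#blocks-join P isP B (∈-blocks⁻ P B∈))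
      (trans (⊑-ext P isP B (inj₂ (∈-blocks⁻ P B∈)) T) (cong (λ z → all (_==ᵛ B) z ∧ ((T⁻ ⊑ᵇ P) ∧ not (memᵇ B T⁻))) e))))
      (free-blocks P T⁻ k j (WF.uniq w′) el)
    where isP = enum-sound n P P∈
  main : ∀ r j k → usize T⁻ + r ≡ suc n → length T⁻ + j ≡ k →
         ∑ (enum n) (λ P → ind k T (ext P zeros) + ∑ (blocks P) (λ B → ind k T (ext P B))) ≡ S r j
  -- The point 0 is uncovered, so r = 0 would force `T⁻` to cover n + 1 of n points.
  main zero j k eu el = contradiction (usize≤ n T⁻ w′) (<⇒≱ (≤-reflexive (sym (trans (sym (+-identityʳ _)) eu))))
  main (suc r) zero k eu el = trans (∑-cong (enum n) (λ P P∈ → trans (cong₂ _+_ (trans (zero-term P P∈ k) (none P))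
      (block-terms P P∈ k zero el)) refl)) (trans (∑-const (enum n) 0) (*-zeroʳ (length (enum n))))
    where
    none : ∀ P → ⟦ (suc (#blocks P) ≡ᵇ k) ∧ (T⁻ ⊑ᵇ P) ⟧ ≡ 0
    none P = cong ⟦_⟧ (≡false λ h → let a , b = ∧-true {suc (#blocks P) ≡ᵇ k} h in
      <-irrefl {#blocks P} refl (≤-trans (≤-reflexive (trans (≡ᵇ-true a) (trans (sym el) (+-identityʳ _)))) (⊑-length P (WF.uniq w′) b)))
  main (suc r) (suc j) (suc k) eu el = trans (∑-cong (enum n) (λ P P∈ → trans (cong₂ _+_ (zero-term P P∈ (suc k))
      (block-terms P P∈ (suc k) (suc j) el)) (+-comm (ind k T⁻ P) _)))
    (trans (∑-+ (enum n) _ _) (cong₂ _+_ (trans (∑-*ˡ (suc j) (enum n) (ind (suc k) T⁻))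
      (cong (suc j *_) (cnt-exact n (suc k) T⁻ r (suc j) w′ eu′ el)))
      (cnt-exact n k T⁻ r j w′ eu′ (suc-injective (trans (sym (+-suc _ j)) el)))))
    where eu′ = suc-injective (trans (sym (+-suc _ r)) eu)
  main (suc r) (suc j) zero eu el with () ← trans (sym (+-suc (length T⁻) j)) el
cnt-exact (suc n) k T r j w eu el | sing e w′ rewrite usize-hd T | length-hd T | e | size-zeros n with refl ← el =
  trans (cnt-suc n k T) (trans (∑-cong (enum n) (λ P P∈ → trans (cong₂ _+_ (zero-term P P∈) (block-terms P P∈)) (+-identityʳ _)))
    (cnt-exact n (length T⁻ + j) T⁻ r j w′ (suc-injective eu) refl))
  where
  T⁻ = hd⁻ T
  zero-term : ∀ P → P ∈ enum n → ind k T (ext P zeros) ≡ ind (length T⁻ + j) T⁻ P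
  zero-term P P∈ = trans (cong₂ (λ x y → ⟦ (x ≡ᵇ k) ∧ y ⟧) (#blocks-zeros P isP)
      (trans (⊑-ext P isP zeros (inj₁ refl) T) (cong (λ z → all (_==ᵛ zeros) z ∧ ((T⁻ ⊑ᵇ P) ∧ not (memᵇ zeros T⁻))) e)))
      (cong (λ b → ⟦ (#blocks P ≡ᵇ length T⁻ + j) ∧ b ⟧) (bool-ext (λ h → proj₁ (∧-true (proj₂ (∧-true {(zeros {n} ==ᵛ zeros) ∧ true} h))))
        (λ h → ∧-intro (cong (_∧ true) (==ᵛ-refl (zeros {n}))) (∧-intro h
        (cong not (∉⇒memᵇ zeros (λ z → zeros∌ {i = proj₁ (WF.inh w′ z)} (proj₂ (WF.inh w′ z)))))))))
    where isP = enum-sound n P P∈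
  block-terms : ∀ P → P ∈ enum n → ∑ (blocks P) (λ B → ind k T (ext P B)) ≡ 0
  block-terms P P∈ = trans (∑-cong (blocks P) (λ B B∈ → cong ⟦_⟧ (≡false λ h → zeros∉ᵇ P isP (∈-blocks⁻ P B∈)
      (sym (==ᵛ⇒≡ zeros B (all-∈ (_==ᵛ B) (proj₁ (∧-true (trans (sym (⊑-ext P isP B (inj₂ (∈-blocks⁻ P B∈)) T))
        (proj₂ (∧-true {#blocks (ext P B) ≡ᵇ k} h))))) (subst (zeros ∈_) (sym e) (here refl))))))))
      (trans (∑-const (blocks P) 0) (*-zeroʳ (length (blocks P))))
    where isP = enum-sound n P P∈
cnt-exact (suc n) k T r j w eu el | join B₀ (i₀ , b₀) e w′ rewrite usize-hd T | length-hd T | e | +-identityʳ (size B₀) =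
  trans (cnt-suc n k T) (trans (∑-cong (enum n) (λ P P∈ → cong₂ _+_ (zero-term P P∈) (block-terms P P∈)))
    (cnt-exact n k (B₀ ∷ T⁻) r j w′ (suc-injective eu) el))
  where
  T⁻ = hd⁻ T
  B₀∉ : ¬ B₀ ∈ T⁻
  B₀∉ h with a ∷ _ ← WF.uniq w′ = All.lookup a h refl
  is-B₀ : ∀ P → IsPartition P → ∀ B → Extends P B → T ⊑ᵇ ext P B ≡ true → B₀ ≡ B
  is-B₀ P isP B eB h = ==ᵛ⇒≡ B₀ B (all-∈ (_==ᵛ B) (proj₁ (∧-true (trans (sym (⊑-ext P isP B eB T)) h))) (subst (B₀ ∈_) (sym e) (here refl)))
  zero-term : ∀ P → P ∈ enum n → ind k T (ext P zeros) ≡ 0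
  zero-term P P∈ = cong ⟦_⟧ (≡false λ h → zeros∌ {i = i₀} (subst (_∋ i₀)
    (is-B₀ P (enum-sound n P P∈) zeros (inj₁ refl) (proj₂ (∧-true {#blocks (ext P zeros) ≡ᵇ k} h))) b₀))
  block-terms : ∀ P → P ∈ enum n → ∑ (blocks P) (λ B → ind k T (ext P B)) ≡ ind k (B₀ ∷ T⁻) P
  block-terms P P∈ = trans (∑-cong (blocks P) (λ B B∈ → trans (pt B (∈-blocks⁻ P B∈)) (*-comm ⟦ B ==ᵛ B₀ ⟧ _)))
      (trans (∑-*ˡ c (blocks P) (λ B → ⟦ B ==ᵛ B₀ ⟧)) (trans (cong (c *_) (sym (count-∑ (_==ᵛ B₀) (blocks P)))) fin))
    where
    isP = enum-sound n P P∈
    c = ind k T⁻ P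
    pt : ∀ B → B ∈ᵇ P ≡ true → ind k T (ext P B) ≡ ⟦ B ==ᵛ B₀ ⟧ * c
    pt B B∈ with B ==ᵛ B₀ in eB
    ... | false = cong ⟦_⟧ (≡false λ h → ==ᵛ-false⇒≢ eB (sym (is-B₀ P isP B (inj₂ B∈) (proj₂ (∧-true {#blocks (ext P B) ≡ᵇ k} h)))))
    ... | true with refl ← ==ᵛ⇒≡ B B₀ eB = trans (cong₂ (λ x y → ⟦ (x ≡ᵇ k) ∧ y ⟧) (#blocks-join P isP B B∈)
        (trans (⊑-ext P isP B (inj₂ B∈) T) (trans (cong (λ z → all (_==ᵛ B) z ∧ ((T⁻ ⊑ᵇ P) ∧ not (memᵇ B T⁻))) e)
          (bool-ext (λ h → proj₁ (∧-true (proj₂ (∧-true {(B ==ᵛ B) ∧ true} h))))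
            (λ h → ∧-intro (cong (_∧ true) (==ᵛ-refl B)) (∧-intro h (cong not (∉⇒memᵇ B B₀∉)))))))) (sym (+-identityʳ c))
    fin : c * count (_==ᵛ B₀) (blocks P) ≡ ind k (B₀ ∷ T⁻) P
    fin with B₀ ∈ᵇ P in e₀
    ... | true rewrite count-≡ (Unique-blocks P) (∈-blocks⁺ P e₀) = *-identityʳ c
    ... | false rewrite count-none {p = _==ᵛ B₀} (blocks P) (λ B B∈ → ≢⇒==ᵛ {B = B} {B₀} λ { refl → contradiction (trans (sym (∈-blocks⁻ P B∈)) e₀) (λ ()) })
          = trans (*-zeroʳ c) (cong ⟦_⟧ (sym (∧-zeroʳ (#blocks P ≡ᵇ k))))

abstract
  famWith : ∀ n → ℕ → List (Block n) → List (Part n)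
  famWith n k T = filterᵇ (λ P → (#blocks P ≡ᵇ k) ∧ (T ⊑ᵇ P)) (enum n)

  length-famWith : ∀ n k T → length (famWith n k T) ≡ cnt n k T
  length-famWith n k T = count-∑ _ (enum n)

  ∈-famWith⁺ : ∀ {k T} (P : Part n) → IsKPartition k P → T ⊑ᵇ P ≡ true → P ∈ famWith n k T
  ∈-famWith⁺ {n} P (isP , refl) h = ∈-filterᵇ⁺ _ (enum-complete n P isP) (∧-intro (≡ᵇ-refl (#blocks P)) h)

  ∈-famWith⁻ : ∀ {k T} (P : Part n) → P ∈ famWith n k T → IsKPartition k P × T ⊑ᵇ P ≡ true
  ∈-famWith⁻ {n} {k} {T} P h with P∈ , e ← ∈-filterᵇ⁻ (λ P → (#blocks P ≡ᵇ k) ∧ (T ⊑ᵇ P)) {enum n} h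
                                with a , b ← ∧-true {#blocks P ≡ᵇ k} e = (enum-sound n P P∈ , ≡ᵇ-true a) , b

  Unique-famWith : ∀ n k T → Unique (famWith n k T)
  Unique-famWith n k T = Unique-filterᵇ _ (Unique-enum n)

famWith-singletons : ∀ {k} c (T : List (Block n)) j → WF T → usize T ≡ length T → length T + suc j ≡ k → n ≡ c + k →
                     length (famWith n k T) ≡ A c j
famWith-singletons {n} {k} c T j w e el en = trans (length-famWith n k T) (cnt-exact n k T (suc (c + j)) (suc j) w eu el)
  where
  eu : usize T + suc (c + j) ≡ n
  eu = trans (cong (_+ suc (c + j)) e) (trans (lem (length T) c j) (trans (cong (c +_) el) (sym en)))
    where lem : ∀ l c j → l + suc (c + j) ≡ c + (l + suc j)
          lem = solve-∀

module Count {n} {k : ℕ} (G : Family n) (FG : FamilyIn k G) where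

  count≤cnt : ∀ T → count (T ⊑ᵇ_) G ≤ cnt n k T
  count≤cnt T = ≤-trans (Unique-⊆⇒length≤ {ys = famWith n k T} (Unique-filterᵇ (T ⊑ᵇ_) (proj₁ FG))
      (λ P P∈ → let P∈G , h = ∈-filterᵇ⁻ (T ⊑ᵇ_) {G} P∈ in ∈-famWith⁺ {k = k} {T} P (All.lookup (proj₂ FG) P∈G) h))
    (≤-reflexive (length-famWith n k T))

  -- `T` may overlap itself or contain an empty block: either no member contains it and the count is
  -- 0, or a member containing it shows that it is well formed.
  count-S : ∀ T r j → Unique T → length T + suc j ≡ k → (WF T → n ≤ usize T + r) → count (T ⊑ᵇ_) G ≤ S r (suc j)
  count-S T r j u el bnd with count (T ⊑ᵇ_) G in e
  ... | zero  = z≤n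
  ... | suc m with P , P∈ , h ← count-∃ (T ⊑ᵇ_) G (≤-trans (s≤s z≤n) (≤-reflexive (sym e))) =
    ≤-trans (≤-reflexive (sym e)) (≤-trans (count≤cnt T) (≤-trans (≤-reflexive (cnt-exact n k T (n ∸ usize T) (suc j) w
      (m+[n∸m]≡n (usize≤ n T w)) el)) (S-monoˡ j (≤-trans (∸-monoˡ-≤ (usize T) (bnd w)) (≤-reflexive (m+n∸m≡n (usize T) r))))))
    where w = ⊑-WF P (proj₁ (All.lookup (proj₂ FG) P∈)) u h

  private
    arith : ∀ {c j} l → l + suc j ≡ k → n ≡ c + k → n ≡ l + suc (c + j)
    arith {c} {j} l el en = trans en (trans (cong (c +_) (sym el)) (lem l c j))
      where lem : ∀ l c j → c + (l + suc j) ≡ l + suc (c + j)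
            lem = solve-∀

  count-A : ∀ c T j → Unique T → length T + suc j ≡ k → n ≡ c + k → count (T ⊑ᵇ_) G ≤ A c j
  count-A c T j u el en = count-S T (suc (c + j)) j u el (λ w → ≤-trans (≤-reflexive (arith (length T) el en))
    (+-monoˡ-≤ (suc (c + j)) (length≤usize T (WF.inh w))))

  -- A block that is not a singleton uses up an extra point. In the applications this costs a factor
  -- of at least 2, which is what eventually forces singletons.
  count-A⁻ : ∀ c T j → Unique T → length T + suc j ≡ k → n ≡ c + k → length T < usize T → count (T ⊑ᵇ_) G ≤ S (c + j) (suc j)
  count-A⁻ c T j u el en lt = count-S T (c + j) j u el (λ w → ≤-trans (≤-reflexive (trans (arith (length T) el en) (+-suc (length T) (c + j))))
    (+-monoˡ-≤ (c + j) lt))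

  count-tail : ∀ B T → count ((B ∷ T) ⊑ᵇ_) G ≤ count (T ⊑ᵇ_) G
  count-tail B T = count-mono G (λ P _ h → proj₂ (∧-true {B ∈ᵇ P} h))

  -- For d = J + 1 the set has k blocks, beyond the range of `count-A`. One block is dropped: k - 1
  -- blocks already determine a k-partition, and A c 0 = 1 is the value at the truncated index.
  count-cover : ∀ c t J d T → Unique T → k ≡ suc (t + J) → n ≡ c + k → d ≤ suc J → length T ≡ t + d → count (T ⊑ᵇ_) G ≤ A c (J ∸ d)
  count-cover c t J d T u refl en d≤ el with m≤n⇒m<n∨m≡n d≤
  ... | inj₁ (s≤s d≤J) = count-A c T (J ∸ d) u (trans (cong (_+ suc (J ∸ d)) el) (trans (lem t d (J ∸ d)) (cong (λ x → suc (t + x)) (m+[n∸m]≡n d≤J)))) en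
    where lem : ∀ t d x → t + d + suc x ≡ suc (t + (d + x))
          lem = solve-∀
  count-cover c t J d [] u refl en d≤ el | inj₂ refl with () ← trans el (+-suc t J)
  count-cover c t J d (B ∷ T) (_ ∷ u) refl en d≤ el | inj₂ refl rewrite m≤n⇒m∸n≡0 (n≤1+n J) =
    ≤-trans (count-tail B T) (count-A c T 0 u (trans (+-comm (length T) 1) (trans el (+-suc t J))) en)

-- Covers and their extension by blocks of the other family.

common-blocks : (P Q : Part n) → #common P Q ≡ count (_∈ᵇ P) (blocks Q)
common-blocks {n} P Q = trans (count-cong (allSubsets n) (λ B _ → ∧-comm (B ∈ᵇ P) (B ∈ᵇ Q)))
  (sym (count-filter (_∈ᵇ P) (_∈ᵇ Q) (allSubsets n)))

common≥ : (P Q : Part n) (L : List (Block n)) → Unique L → (∀ {B} → B ∈ L → B ∈ᵇ P ≡ true × B ∈ᵇ Q ≡ true) → length L ≤ #common P Q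
common≥ {n} P Q L u h = Unique-⊆⇒length≤ {ys = filterᵇ (λ B → (B ∈ᵇ P) ∧ (B ∈ᵇ Q)) (allSubsets n)} u (λ B B∈ → ∈-filterᵇ⁺ (λ B → (B ∈ᵇ P) ∧ (B ∈ᵇ Q)) (∈-allSubsets B) (∧-intro (proj₁ (h B∈)) (proj₂ (h B∈))))

count-drop : ∀ {X : Set} (p : X → Bool) m xs → count p xs ≤ m + count p (drop m xs)
count-drop p zero    xs       = ≤-refl
count-drop p (suc m) []       = z≤n
count-drop p (suc m) (x ∷ xs) rewrite count-∷ p x xs = +-mono-≤ (⟦⟧≤1 (p x)) (count-drop p m xs)

∈-drop : ∀ {X : Set} m {xs : List X} {x} → x ∈ drop m xs → x ∈ xs
∈-drop zero    h = h
∈-drop (suc m) {y ∷ xs} h = there (∈-drop m h)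

∈-drop-++ : ∀ {X : Set} m (xs {ys} : List X) {x} → length xs ≤ m → x ∈ drop m (xs ++ ys) → x ∈ ys
∈-drop-++ m       []       h x∈ = ∈-drop m x∈
∈-drop-++ (suc m) (_ ∷ xs) (s≤s h) x∈ = ∈-drop-++ m xs h x∈

∈-drop-++⁺ : ∀ {X : Set} m (xs {ys} : List X) {x} → m ≤ length xs → x ∈ ys → x ∈ drop m (xs ++ ys)
∈-drop-++⁺ zero    xs       h x∈ = ∈-++⁺ʳ xs x∈
∈-drop-++⁺ (suc m) (_ ∷ xs) (s≤s h) x∈ = ∈-drop-++⁺ m xs h x∈

count-partition : ∀ {X : Set} (p q : X → Bool) xs → count p (filterᵇ q xs ++ filterᵇ (not ∘ q) xs) ≡ count p xs
count-partition p q [] = refl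
count-partition p q (x ∷ xs) with ih ← count-partition p q xs with q x
... | true  = trans (count-∷ p x _) (trans (cong (⟦ p x ⟧ +_) ih) (sym (count-∷ p x xs)))
... | false = trans (count-++ p (filterᵇ q xs) _) (trans (cong (count p (filterᵇ q xs) +_) (count-∷ p x (filterᵇ (not ∘ q) xs)))
   (trans (lem (count p (filterᵇ q xs)) ⟦ p x ⟧ _) (trans (cong (⟦ p x ⟧ +_) (trans (sym (count-++ p (filterᵇ q xs) _)) ih)) (sym (count-∷ p x xs)))))
  where lem : ∀ a b c → a + (b + c) ≡ b + (a + c)
        lem = solve-∀

Unique-drop : ∀ {X : Set} m {xs : List X} → Unique xs → Unique (drop m xs)
Unique-drop zero    u = u
Unique-drop (suc m) [] = []
Unique-drop (suc m) (_ ∷ u) = Unique-drop m u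

count-mem≡ : ∀ (Q : Part n) {T} → Unique T → count (λ B → memᵇ B T) (blocks Q) ≡ count (_∈ᵇ Q) T
count-mem≡ Q {T} u = ≤-antisym
  (Unique-⊆⇒length≤ (Unique-filterᵇ (λ B → memᵇ B T) (Unique-blocks Q)) λ B B∈ →
    let a , b = ∈-filterᵇ⁻ (λ B → memᵇ B T) {blocks Q} B∈ in ∈-filterᵇ⁺ (_∈ᵇ Q) (memᵇ⇒∈ B T b) (∈-blocks⁻ Q a))
  (Unique-⊆⇒length≤ (Unique-filterᵇ (_∈ᵇ Q) u) λ B B∈ →
    let a , b = ∈-filterᵇ⁻ (_∈ᵇ Q) {T} B∈ in ∈-filterᵇ⁺ (λ B → memᵇ B T) (∈-blocks⁺ Q b) (∈⇒memᵇ B a))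

-- If T shares at most t blocks with Q, a partition containing T and sharing t + 1 blocks with Q must contain
-- one of any #Q − t blocks of Q outside T.
module Extension (t : ℕ) (Q : Part n) (T : List (Block n)) (u : Unique T) (few : count (_∈ᵇ Q) T ≤ t) where
  private
    inT outT : List (Block n)
    inT  = filterᵇ (λ B → memᵇ B T) (blocks Q)
    outT = filterᵇ (not ∘ (λ B → memᵇ B T)) (blocks Q)

  W : List (Block n)
  -- The blocks of Q in `T` stand first and number at most t, so what survives lies outside `T`.
  -- Exactly t blocks are dropped, hence a partition sharing t + 1 blocks with Q still meets the
  -- rest.
  W = drop t (inT ++ outT)

  length-W : length W ≡ #blocks Q ∸ t
  length-W = trans (length-drop t (inT ++ outT)) (cong (_∸ t) (trans (length-++ inT) (count-not (λ B → memᵇ B T) (blocks Q))))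

  Unique-W : Unique W
  Unique-W = Unique-drop t (Uniqueₚ.++⁺ (Unique-filterᵇ _ (Unique-blocks Q)) (Unique-filterᵇ _ (Unique-blocks Q))
    (λ {v} (a , b) → contradiction (trans (sym (cong not (proj₂ (∈-filterᵇ⁻ (λ B → memᵇ B T) {blocks Q} a)))) (proj₂ (∈-filterᵇ⁻ (not ∘ (λ B → memᵇ B T)) {blocks Q} b))) (λ ())))

  W⊆ : ∀ {B} → B ∈ W → B ∈ᵇ Q ≡ true × ¬ B ∈ T
  W⊆ {B} h with a , b ← ∈-filterᵇ⁻ (not ∘ (λ B → memᵇ B T)) {blocks Q} (∈-drop-++ t inT (≤-trans (≤-reflexive (count-mem≡ Q u)) few) h) =
    ∈-blocks⁻ Q a , λ B∈ → not⇒¬ b (∈⇒memᵇ B B∈)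

  ⊆W : t ≤ count (_∈ᵇ Q) T → ∀ {B} → B ∈ᵇ Q ≡ true → ¬ B ∈ T → B ∈ W
  ⊆W h {B} b B∉ = ∈-drop-++⁺ t inT (≤-trans h (≤-reflexive (sym (count-mem≡ Q u))))
    (∈-filterᵇ⁺ (not ∘ (λ B → memᵇ B T)) (∈-blocks⁺ Q b) (cong not (∉⇒memᵇ B B∉)))

  W-hit : ∀ P → suc t ≤ count (_∈ᵇ P) (blocks Q) → ∃ λ B → B ∈ W × B ∈ᵇ P ≡ true
  W-hit P h = count-∃ (_∈ᵇ P) W (+-cancelˡ-≤ t 1 _ (≤-trans (≤-trans (≤-reflexive (+-comm t 1)) h)
    (≤-trans (≤-reflexive (sym (count-partition (_∈ᵇ P) (λ B → memᵇ B T) (blocks Q)))) (count-drop (_∈ᵇ P) t (inT ++ outT)))))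

Cov : ℕ → List (Block n) → Family n → Set
Cov t T H = ∀ Q → Q ∈ H → t ≤ count (_∈ᵇ Q) T

cov? : ∀ t (T : List (Block n)) H → Cov t T H ⊎ ∃ λ Q → Q ∈ H × count (_∈ᵇ Q) T < t
cov? t T [] = inj₁ λ _ ()
cov? t T (Q ∷ H) with ≤-<-connex t (count (_∈ᵇ Q) T)
... | inj₂ lt = inj₂ (Q , here refl , lt)
... | inj₁ le with cov? t T H
...   | inj₂ (Q′ , Q∈ , lt) = inj₂ (Q′ , there Q∈ , lt)
...   | inj₁ f = inj₁ λ { _ (here refl) → le ; Q′ (there Q∈) → f Q′ Q∈ }

Cross : ℕ → Family n → Family n → Set
Cross t G H = ∀ P Q → P ∈ G → Q ∈ H → t ≤ count (_∈ᵇ P) (blocks Q)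

extend-step : ∀ {t I} {G H : Family n} → Cross (suc t) G H → All (λ Q → #blocks Q ≡ suc (suc t + I)) H →
              ∀ T → Unique T → ¬ Cov (suc t) T H → ∀ w →
              (∀ B → Unique (B ∷ T) → count ((B ∷ T) ⊑ᵇ_) G ≤ w) → count (T ⊑ᵇ_) G ≤ (2 + I) * w
extend-step {t = t} {I} {G} {H} x lH T u nc w bnd with cov? (suc t) T H
... | inj₁ cov = contradiction cov nc
... | inj₂ (Q , Q∈ , s≤s few) = ≤-trans
    (union-bound (T ⊑ᵇ_) (λ B P → (B ∷ T) ⊑ᵇ P) W (λ _ → w) G
      (λ P P∈ h → let B , B∈ , b = W-hit P (x P Q P∈ Q∈) in B , B∈ , ∧-intro b h)
      (λ B B∈ → bnd B (∉⇒All≢ (proj₂ (W⊆ B∈)) ∷ u)))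
    (≤-reflexive (trans (∑-const W _) (cong (_* w) lW)))
  where
  open Extension t Q T u few
  lW : length W ≡ 2 + I
  lW = trans length-W (trans (cong (_∸ t) (trans (All.lookup lH Q∈) (lem t I))) (m+n∸n≡m (2 + I) t))
    where lem : ∀ t I → suc (suc t + I) ≡ 2 + I + t
          lem = solve-∀

extend-bound : ∀ {t I} {G H : Family n} → Cross (suc t) G H → All (λ Q → #blocks Q ≡ suc (suc t + I)) H →
               ∀ d T → Unique T → (∀ T′ → Unique T′ → length T ≤ length T′ → length T′ < length T + d → ¬ Cov (suc t) T′ H) →
               ∀ w → (∀ T′ → Unique T′ → length T′ ≡ length T + d → count (T′ ⊑ᵇ_) G ≤ w) →
               count (T ⊑ᵇ_) G ≤ (2 + I) ^ d * w
extend-bound x lH zero T u nc w bnd =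
  ≤-trans (bnd T u (sym (+-identityʳ _))) (≤-reflexive (sym (+-identityʳ w)))
extend-bound {I = I} x lH (suc d) T u nc w bnd = ≤-trans
  (extend-step x lH T u (nc T u ≤-refl (≤-trans (≤-reflexive (+-comm 1 (length T))) (+-monoʳ-≤ (length T) (s≤s z≤n)))) ((2 + I) ^ d * w)
    (λ B u′ → extend-bound x lH d (B ∷ T) u′
      (λ T′ u″ ge lt → nc T′ u″ (≤-trans (n≤1+n _) ge) (≤-trans lt (≤-reflexive (sym (+-suc (length T) d))))) w
      (λ T′ u″ e → bnd T′ u″ (trans e (sym (+-suc (length T) d))))))
  (≤-reflexive (sym (*-assoc (2 + I) ((2 + I) ^ d) w)))

≤ᵇ-true : ∀ {m k} → (m ≤ᵇ k) ≡ true → m ≤ k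
≤ᵇ-true {m} {k} h = ≤ᵇ⇒≤ m k (subst T (sym h) _)

≤⇒≤ᵇ-true : ∀ {m k} → m ≤ k → (m ≤ᵇ k) ≡ true
≤⇒≤ᵇ-true {m} {k} h with m ≤ᵇ k | ≤⇒≤ᵇ h
... | true | _ = refl

⊆-∈ : ∀ {X : Set} {xs ys : List X} → xs ⊆ ys → ∀ {x} → x ∈ xs → x ∈ ys
⊆-∈ (y ∷ʳ s)   x∈          = there (⊆-∈ s x∈)
⊆-∈ (refl ∷ s) (here refl) = here refl
⊆-∈ (refl ∷ s) (there x∈)  = there (⊆-∈ s x∈)

Unique-⊆ : ∀ {X : Set} {xs ys : List X} → xs ⊆ ys → Unique ys → Unique xs
Unique-⊆ []         [] = []
Unique-⊆ (y ∷ʳ s)   (_ ∷ u) = Unique-⊆ s u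
Unique-⊆ (refl ∷ s) (a ∷ u) = All.tabulate (λ x∈ → All.lookup a (⊆-∈ s x∈)) ∷ Unique-⊆ s u

-- (r + 1)^(|S| − r) bounds the number of r-subsets of S.
cover-bound : ∀ (G : Family n) S r d (z : Part n → Bool) w → length S ≡ r + d →
              (∀ Y → Y ⊆ S → length Y ≡ r → count (λ P → z P ∧ (Y ⊑ᵇ P)) G ≤ w) →
              count (λ P → z P ∧ (r ≤ᵇ count (_∈ᵇ P) S)) G ≤ suc r ^ d * w
cover-bound G S zero d z w el bnd = ≤-trans (bnd [] (minimum S) refl) (≤-reflexive (sym (trans (cong (_* w) (^-zeroˡ d)) (*-identityˡ w))))
cover-bound G (B ∷ S) (suc r) d z w el bnd = begin
    count (λ P → z P ∧ (suc r ≤ᵇ count (_∈ᵇ P) (B ∷ S))) G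
      ≤⟨ union-bound _ ev (true ∷ false ∷ []) val G cov bound ⟩
    suc r ^ d * w + (val false + 0)
      ≤⟨ last d ⟩
    suc (suc r) ^ d * w ∎
  where
  open ≤-Reasoning
  z′ : Part _ → Bool
  z′ P = z P ∧ (B ∈ᵇ P)
  ev : Bool → Part _ → Bool
  ev true  P = z′ P ∧ (r ≤ᵇ count (_∈ᵇ P) S)
  ev false P = z P ∧ (suc r ≤ᵇ count (_∈ᵇ P) S)
  second : ℕ → ℕ
  second zero    = 0
  second (suc d) = suc (suc r) ^ d * w
  val : Bool → ℕ
  val true  = suc r ^ d * w
  val false = second d
  cov : ∀ P → P ∈ G → z P ∧ (suc r ≤ᵇ count (_∈ᵇ P) (B ∷ S)) ≡ true → ∃ λ b → b ∈ (true ∷ false ∷ []) × ev b P ≡ true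
  cov P _ h with zP , g ← ∧-true {z P} h with B ∈ᵇ P in eB
  ... | true  = true , here refl , ∧-intro (∧-intro zP eB) (≤⇒≤ᵇ-true {r} {count (_∈ᵇ P) S} (s≤s⁻¹ (≤ᵇ-true {suc r} g)))
  ... | false = false , there (here refl) , ∧-intro zP g
  second-bound : ∀ d → length S ≡ r + d → count (ev false) G ≤ second d
  second-bound zero e = ≤-reflexive (count-none G (λ P _ → ≡false λ h → <⇒≱ (≤ᵇ-true {suc r} (proj₂ (∧-true {z P} h)))
    (≤-trans (count-≤length (_∈ᵇ P) S) (≤-reflexive (trans e (+-identityʳ r))))))
  second-bound (suc d) e = cover-bound G S (suc r) d z w (trans e (+-suc r d)) (λ Y s → bnd Y (B ∷ʳ s))
  bound : ∀ b → b ∈ (true ∷ false ∷ []) → count (ev b) G ≤ val b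
  bound true  _ = cover-bound G S r d z′ w (suc-injective el) (λ Y s e → ≤-trans
    (count-mono G (λ P _ h → let a , b = ∧-true {z′ P} h ; a₁ , a₂ = ∧-true {z P} a in ∧-intro a₁ (∧-intro a₂ b)))
    (bnd (B ∷ Y) (refl ∷ s) (cong suc e)))
  bound false _ = second-bound d (suc-injective el)
  last : ∀ d → suc r ^ d * w + (second d + 0) ≤ suc (suc r) ^ d * w
  last zero    = ≤-reflexive (+-identityʳ _)
  last (suc d) = ≤-trans (+-monoˡ-≤ _ (*-monoˡ-≤ w (*-monoʳ-≤ (suc r) (^-monoˡ-≤ d (n≤1+n (suc r)))))) (≤-reflexive (lem r (suc (suc r) ^ d) w))
    where lem : ∀ r x w → suc r * x * w + (x * w + 0) ≡ suc (suc r) * x * w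
          lem = solve-∀

-- `C` is not decidable in general, so a least witness is available only while proving ⊥. That
-- suffices, since each use refutes a configuration.
minimal : (C : ℕ → Set) → ∀ d → C d → (∀ e → e ≤ d → C e → (∀ e′ → e′ < e → ¬ C e′) → ⊥) → ⊥
minimal C d cd k = go (suc d) d ≤-refl cd k
  where
  go : ∀ N d → d < N → C d → (∀ e → e ≤ d → C e → (∀ e′ → e′ < e → ¬ C e′) → ⊥) → ⊥
  go (suc N) d (s≤s d≤N) cd k = k d ≤-refl cd (λ e e<d ce → go N e (≤-trans e<d d≤N) ce
    (λ e′ e′≤e → k e′ (≤-trans e′≤e (<⇒≤ e<d))))

-- Least covers and crossing pairs.

CovOfSize : ℕ → Family n → ℕ → Set
CovOfSize {n} t H s = ∃ λ (S : List (Block n)) → Unique S × length S ≡ s × Cov t S H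

cov⇒⊑ : ∀ {t} (T : List (Block n)) {H} → length T ≡ t → Cov t T H → ∀ Q → Q ∈ H → T ⊑ᵇ Q ≡ true
cov⇒⊑ T refl c Q Q∈ = ∈-all (_∈ᵇ Q) T (λ {B} B∈ → count-full (_∈ᵇ Q) T (c Q Q∈) B B∈)

⊑⇒cov : ∀ {t} (T : List (Block n)) {H} → length T ≡ t → (∀ Q → Q ∈ H → T ⊑ᵇ Q ≡ true) → Cov t T H
⊑⇒cov T refl h Q Q∈ = ≤-reflexive (sym (count-all T (λ B B∈ → all-∈ (_∈ᵇ Q) (h Q Q∈) B∈)))

count-true : ∀ {X : Set} (xs : List X) {p : X → Bool} → (∀ x → x ∈ xs → p x ≡ true) → length xs ≤ count p xs
count-true xs h = ≤-reflexive (sym (count-all xs h))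

-- A member of one family covers the other; this bounds the size of a least cover from above and
-- starts each use of `minimal`.
members-cover : ∀ {t k} {G H : Family n} → Cross t H G → FamilyIn k G → ∀ P → P ∈ G → CovOfSize t H k
members-cover x FG P P∈ = blocks P , Unique-blocks P , proj₂ (All.lookup (proj₂ FG) P∈) , λ Q Q∈ → x Q P Q∈ P∈

-- The sizes are k = t + 2 + j and ℓ = t + 2 + i with t = t′ + 1, so that k, ℓ ≥ t + 2 holds by
-- construction; c₁ and c₂ are n - k and n - ℓ, the first argument of `A`. Keeping both orders of
-- the crossing property makes `flip` immediate.
record Crossing (n t′ j i c₁ c₂ : ℕ) : Set where
  field
    G H : Family n
    en₁ : n ≡ c₁ + suc (suc t′ + suc j)
    en₂ : n ≡ c₂ + suc (suc t′ + suc i)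
    FG  : FamilyIn (suc (suc t′ + suc j)) G
    FH  : FamilyIn (suc (suc t′ + suc i)) H
    x   : Cross (suc t′) G H
    x′  : Cross (suc t′) H G

flip : ∀ {t′ j i c₁ c₂} → Crossing n t′ j i c₁ c₂ → Crossing n t′ i j c₂ c₁
flip C = record { G = H ; H = G ; en₁ = en₂ ; en₂ = en₁ ; FG = FH ; FH = FG ; x = x′ ; x′ = x }
  where open Crossing C

-- One X serves both families, so that the flipped pair satisfies the same bounds.
record Bounds {n t′ j i c₁ c₂} (C : Crossing n t′ j i c₁ c₂) : Set where
  field
    X   : ℕ
    2≤X : 2 ≤ X
    g₁  : Good X c₁ (suc j)
    g₂  : Good X c₂ (suc i)
    hI  : (2 + t′) * (3 + i) ≤ X
    hJ  : (2 + t′) * (3 + j) ≤ X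

record Kernel {n t′ j i c₁ c₂} (C : Crossing n t′ j i c₁ c₂) : Set where
  open Crossing C
  field
    Z     : List (Block n)
    uZ    : Unique Z
    lZ    : length Z ≡ suc t′
    cZ    : ∀ P → P ∈ G → Z ⊑ᵇ P ≡ true
    P₀ Q₀ : Part n
    P₀∈   : P₀ ∈ G
    Q₀∈   : Q₀ ∈ H
    few   : count (_∈ᵇ Q₀) Z ≤ t′

module Pair {n t′ j i c₁ c₂} (C : Crossing n t′ j i c₁ c₂) where
  open Crossing C
  open Count G FG
  private
    t J I c : ℕ
    t = suc t′
    J = suc j
    I = suc i
    c = c₁

  sizesH : All (λ Q → #blocks Q ≡ suc (t + I)) H
  sizesH = All.map proj₂ (proj₂ FH)

  -- Each member of G contains a t-subset of the cover `S`, with at most (t + 1)^e choices. As no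
  -- t-cover of H has fewer than t + d blocks, every choice can be extended d times, until t + d
  -- blocks are fixed.
  cover-extend : ∀ e d S → length S ≡ t + e → Unique S → Cov t S G → d ≤ suc J →
                 (∀ T → Unique T → t ≤ length T → length T < t + d → ¬ Cov t T H) →
                 length G ≤ suc t ^ e * ((2 + I) ^ d * A c (J ∸ d))
  cover-extend e d S lS uS cS d≤ nc = ≤-trans
    (count-true G {λ P → true ∧ (t ≤ᵇ count (_∈ᵇ P) S)} (λ P P∈ → ≤⇒≤ᵇ-true (cS P P∈)))
    (cover-bound G S t e (λ _ → true) ((2 + I) ^ d * A c (J ∸ d)) lS λ Y Y⊆ lY →
      extend-bound x sizesH d Y (Unique-⊆ Y⊆ uS)
        (λ T u ge lt → nc T u (≤-trans (≤-reflexive (sym lY)) ge) (≤-trans lt (≤-reflexive (cong (_+ d) lY))))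
        (A c (J ∸ d))
        (λ T u lT → count-cover c t J d T u refl en₁ d≤ (trans lT (cong (_+ d) lY))))

  count-plus1 : ∀ T → Unique T → length T ≡ t + 1 → count (T ⊑ᵇ_) G ≤ A c (J ∸ 1)
  count-plus1 T u lT = count-cover c t J 1 T u refl en₁ (s≤s z≤n) lT

no-small : ∀ {t} {H : Family n} d → (∀ e → e < d → ¬ CovOfSize t H (t + e)) →
           ∀ T → Unique T → t ≤ length T → length T < t + d → ¬ Cov t T H
no-small {t = t} d h T u ge lt cT with e , eq ← m≤n⇒∃[o]m+o≡n ge =
  h e (+-cancelˡ-< t e d (≤-trans (≤-reflexive (cong suc eq)) lt)) (T , u , sym eq , cT)

[mn]^≤ : ∀ {a b X} d → a * b ≤ X → a ^ d * b ^ d ≤ X ^ d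
[mn]^≤ {a} {b} d h = ≤-trans (≤-reflexive (sym (^-distribʳ-* d a b))) (^-monoˡ-≤ d h)

-- Neither or both of the families have t common blocks.

module BothSpread {n t′ j i c₁ c₂} (C : Crossing n t′ j i c₁ c₂) (B : Bounds C) (i≤j : i ≤ j) where
  open Crossing C
  open Bounds B
  private
    t p q q′ : ℕ
    t = suc t′
    p = A c₁ j
    q = A c₂ (suc i)
    q′ = A c₂ i
  module GH = Pair C
  module HG = Pair (flip C)

  -- For i, j ≥ 1 each side retains one factor X, and X² is absorbed by `ratio` for the second
  -- family. For i = 0 its Stirling number has shrunk to 1, and the remaining X³ or X⁴ is absorbed
  -- by A c₂ 1 through `big`.
  numeric : ∀ i j → i ≤ j → Good X c₁ (suc j) → Good X c₂ (suc i) → ∀ d₁ d₂ → 1 ≤ d₁ → d₁ ≤ 2 + j → 1 ≤ d₂ → d₂ ≤ 2 + i →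
            (X ^ d₁ * A c₁ (suc j ∸ d₁)) * (X ^ d₂ * A c₂ (suc i ∸ d₂)) ≤ A c₁ j * (A c₂ (suc i) + A c₂ i)
  numeric (suc i) (suc j) le g₁ g₂ d₁ d₂ a b c d = ≤-trans (*-mono-≤ (cover₁ g₁ 2≤X d₁ a b) (cover₁ g₂ 2≤X d₂ c d))
    (≤-trans (≤-reflexive (lem X (A c₁ (suc j)) (A c₂ (suc i)))) (*-monoʳ-≤ (A c₁ (suc j)) (Good.ratio g₂ (suc i) ≤-refl)))
    where lem : ∀ X p q → X * p * (X * q) ≡ p * (X * X * q)
          lem = solve-∀
  numeric zero (suc j) le g₁ g₂ d₁ d₂ a b c d = ≤-trans (*-mono-≤ (cover₁ g₁ 2≤X d₁ a b) (small d₂ c d))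
    (≤-trans (≤-reflexive (lem X (A c₁ (suc j)))) (*-monoʳ-≤ (A c₁ (suc j)) (≤-trans (X^6≤ g₂ 2≤X 3 (s≤s (s≤s (s≤s z≤n)))) (m≤m+n _ _))))
    where
    lem : ∀ X p → X * p * (X * (X * 1)) ≡ p * (X * (X * (X * 1)))
    lem = solve-∀
    small : ∀ d → 1 ≤ d → d ≤ 2 → X ^ d * A c₂ (1 ∸ d) ≤ X ^ 2
    small d a b = ≤-trans (≤-reflexive (trans (cong (X ^ d *_) (trans (cong (A c₂) (m≤n⇒m∸n≡0 a)) (A-zero c₂))) (*-identityʳ _)))
      (^-monoʳ-≤ X ⦃ >-nonZero (≤-trans (s≤s z≤n) 2≤X) ⦄ b)
  numeric zero zero le g₁ g₂ d₁ d₂ a b c d = ≤-trans (*-mono-≤ (small c₁ d₁ a b) (small c₂ d₂ c d))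
    (≤-trans (≤-reflexive (sym (^-distribˡ-+-* X 2 2))) (≤-trans (X^6≤ g₂ 2≤X 4 (s≤s (s≤s (s≤s (s≤s z≤n)))))
      (≤-trans (m≤m+n (A c₂ 1) (A c₂ 0)) (≤-reflexive (sym (trans (cong (_* (A c₂ 1 + A c₂ 0)) (A-zero c₁)) (*-identityˡ _)))))))
    where
    small : ∀ c d → 1 ≤ d → d ≤ 2 → X ^ d * A c (1 ∸ d) ≤ X ^ 2
    small c d a b = ≤-trans (≤-reflexive (trans (cong (X ^ d *_) (trans (cong (A c) (m≤n⇒m∸n≡0 a)) (A-zero c))) (*-identityʳ _)))
      (^-monoʳ-≤ X ⦃ >-nonZero (≤-trans (s≤s z≤n) 2≤X) ⦄ b)

  spread : ∀ P Q → P ∈ G → Q ∈ H → ¬ CovOfSize t G t → ¬ CovOfSize t H t →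
           ¬ (length G * length H ≤ p * (q + q′)) → ⊥
  spread P Q P∈ Q∈ noG noH big =
    minimal (λ d → CovOfSize t H (t + d)) (2 + j) (subst (CovOfSize t H) (sym (+-suc t (suc j))) (members-cover x′ FG P P∈)) λ d₁ d₁≤ (S₁ , u₁ , l₁ , C₁) min₁ →
    minimal (λ d → CovOfSize t G (t + d)) (2 + i) (subst (CovOfSize t G) (sym (+-suc t (suc i))) (members-cover x FH Q Q∈)) λ d₂ d₂≤ (S₂ , u₂ , l₂ , C₂) min₂ →
    big (≤-trans (*-mono-≤ (GH.cover-extend d₂ d₁ S₂ l₂ u₂ C₂ d₁≤ (no-small d₁ min₁))
                           (HG.cover-extend d₁ d₂ S₁ l₁ u₁ C₁ d₂≤ (no-small d₂ min₂)))
        -- The bound for H has (t + 1)^d₁ and the bound for G has (3 + i)^d₁: regrouping across the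
        -- two families gives X^d₁, and likewise X^d₂.
        (≤-trans (≤-reflexive (lem (suc t ^ d₂) ((3 + i) ^ d₁) (A c₁ (suc j ∸ d₁)) (suc t ^ d₁) ((3 + j) ^ d₂) (A c₂ (suc i ∸ d₂))))
        (≤-trans (*-mono-≤ (*-monoˡ-≤ (A c₁ (suc j ∸ d₁)) ([mn]^≤ {suc t} {3 + i} {X} d₁ hI)) (*-monoˡ-≤ (A c₂ (suc i ∸ d₂)) ([mn]^≤ {suc t} {3 + j} {X} d₂ hJ)))
          (numeric i j i≤j g₁ g₂ d₁ d₂ (pos noH d₁ (S₁ , u₁ , l₁ , C₁)) d₁≤ (pos noG d₂ (S₂ , u₂ , l₂ , C₂)) d₂≤))))
    where
    lem : ∀ a b c d e f → a * (b * c) * (d * (e * f)) ≡ (d * b * c) * (a * e * f)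
    lem = solve-∀
    pos : ∀ {F} → ¬ CovOfSize t F t → ∀ d → CovOfSize t F (t + d) → 1 ≤ d
    pos ¬cv zero    cv = contradiction (subst (CovOfSize t _) (+-identityʳ t) cv) ¬cv
    pos ¬cv (suc d) cv = s≤s z≤n

  -- Neither t-set covers the other family, so both can be extended once; the price (3 + i)(3 + j) ≤
  -- X² is absorbed by `ratio`.
  concentrated : ∀ Y Z → Unique Y → Unique Z → length Y ≡ t → length Z ≡ t → Cov t Y G → Cov t Z H →
                 ¬ Cov t Y H → ¬ Cov t Z G → length G * length H ≤ p * (q + q′)
  concentrated Y Z uY uZ lY lZ cY cZ nY nZ = begin
    length G * length H             ≤⟨ *-mono-≤ bG bH ⟩
    ((3 + i) * p) * ((3 + j) * q′)  ≤⟨ *-mono-≤ (*-monoˡ-≤ p (le i hI)) (*-monoˡ-≤ q′ (le j hJ)) ⟩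
    (X * p) * (X * q′)              ≡⟨ lem X p q′ ⟩
    p * (X * X * q′)                ≤⟨ *-monoʳ-≤ p (Good.ratio g₂ i ≤-refl) ⟩
    p * (q + q′)                    ∎
    where
    open ≤-Reasoning
    lem : ∀ X p q → X * p * (X * q) ≡ p * (X * X * q)
    lem = solve-∀
    le : ∀ i → (2 + t′) * (3 + i) ≤ X → 3 + i ≤ X
    le i h = ≤-trans (m≤m+n (3 + i) _) h
    bG : length G ≤ (3 + i) * p
    bG = ≤-trans (count-true G (λ P P∈ → cov⇒⊑ Y lY cY P P∈)) (extend-step x GH.sizesH Y uY nY p
      (λ B u → GH.count-plus1 (B ∷ Y) u (trans (cong suc lY) (+-comm 1 t))))
    bH : length H ≤ (3 + j) * q′
    bH = ≤-trans (count-true H (λ P P∈ → cov⇒⊑ Z lZ cZ P P∈)) (extend-step x′ HG.sizesH Z uZ nZ q′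
      (λ B u → HG.count-plus1 (B ∷ Z) u (trans (cong suc lZ) (+-comm 1 t))))

-- Numeric contradictions with maximality, in units of pq.

absorb : ∀ {a b x y} → b + 1 ≤ a → a * x ≤ y + x → b * x ≤ y
absorb {a} {b} {x} {y} h g = ≤-cert 0 (+-mono-≤ (*-monoˡ-≤ x h) g) (lem a b x y)
  where lem : ∀ a b x y → y + ((b + 1) * x + a * x) ≡ b * x + (a * x + (y + x)) + 0
        lem = solve-∀

1≰0 : ¬ 1 ≤ 0
1≰0 ()

-- 3/2 against t + 15/16 ≥ 31/16.
few-covers-⊥ : ∀ t′ p p′ q N → (16 * suc t′ + 15) * (p * q) ≤ 16 * N → N ≤ q * (p + p′) → 2 * p′ ≤ p → 1 ≤ p * q → ⊥
few-covers-⊥ t′ p p′ q N h₁ h₂ h₃ h₄ = 1≰0 (≤-cert ((16 * t′ + 6) * (p * q))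
    (+-mono-≤ (+-mono-≤ h₁ (*-monoʳ-≤ 16 h₂)) (+-mono-≤ (*-monoʳ-≤ (8 * q) h₃) h₄)) (lem t′ p p′ q N))
  where lem : ∀ t′ p p′ q N → 0 + ((16 * suc t′ + 15) * (p * q) + 16 * N + (8 * q * (2 * p′) + 1))
            ≡ 1 + (16 * N + 16 * (q * (p + p′)) + (8 * q * p + p * q)) + (16 * t′ + 6) * (p * q)
        lem = solve-∀

-- (1 + 1/4)(1 + 1/8) = 45/32 against t + 15/16 ≥ 62/32.
one-bad-⊥ : ∀ t′ p q E F N → (16 * suc t′ + 15) * (p * q) ≤ 16 * N → N ≤ (p + E) * (q + F) → 4 * E ≤ p → 8 * F ≤ q → 1 ≤ p * q → ⊥
one-bad-⊥ t′ p q E F N h₁ h₂ h₃ h₄ h₅ = 1≰0 (≤-cert ((32 * t′ + 16) * (p * q))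
    (+-mono-≤ (+-mono-≤ (+-mono-≤ (*-monoʳ-≤ 2 h₁) (*-monoʳ-≤ 32 h₂)) (+-mono-≤ (*-monoʳ-≤ (8 * q) h₃) (*-monoʳ-≤ (4 * p) h₄))) (+-mono-≤ (*-mono-≤ h₃ h₄) h₅))
    (lem t′ p q E F N))
  where lem : ∀ t′ p q E F N → 0 + (2 * ((16 * suc t′ + 15) * (p * q)) + 32 * N + (8 * q * (4 * E) + 4 * p * (8 * F)) + (4 * E * (8 * F) + 1))
            ≡ 1 + (2 * (16 * N) + 32 * ((p + E) * (q + F)) + (8 * q * p + 4 * p * q) + (p * q + p * q)) + (32 * t′ + 16) * (p * q)
        lem = solve-∀

-- (I + 1/4)(1 + 1/(8(I + 1))) < I + 3/8 against I + 7/8.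
mid-⊥ : ∀ I p q E F N → (8 * I + 7) * (p * q) ≤ 8 * N → N ≤ (I * p + E) * (q + F) → 4 * E ≤ p → 8 * ((1 + I) * F) ≤ q → 1 ≤ p * q → ⊥
mid-⊥ I p q E F N h₁ h₂ h₃ h₄ h₅ = 1≰0 (≤-cert (3 * (p * q) + 6 * (p * F))
    (+-mono-≤ (+-mono-≤ h₁ (*-monoʳ-≤ 8 h₂)) (+-mono-≤ (+-mono-≤ (*-monoʳ-≤ (2 * q) h₃) (*-monoʳ-≤ (2 * F) h₃)) (+-mono-≤ (*-monoʳ-≤ p h₄) h₅)))
    (lem I p q E F N))
  where lem : ∀ I p q E F N → 0 + ((8 * I + 7) * (p * q) + 8 * N + (2 * q * (4 * E) + 2 * F * (4 * E) + (p * (8 * ((1 + I) * F)) + 1)))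
            ≡ 1 + (8 * N + 8 * ((I * p + E) * (q + F)) + (2 * q * p + 2 * F * p + (p * q + p * q))) + (3 * (p * q) + 6 * (p * F))
        lem = solve-∀

-- (I + 1)(1/2 + 1/(8(I + 1))) = I/2 + 5/8 against I + 7/8.
core-⊥ : ∀ I p q q″ F N → (8 * I + 7) * (p * q) ≤ 8 * N → N ≤ (1 + I) * p * (q″ + F) → 2 * q″ ≤ q → 8 * ((1 + I) * F) ≤ q → 1 ≤ p * q → ⊥
core-⊥ I p q q″ F N h₁ h₂ h₃ h₄ h₅ = 1≰0 (≤-cert ((4 * I + 1) * (p * q))
    (+-mono-≤ (+-mono-≤ h₁ (*-monoʳ-≤ 8 h₂)) (+-mono-≤ (*-monoʳ-≤ (4 * (1 + I) * p) h₃) (+-mono-≤ (*-monoʳ-≤ p h₄) h₅)))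
    (lem I p q q″ F N))
  where lem : ∀ I p q q″ F N → 0 + ((8 * I + 7) * (p * q) + 8 * N + (4 * (1 + I) * p * (2 * q″) + (p * (8 * ((1 + I) * F)) + 1)))
            ≡ 1 + (8 * N + 8 * ((1 + I) * p * (q″ + F)) + (4 * (1 + I) * p * q + (p * q + p * q))) + (4 * I + 1) * (p * q)
        lem = solve-∀

-- (I + 1/2)(1 + 1/(8(I + 1))) < I + 5/8 against I + 7/8.
petal-⊥ : ∀ I p q p″ F N → (8 * I + 7) * (p * q) ≤ 8 * N → N ≤ (I * p + p″) * (q + F) → 2 * p″ ≤ p → 8 * ((1 + I) * F) ≤ q → 1 ≤ p * q → ⊥
petal-⊥ I p q p″ F N h₁ h₂ h₃ h₄ h₅ = 1≰0 (≤-cert (p * q + 4 * (p * F))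
    (+-mono-≤ (+-mono-≤ h₁ (*-monoʳ-≤ 8 h₂)) (+-mono-≤ (+-mono-≤ (*-monoʳ-≤ (4 * q) h₃) (*-monoʳ-≤ (4 * F) h₃)) (+-mono-≤ (*-monoʳ-≤ p h₄) h₅)))
    (lem I p q p″ F N))
  where lem : ∀ I p q p″ F N → 0 + ((8 * I + 7) * (p * q) + 8 * N + (4 * q * (2 * p″) + 4 * F * (2 * p″) + (p * (8 * ((1 + I) * F)) + 1)))
            ≡ 1 + (8 * N + 8 * ((I * p + p″) * (q + F)) + (4 * q * p + 4 * F * p + (p * q + p * q))) + (p * q + 4 * (p * F))
        lem = solve-∀

-- 1 + t/2 against t + 15/16.
kernel-⊥ : ∀ t′ p q q″ N → (16 * suc t′ + 15) * (p * q) ≤ 16 * N → N ≤ p * (q + suc t′ * q″) → 2 * q″ ≤ q → 1 ≤ p * q → ⊥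
kernel-⊥ t′ p q q″ N h₁ h₂ h₃ h₄ = 1≰0 (≤-cert ((8 * t′ + 6) * (p * q))
    (+-mono-≤ (+-mono-≤ h₁ (*-monoʳ-≤ 16 h₂)) (+-mono-≤ (*-monoʳ-≤ (8 * suc t′ * p) h₃) h₄)) (lem t′ p q q″ N))
  where lem : ∀ t′ p q q″ N → 0 + ((16 * suc t′ + 15) * (p * q) + 16 * N + (8 * suc t′ * p * (2 * q″) + 1))
            ≡ 1 + (16 * N + 16 * (p * (q + suc t′ * q″)) + (8 * suc t′ * p * q + p * q)) + (8 * t′ + 6) * (p * q)
        lem = solve-∀

-- The shapes 𝒞/𝒟 and 𝒜/ℬ up to relabelling.

KernelShape : ℕ → Family n → Family n → Set
KernelShape {n} t G H = ∃ λ (T : List (Block n)) → Unique T × length T ≡ suc t × (∀ B → B ∈ T → size B ≡ 1) ×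
  (∀ P → P ∈ G → T ⊑ᵇ P ≡ true) × (∀ Q → Q ∈ H → t ≤ count (_∈ᵇ Q) T)

FlowerShape : ℕ → ℕ → Family n → Family n → Set
FlowerShape {n} t b G H = ∃ λ (Z : List (Block n)) → ∃ λ (L : List (Block n)) →
  Unique (Z ++ L) × length Z ≡ t × length L ≡ b × (∀ B → B ∈ Z ++ L → size B ≡ 1) ×
  (∀ P → P ∈ G → Z ⊑ᵇ P ≡ true × ∃ λ B → B ∈ L × B ∈ᵇ P ≡ true) ×
  (∀ Q → Q ∈ H → Z ⊑ᵇ Q ≡ true ⊎ (L ⊑ᵇ Q ≡ true × t ≤ suc (count (_∈ᵇ Q) Z)))

-- Deleting a block, and the price of a block that is not a singleton.

without : Block n → List (Block n) → List (Block n)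
without C T = filterᵇ (not ∘ (_==ᵛ C)) T

without-∈ : ∀ {C : Block n} {T B} → B ∈ without C T → B ∈ T × ¬ B ≡ C
without-∈ {C = C} {T} {B} h with a , b ← ∈-filterᵇ⁻ (not ∘ (_==ᵛ C)) {T} h =
  a , λ e → not⇒¬ b (≡⇒==ᵛ e)

count-without : ∀ {C : Block n} {T} (p : Block n → Bool) → Unique T → C ∈ T → count p T ≡ ⟦ p C ⟧ + count p (without C T)
count-without {C = C} {T} p u C∈ = trans (sym (count-partition p (_==ᵛ C) T)) (trans (count-++ p (filterᵇ (_==ᵛ C) T) (without C T))
  (cong (_+ count p (without C T)) (trans (count-filter p (_==ᵛ C) T) (go (p C) refl))))
  where
  go : ∀ b → p C ≡ b → count (λ B → (B ==ᵛ C) ∧ p B) T ≡ ⟦ b ⟧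
  go true e = trans (count-cong T (λ B _ → bool-ext (λ h → proj₁ (∧-true {B ==ᵛ C} h))
    (λ h → ∧-intro h (trans (cong p (==ᵛ⇒≡ B C h)) e)))) (count-≡ u C∈)
  go false e = count-none T (λ B _ → ≡false λ h → let a , b = ∧-true {B ==ᵛ C} h in
    contradiction (trans (sym b) (trans (cong p (==ᵛ⇒≡ B C a)) e)) (λ ()))

length-without : ∀ {C : Block n} {T} → Unique T → C ∈ T → length T ≡ suc (length (without C T))
length-without {C = C} {T} u C∈ = trans (sym (count-all T (λ _ _ → refl))) (trans (count-without (λ _ → true) u C∈)
  (cong suc (count-all (without C T) (λ _ _ → refl))))

usize> : ∀ (T : List (Block n)) → (∀ {B} → B ∈ T → ∃ λ i → B ∋ i) → ∀ {C} → C ∈ T → ¬ size C ≡ 1 → length T < usize T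
usize> (B ∷ T) h (here refl) ne = +-mono-≤ (≤∧≢⇒< (size-pos B _ (proj₂ (h (here refl)))) (ne ∘ sym)) (length≤usize T (h ∘ there))
usize> (B ∷ T) h (there C∈) ne = ≤-trans (≤-reflexive (sym (+-suc 1 (length T)))) (+-mono-≤ (size-pos B _ (proj₂ (h (here refl)))) (usize> T (h ∘ there) C∈ ne))

usize-Singles : ∀ (T : List (Block n)) → (∀ B → B ∈ T → size B ≡ 1) → usize T ≡ length T
usize-Singles []      h = refl
usize-Singles (B ∷ T) h = cong₂ _+_ (h B (here refl)) (usize-Singles T (λ C C∈ → h C (there C∈)))

singles? : ∀ (T : List (Block n)) → (∀ B → B ∈ T → size B ≡ 1) ⊎ ∃ λ B → B ∈ T × ¬ size B ≡ 1
singles? [] = inj₁ λ _ ()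
singles? (B ∷ T) with size B ≟ 1
... | no ne = inj₂ (B , here refl , ne)
... | yes e with singles? T
...   | inj₁ h = inj₁ λ { _ (here refl) → e ; C (there C∈) → h C C∈ }
...   | inj₂ (C , C∈ , ne) = inj₂ (C , there C∈ , ne)

⊑-inh : ∀ {k} {G : Family n} → FamilyIn k G → ∀ P → P ∈ G → ∀ {T} → T ⊑ᵇ P ≡ true → ∀ {B} → B ∈ T → ∃ λ i → B ∋ i
⊑-inh FG P P∈ h B∈ = block-inhabited P (proj₁ (All.lookup (proj₂ FG) P∈)) (all-∈ (_∈ᵇ P) h B∈)

-- A member of H without C contains the t other blocks of `T`. A member with C contains t - 1 of
-- them, chosen in at most t ways, and then the surplus point of C lowers the count to q″.
kernel-count : ∀ t′ i c (H : Family n) (FH : FamilyIn (suc (suc t′ + suc i)) H) → n ≡ c + suc (suc t′ + suc i) →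
               ∀ T → Unique T → length T ≡ suc (suc t′) → (∀ {B} → B ∈ T → ∃ λ i → B ∋ i) →
               (∀ Q → Q ∈ H → suc t′ ≤ count (_∈ᵇ Q) T) → ∀ {C} → C ∈ T → ¬ size C ≡ 1 →
               length H ≤ A c (suc i) + suc t′ * S (c + suc i) (suc (suc i))
kernel-count t′ i c H FH en T u lT inh cov {C} C∈ ne = ≤-trans (count-true H (λ _ _ → refl))
    (≤-trans (union-bound (λ _ → true) ev (true ∷ false ∷ []) val H split′ bound) (≤-reflexive (lem (A c (suc i)) (suc t′ * q″))))
  where
  open Count H FH
  q″ = S (c + suc i) (suc (suc i))
  T′ = without C T
  lT′ : length T′ ≡ suc t′
  lT′ = suc-injective (trans (sym (length-without u C∈)) lT)
  ev : Bool → Part _ → Bool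
  ev true  Q = T′ ⊑ᵇ Q
  ev false Q = (C ∈ᵇ Q) ∧ (t′ ≤ᵇ count (_∈ᵇ Q) T′)
  val : Bool → ℕ
  val true  = A c (suc i)
  val false = suc t′ * q″
  lem : ∀ a b → a + (b + 0) ≡ a + b
  lem = solve-∀
  split′ : ∀ Q → Q ∈ H → true ≡ true → ∃ λ b → b ∈ (true ∷ false ∷ []) × ev b Q ≡ true
  split′ Q Q∈ _ = go (C ∈ᵇ Q) refl
    where
    tot : ∀ {b} → C ∈ᵇ Q ≡ b → suc t′ ≤ ⟦ b ⟧ + count (_∈ᵇ Q) T′
    tot e = ≤-trans (cov Q Q∈) (≤-reflexive (trans (count-without (_∈ᵇ Q) u C∈) (cong (λ b → ⟦ b ⟧ + count (_∈ᵇ Q) T′) e)))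
    go : ∀ b → C ∈ᵇ Q ≡ b → ∃ λ b → b ∈ (true ∷ false ∷ []) × ev b Q ≡ true
    go true  e = false , there (here refl) , ∧-intro e (≤⇒≤ᵇ-true (s≤s⁻¹ (tot e)))
    go false e = true , here refl , ∈-all (_∈ᵇ Q) T′ (λ {B} B∈ → count-full (_∈ᵇ Q) T′ (≤-trans (≤-reflexive lT′) (tot e)) B B∈)
  bound : ∀ b → b ∈ (true ∷ false ∷ []) → count (ev b) H ≤ val b
  bound true  _ = count-A c T′ (suc i) (Unique-filterᵇ _ u) (trans (cong (_+ suc (suc i)) lT′) (+-suc (suc t′) (suc i))) en
  bound false _ = ≤-trans (cover-bound H T′ t′ 1 (C ∈ᵇ_) q″ (trans lT′ (+-comm 1 t′)) λ Y Y⊆ lY →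
      count-A⁻ c (C ∷ Y) (suc i) (All.tabulate (λ B∈ e → proj₂ (without-∈ {T = T} (⊆-∈ Y⊆ B∈)) (sym e)) ∷ Unique-⊆ Y⊆ (Unique-filterᵇ _ u))
        (cong suc (trans (cong (_+ suc (suc i)) lY) (+-suc t′ (suc i)))) en
        (usize> (C ∷ Y) (λ { (here refl) → inh C∈ ; (there B∈) → inh (proj₁ (without-∈ {T = T} (⊆-∈ Y⊆ B∈))) }) (here refl) ne))
    (≤-reflexive (cong (_* q″) (*-identityʳ (suc t′))))

module Core {n t′ j i c₁ c₂} (C : Crossing n t′ j i c₁ c₂) (K : Kernel C) where
  open Crossing C
  open Kernel K
  t p q q′ : ℕ
  t = suc t′
  p = A c₁ j
  q = A c₂ (suc i)
  q′ = A c₂ i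
  module GH = Pair C
  module HG = Pair (flip C)
  module CG = Count G FG
  module CH = Count H FH
  open Extension t′ Q₀ Z uZ few public

  inhZ : ∀ {B} → B ∈ Z → ∃ λ i → B ∋ i
  inhZ = ⊑-inh FG P₀ P₀∈ (cZ P₀ P₀∈)

  lW : length W ≡ 3 + i
  lW = trans length-W (trans (cong (_∸ t′) (trans (proj₂ (All.lookup (proj₂ FH) Q₀∈)) (lem t′ i))) (m+n∸n≡m (3 + i) t′))
    where lem : ∀ t i → suc (suc t + suc i) ≡ 3 + i + t
          lem = solve-∀

  uB∷Z : ∀ {B} → B ∈ W → Unique (B ∷ Z)
  uB∷Z B∈ = ∉⇒All≢ (proj₂ (W⊆ B∈)) ∷ uZ

  -- The test for a petal. Besides covering H together with `Z`, a petal must occur with `Z` in some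
  -- member of G: this excludes the dead block and shows petals to be non-empty.
  gB : Block n → Bool
  gB B = all (λ Q → t ≤ᵇ count (_∈ᵇ Q) (B ∷ Z)) H ∧ (1 ≤ᵇ count ((B ∷ Z) ⊑ᵇ_) G)

  gB-cov : ∀ B → gB B ≡ true → Cov t (B ∷ Z) H
  gB-cov B g Q Q∈ = ≤ᵇ-true (all-∈ (λ Q → t ≤ᵇ count (_∈ᵇ Q) (B ∷ Z)) (proj₁ (∧-true {all (λ Q → t ≤ᵇ count (_∈ᵇ Q) (B ∷ Z)) H} g)) Q∈)

  gB-mem : ∀ B → gB B ≡ true → ∃ λ P → P ∈ G × (B ∷ Z) ⊑ᵇ P ≡ true
  gB-mem B g = count-∃ ((B ∷ Z) ⊑ᵇ_) G (≤ᵇ-true {1} (proj₂ (∧-true {all (λ Q → t ≤ᵇ count (_∈ᵇ Q) (B ∷ Z)) H} g)))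

  missing : ∀ Q → ¬ Z ⊑ᵇ Q ≡ true → count (_∈ᵇ Q) Z ≤ t′
  missing Q h with ≤-<-connex (count (_∈ᵇ Q) Z) t′
  ... | inj₁ le = le
  ... | inj₂ gt = contradiction (∈-all (_∈ᵇ Q) Z (λ {B} B∈ → count-full (_∈ᵇ Q) Z (≤-trans (≤-reflexive lZ) gt) B B∈)) h

  -- Q has at most t - 1 blocks of `Z`, so it reaches t blocks of B ∷ Z only by containing B and
  -- exactly t - 1 blocks of `Z`.
  gB-has : ∀ B → gB B ≡ true → ∀ Q → Q ∈ H → count (_∈ᵇ Q) Z ≤ t′ → B ∈ᵇ Q ≡ true × t′ ≤ count (_∈ᵇ Q) Z
  gB-has B g Q Q∈ le with c ← gB-cov B g Q Q∈ rewrite count-∷ (_∈ᵇ Q) B Z with B ∈ᵇ Q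
  ... | true  = refl , s≤s⁻¹ c
  ... | false = contradiction c (<⇒≱ (s≤s le))

  -- Q₀ misses a block of Z; the block D of Q₀ meeting that block is in no member of G.
  dead : t′ ≤ count (_∈ᵇ Q₀) Z → ∃ λ D → D ∈ W × (∀ P → P ∈ G → ¬ D ∈ᵇ P ≡ true)
  dead ge with C , C∈ , nC ← count-∃ (not ∘ (_∈ᵇ Q₀)) Z (+-cancelˡ-≤ t′ 1 _ (≤-trans (≤-reflexive (trans (+-comm t′ 1) (trans (sym lZ) (sym (count-not (_∈ᵇ Q₀) Z)))))
                (+-monoˡ-≤ (count (not ∘ (_∈ᵇ Q₀)) Z) few)))
       with y , Cy ← inhZ C∈ = D , ⊆W ge D∈ D∉Z , λ P P∈ DP → C∉ (subst (λ B → B ∈ᵇ Q₀ ≡ true)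
             (block-unique P (proj₁ (All.lookup (proj₂ FG) P∈)) DP (all-∈ (_∈ᵇ P) (cZ P P∈) C∈) {y} Dy Cy) D∈)
    where
    isQ = proj₁ (All.lookup (proj₂ FH) Q₀∈)
    D = Vec.lookup Q₀ y
    Dy = row∋ Q₀ isQ y
    D∈ = row∈ᵇ Q₀ isQ y
    C∉ : ¬ C ∈ᵇ Q₀ ≡ true
    C∉ h = not⇒¬ nC h
    D∉Z : ¬ D ∈ Z
    D∉Z D∈Z = C∉ (subst (λ B → B ∈ᵇ Q₀ ≡ true) (block-unique P₀ (proj₁ (All.lookup (proj₂ FG) P₀∈))
      (all-∈ (_∈ᵇ P₀) (cZ P₀ P₀∈) D∈Z) (all-∈ (_∈ᵇ P₀) (cZ P₀ P₀∈) C∈) {y} Dy Cy) D∈)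

  G-hit : ∀ P → P ∈ G → ∃ λ B → B ∈ W × B ∈ᵇ P ≡ true
  G-hit P P∈ = W-hit P (x P Q₀ P∈ Q₀∈)

  countZ-H : count (Z ⊑ᵇ_) H ≤ q
  countZ-H = CH.count-cover c₂ t (suc i) 0 Z uZ refl en₂ z≤n (trans lZ (sym (+-identityʳ t)))

  count-rest : ∀ (z : Part n → Bool) w → (∀ Q → Q ∈ H → count (_∈ᵇ Q) Z ≤ t′ → z Q ≡ true × t′ ≤ count (_∈ᵇ Q) Z) →
               (∀ Y → Y ⊆ Z → length Y ≡ t′ → count (λ Q → z Q ∧ (Y ⊑ᵇ Q)) H ≤ w) → count (not ∘ (Z ⊑ᵇ_)) H ≤ t * w
  count-rest z w h bnd = ≤-trans (count-mono H (λ Q Q∈ m → let a , b = h Q Q∈ (missing Q (not⇒¬ m)) in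
      ∧-intro a (≤⇒≤ᵇ-true {t′} {count (_∈ᵇ Q) Z} b)))
    (≤-trans (cover-bound H Z t′ 1 z w (trans lZ (+-comm 1 t′)) bnd) (≤-reflexive (cong (_* w) (*-identityʳ t))))

  countH : ∀ {r} → count (not ∘ (Z ⊑ᵇ_)) H ≤ r → length H ≤ q + r
  countH h = ≤-trans (≤-reflexive (sym (count-not (Z ⊑ᵇ_) H))) (+-mono-≤ countZ-H h)

  Y∉ : ∀ {B Y} → B ∈ W → Y ⊆ Z → All (λ C → ¬ B ≡ C) Y
  Y∉ B∈ Y⊆ = All.tabulate (λ C∈ e → proj₂ (W⊆ B∈) (subst (_∈ Z) (sym e) (⊆-∈ Y⊆ C∈)))

  -- A member of H without all of `Z` contains both petals and t - 1 blocks of `Z`: t + 1 fixed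
  -- blocks, chosen in at most t ways.
  pair-rest : ∀ B C → B ∈ W → C ∈ W → ¬ B ≡ C → gB B ≡ true → gB C ≡ true → count (not ∘ (Z ⊑ᵇ_)) H ≤ t * q′
  pair-rest B C B∈ C∈ ne gb gc = count-rest (λ Q → (B ∈ᵇ Q) ∧ (C ∈ᵇ Q)) q′
    (λ Q Q∈ le → let b , ge = gB-has B gb Q Q∈ le in ∧-intro b (proj₁ (gB-has C gc Q Q∈ le)) , ge)
    (λ Y Y⊆ lY → ≤-trans (count-mono H (λ Q _ h → let bc , y = ∧-true {(B ∈ᵇ Q) ∧ (C ∈ᵇ Q)} h ; b , c = ∧-true {B ∈ᵇ Q} bc in ∧-intro b (∧-intro c y)))
      (HG.count-plus1 (B ∷ C ∷ Y) ((ne ∷ Y∉ B∈ Y⊆) ∷ Y∉ C∈ Y⊆ ∷ Unique-⊆ Y⊆ uZ) (trans (cong (2 +_) lY) (+-comm 1 t))))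

  -- Members of H missing part of Z must meet P outside Z as well.
  other-rest : ∀ B P → B ∈ W → gB B ≡ true → P ∈ G → ¬ B ∈ᵇ P ≡ true → count (not ∘ (Z ⊑ᵇ_)) H ≤ (2 + j) * (t * q′)
  other-rest B P B∈ gb P∈ B∉P = ≤-trans (union-bound (not ∘ (Z ⊑ᵇ_)) (λ C Q → ((B ∈ᵇ Q) ∧ (C ∈ᵇ Q)) ∧ (t′ ≤ᵇ count (_∈ᵇ Q) Z)) L (λ _ → t * q′) H cov bnd)
      (≤-reflexive (trans (∑-const L (t * q′)) (cong (_* (t * q′)) lL)))
    where
    isP = All.lookup (proj₂ FG) P∈
    memZ : Block n → Bool
    memZ C = memᵇ C Z
    L = filterᵇ (not ∘ memZ) (blocks P)
    L∈ : ∀ {C} → C ∈ L → C ∈ᵇ P ≡ true × ¬ C ∈ Z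
    L∈ {C} h with a , b ← ∈-filterᵇ⁻ (not ∘ memZ) {blocks P} h = ∈-blocks⁻ P a , λ C∈ → not⇒¬ b (∈⇒memᵇ C C∈)
    lL : length L ≡ 2 + j
    lL = +-cancelˡ-≡ t _ _ (trans (cong (_+ length L) (trans (sym lZ) (sym (count-mem P uZ (cZ P P∈)))))
      (trans (count-not memZ (blocks P)) (trans (proj₂ isP) (lem t j))))
      where lem : ∀ t j → suc (t + suc j) ≡ t + (2 + j)
            lem = solve-∀
    cov : ∀ Q → Q ∈ H → not (Z ⊑ᵇ Q) ≡ true → ∃ λ C → C ∈ L × ((B ∈ᵇ Q) ∧ (C ∈ᵇ Q)) ∧ (t′ ≤ᵇ count (_∈ᵇ Q) Z) ≡ true
    cov Q Q∈ m = proj₁ hit , proj₁ (proj₂ hit) , ∧-intro (∧-intro (proj₁ has) (proj₂ (proj₂ hit))) (≤⇒≤ᵇ-true (proj₂ has))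
      where
      le = missing Q (not⇒¬ m)
      has = gB-has B gb Q Q∈ le
      inner : count (_∈ᵇ Q) (filterᵇ memZ (blocks P)) ≤ count (_∈ᵇ Q) Z
      inner = Unique-⊆⇒length≤ {ys = filterᵇ (_∈ᵇ Q) Z} (Unique-filterᵇ (_∈ᵇ Q) (Unique-filterᵇ memZ (Unique-blocks P)))
        (λ D D∈ → let a , b = ∈-filterᵇ⁻ (_∈ᵇ Q) {filterᵇ memZ (blocks P)} D∈ in
          ∈-filterᵇ⁺ (_∈ᵇ Q) (memᵇ⇒∈ D Z (proj₂ (∈-filterᵇ⁻ memZ {blocks P} a))) b)
      hit = count-∃ (_∈ᵇ Q) L (+-cancelˡ-≤ t′ 1 _ (≤-trans (≤-reflexive (+-comm t′ 1)) (≤-trans (x′ Q P Q∈ P∈)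
        (≤-trans (≤-reflexive (sym (trans (sym (count-++ (_∈ᵇ Q) (filterᵇ memZ (blocks P)) L)) (count-partition (_∈ᵇ Q) memZ (blocks P)))))
          (+-monoˡ-≤ (count (_∈ᵇ Q) L) (≤-trans inner le))))))
    bnd : ∀ C → C ∈ L → count (λ Q → ((B ∈ᵇ Q) ∧ (C ∈ᵇ Q)) ∧ (t′ ≤ᵇ count (_∈ᵇ Q) Z)) H ≤ t * q′
    bnd C C∈ = ≤-trans (cover-bound H Z t′ 1 (λ Q → (B ∈ᵇ Q) ∧ (C ∈ᵇ Q)) q′ (trans lZ (+-comm 1 t′)) λ Y Y⊆ lY →
        ≤-trans (count-mono H (λ Q _ h → let bc , y = ∧-true {(B ∈ᵇ Q) ∧ (C ∈ᵇ Q)} h ; b , c = ∧-true {B ∈ᵇ Q} bc in ∧-intro b (∧-intro c y)))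
          (HG.count-plus1 (B ∷ C ∷ Y) (((λ e → B∉P (subst (λ D → D ∈ᵇ P ≡ true) (sym e) (proj₁ (L∈ C∈)))) ∷ Y∉ B∈ Y⊆)
            ∷ All.tabulate (λ D∈ e → proj₂ (L∈ C∈) (subst (_∈ Z) (sym e) (⊆-∈ Y⊆ D∈))) ∷ Unique-⊆ Y⊆ uZ) (trans (cong (2 +_) lY) (+-comm 1 t))))
      (≤-reflexive (cong (_* q′) (*-identityʳ t)))

module Large {n t′ m i c₁ c₂} (C : Crossing n t′ (suc m) i c₁ c₂) (bounds : Bounds C) (kernel : Kernel C)
    (noH : ¬ CovOfSize (suc t′) (Crossing.H C) (suc t′))
    (opt𝒟 : (16 * suc t′ + 15) * (A c₁ (suc m) * A c₂ (suc i)) ≤ 16 * (length (Crossing.G C) * length (Crossing.H C)))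
    (opt𝒜 : (8 * suc i + 7) * (A c₁ (suc m) * A c₂ (suc i)) ≤ 8 * (length (Crossing.G C) * length (Crossing.H C))) where
  open Crossing C
  open Bounds bounds
  open Kernel kernel
  open Core C kernel
  private
    p′ p″ q″ I N : ℕ
    p′ = A c₁ m
    p″ = S (c₁ + suc m) (2 + m)
    q″ = S (c₂ + suc i) (2 + i)
    I = suc i
    N = length G * length H

  8≤X : 8 ≤ X
  8≤X = ≤-trans (*-mono-≤ {2} {2 + t′} {4} {4 + m} (m≤m+n 2 t′) (m≤m+n 4 m)) hJ

  1≤pq : 1 ≤ p * q
  1≤pq = *-mono-≤ (A-pos c₁ (suc m)) (A-pos c₂ (suc i))

  ratio-p : X * X * p′ ≤ p + p′
  ratio-p = Good.ratio g₁ m (n≤1+n _)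

  ratio-q : X * X * q′ ≤ q + q′
  ratio-q = Good.ratio g₂ i ≤-refl

  2p″≤p : 2 * p″ ≤ p
  2p″≤p = ≤-trans (*-monoˡ-≤ p″ (m≤m+n 2 m)) (m≤m+n _ _)

  2q″≤q : 2 * q″ ≤ q
  2q″≤q = ≤-trans (*-monoˡ-≤ q″ (m≤m+n 2 i)) (m≤m+n _ _)

  p″≤p : p″ ≤ p
  p″≤p = ≤-trans (m≤m+n p″ _) 2p″≤p

  2p′≤p : 2 * p′ ≤ p
  2p′≤p = absorb {X * X} {2} (≤-trans (m≤m+n 3 61) (*-mono-≤ 8≤X 8≤X)) ratio-p

  -- The total contribution of 2 + i blocks that are not petals is at most p/4, because 4(2 + i)(3 +
  -- i) + 1 ≤ (2(3 + i))² ≤ X².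
  pEp : 4 * ((2 + i) * (3 + i) * p′) ≤ p
  pEp = ≤-trans (≤-reflexive (lem i p′)) (absorb {X * X} (≤-trans (≤-cert (11 + 4 * i) (z≤n {0}) (lem2 i)) (*-mono-≤ h h)) ratio-p)
    where
    h : 2 * (3 + i) ≤ X
    h = ≤-trans (*-monoˡ-≤ (3 + i) (m≤m+n 2 t′)) hI
    lem : ∀ i p → 4 * ((2 + i) * (3 + i) * p) ≡ 4 * ((2 + i) * (3 + i)) * p
    lem = solve-∀
    lem2 : ∀ i → 2 * (3 + i) * (2 * (3 + i)) + 0 ≡ 4 * ((2 + i) * (3 + i)) + 1 + 0 + (11 + 4 * i)
    lem2 = solve-∀

  qF : ∀ b → (2 + t′) * (1 + b) ≤ X → 8 * (b * (t * q′)) ≤ q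
  qF b h = ≤-trans (≤-reflexive (lem b t q′)) (absorb {X * X} {8 * (b * t)} (≤-trans (≤-cert (8 * t′ + 8 * b + 15) (z≤n {0}) (lem2 b t′)) (*-mono-≤ 8≤X h)) ratio-q)
    where
    lem : ∀ b t q → 8 * (b * (t * q)) ≡ 8 * (b * t) * q
    lem = solve-∀
    lem2 : ∀ b t′ → 8 * ((2 + t′) * (1 + b)) + 0 ≡ 8 * (b * suc t′) + 1 + 0 + (8 * t′ + 8 * b + 15)
    lem2 = solve-∀

  weight : Bool → ℕ
  weight true  = p
  weight false = (3 + i) * p′

  -- Without being a petal, B either fails to cover H together with `Z`, which allows one more
  -- extension step, or occurs with `Z` in no member of G.
  petal-bound : ∀ B → B ∈ W → count ((B ∷ Z) ⊑ᵇ_) G ≤ weight (gB B)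
  petal-bound B B∈ with cov? t (B ∷ Z) H
  ... | inj₂ (Q , Q∈ , lt) = ≤-trans (extend-step x GH.sizesH (B ∷ Z) (uB∷Z B∈) (λ c → <⇒≱ lt (c Q Q∈)) p′
          (λ C u → CG.count-cover c₁ t (2 + m) 2 (C ∷ B ∷ Z) u refl en₁ (m≤m+n 2 (suc m)) (trans (cong (2 +_) lZ) (+-comm 2 t))))
        (≤-reflexive (cong weight (sym (≡false λ g → <⇒≱ lt (gB-cov B g Q Q∈)))))
  ... | inj₁ c = go (gB B) refl
    where
    go : ∀ b → gB B ≡ b → count ((B ∷ Z) ⊑ᵇ_) G ≤ weight b
    go true  _ = GH.count-plus1 (B ∷ Z) (uB∷Z B∈) (trans (cong suc lZ) (+-comm 1 t))
    go false e with ≤-<-connex (count ((B ∷ Z) ⊑ᵇ_) G) 0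
    ... | inj₁ z = ≤-trans z z≤n
    ... | inj₂ pos = contradiction (trans (sym (∧-intro (∈-all _ H (λ {Q} Q∈ → ≤⇒≤ᵇ-true (c Q Q∈))) (≤⇒≤ᵇ-true pos))) e) (λ ())

  ∑-weight : ∀ L → ∑ L (weight ∘ gB) ≡ count gB L * p + count (not ∘ gB) L * ((3 + i) * p′)
  ∑-weight [] = refl
  ∑-weight (B ∷ L) rewrite count-∷ gB B L | count-∷ (not ∘ gB) B L | ∑-weight L with gB B
  ... | true  = sym (+-assoc p _ _)
  ... | false = lem ((3 + i) * p′) (count gB L * p) _
    where lem : ∀ a b c → a + (b + c) ≡ b + (a + c)
          lem = solve-∀

  b b̄ : ℕ
  b = count gB W
  b̄ = count (not ∘ gB) W

  b+b̄ : b + b̄ ≡ 3 + i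
  b+b̄ = trans (count-not gB W) lW

  countG : length G ≤ b * p + b̄ * ((3 + i) * p′)
  countG = ≤-trans (count-true G (λ P P∈ → cZ P P∈)) (≤-trans (union-bound (Z ⊑ᵇ_) (λ B P → (B ∷ Z) ⊑ᵇ P) W (weight ∘ gB) G
      (λ P P∈ h → let B , B∈ , e = G-hit P P∈ in B , B∈ , ∧-intro e h) petal-bound) (≤-reflexive (∑-weight W)))

  case-none : b ≡ 0 → ⊥
  case-none b≡0 = minimal (λ d → CovOfSize t H (t + d)) (3 + m) (subst (CovOfSize t H) (sym (+-suc t (2 + m))) (members-cover x′ FG P₀ P₀∈)) go
    where
    fin : N ≤ q * (p + p′) → ⊥
    fin h = few-covers-⊥ t′ p p′ q N opt𝒟 h 2p′≤p 1≤pq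
    hH : ∀ d → CovOfSize t H (t + d) → length H ≤ suc t ^ d * q
    hH d (Sc , u , l , c) = ≤-trans (HG.cover-extend d 0 Sc l u c z≤n (λ T u ge lt → contradiction ge (<⇒≱ (≤-trans lt (≤-reflexive (+-identityʳ t))))))
      (≤-reflexive (cong (suc t ^ d *_) (+-identityʳ q)))
    G≤ : length G ≤ (3 + i) * ((3 + i) * p′)
    G≤ = ≤-trans countG (≤-reflexive (trans (cong (λ z → z * p + b̄ * ((3 + i) * p′)) b≡0) (cong (_* ((3 + i) * p′)) (trans (cong (_+ b̄) (sym b≡0)) b+b̄))))
    go : ∀ d → d ≤ 3 + m → CovOfSize t H (t + d) → (∀ e → e < d → ¬ CovOfSize t H (t + e)) → ⊥
    go zero d≤ cv _ = noH (subst (CovOfSize t H) (+-identityʳ t) cv)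
    -- A cover of H by t + 1 blocks need not contain `Z`, hence gives no petal. The estimate for G
    -- comes from the absence of petals, and a spare factor t + 1 completes X².
    go (suc zero) d≤ cv _ = fin (begin
      N                                                  ≤⟨ *-mono-≤ G≤ (hH 1 cv) ⟩
      (3 + i) * ((3 + i) * p′) * (suc t * 1 * q)         ≤⟨ m≤m*n _ (suc t) ⟩
      (3 + i) * ((3 + i) * p′) * (suc t * 1 * q) * suc t ≡⟨ lem i p′ t q ⟩
      q * ((suc t * (3 + i)) * (suc t * (3 + i)) * p′)   ≤⟨ *-monoʳ-≤ q (≤-trans (*-monoˡ-≤ p′ (*-mono-≤ hI hI)) ratio-p) ⟩
      q * (p + p′)                                       ∎)
      where open ≤-Reasoning
            lem : ∀ i p t q → (3 + i) * ((3 + i) * p) * (suc t * 1 * q) * suc t ≡ q * ((suc t * (3 + i)) * (suc t * (3 + i)) * p)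
            lem = solve-∀
    go d@(suc (suc _)) d≤ cv min = fin (begin
      N                                                               ≤⟨ *-mono-≤ (GH.cover-extend 0 d Z (trans lZ (sym (+-identityʳ t))) uZ (⊑⇒cov Z lZ cZ) d≤ (no-small d min)) (hH d cv) ⟩
      1 * ((3 + i) ^ d * A c₁ (2 + m ∸ d)) * (suc t ^ d * q)          ≡⟨ lem ((3 + i) ^ d) (A c₁ (2 + m ∸ d)) (suc t ^ d) q ⟩
      q * (suc t ^ d * (3 + i) ^ d * A c₁ (2 + m ∸ d))                ≤⟨ *-monoʳ-≤ q (*-monoˡ-≤ (A c₁ (2 + m ∸ d)) ([mn]^≤ {suc t} {3 + i} d hI)) ⟩
      q * (X ^ d * A c₁ (2 + m ∸ d))                                  ≤⟨ *-monoʳ-≤ q (cover₂ g₁ 2≤X d (s≤s (s≤s z≤n)) d≤) ⟩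
      q * (p + p′)                                                    ∎)
      where open ≤-Reasoning
            lem : ∀ a b c q → 1 * (a * b) * (c * q) ≡ q * (c * a * b)
            lem = solve-∀

  -- If a member of G avoids the only petal, `other-rest` keeps |H| within 9q/8 and the product is
  -- too small. So the petal lies in every member, and K = B ∷ Z is the kernel.
  case-one : ∀ B → B ∈ W → gB B ≡ true → b ≡ 1 → KernelShape t G H
  case-one B B∈ gb b≡1 = go (cov? 1 (B ∷ []) G)
    where
    K = B ∷ Z
    go : Cov 1 (B ∷ []) G ⊎ (∃ λ P → P ∈ G × count (_∈ᵇ P) (B ∷ []) < 1) → KernelShape t G H
    go (inj₂ (P , P∈ , lt)) = ⊥-elim (one-bad-⊥ t′ p q ((2 + i) * (3 + i) * p′) ((3 + m) * (t * q′)) N opt𝒟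
      (*-mono-≤ (≤-trans countG (≤-reflexive (trans (cong (λ z → z * p + b̄ * ((3 + i) * p′)) b≡1)
          (cong₂ _+_ (+-identityʳ p) (trans (cong (_* ((3 + i) * p′)) (suc-injective (trans (cong (_+ b̄) (sym b≡1)) b+b̄))) (sym (*-assoc (2 + i) (3 + i) p′)))))))
        (countH (other-rest B P B∈ gb P∈ (λ h → <⇒≱ lt (count-pos (_∈ᵇ P) {B ∷ []} (here refl) h)))))
      pEp (qF (3 + m) hJ) 1≤pq)
    go (inj₁ c) = conclude (singles? K)
      where
      cT : ∀ P → P ∈ G → K ⊑ᵇ P ≡ true
      cT P P∈ = ∧-intro (all-∈ (_∈ᵇ P) {B ∷ []} (cov⇒⊑ (B ∷ []) refl c P P∈) (here refl)) (cZ P P∈)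
      conclude : _ → KernelShape t G H
      conclude (inj₁ s) = K , uB∷Z B∈ , cong suc lZ , s , cT , gB-cov B gb
      conclude (inj₂ (C , C∈ , ne)) = ⊥-elim (kernel-⊥ t′ p q q″ N opt𝒟
        (*-mono-≤ (≤-trans (count-true G cT) (GH.count-plus1 K (uB∷Z B∈) (trans (cong suc lZ) (+-comm 1 t))))
          (kernel-count t′ i c₂ H FH en₂ K (uB∷Z B∈) (cong suc lZ) (⊑-inh FG P₀ P₀∈ {K} (cT P₀ P₀∈)) (gB-cov B gb) C∈ ne))
        2q″≤q 1≤pq)

  rest≤ : 8 * ((1 + I) * (t * q′)) ≤ q
  rest≤ = qF (2 + i) hI

  -- The dead block D is not a petal, so there are at most 2 + i petals among the 3 + i blocks of
  -- `W`. One petal fewer already loses about pq.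
  case-many : ∀ B C → B ∈ W → C ∈ W → ¬ B ≡ C → gB B ≡ true → gB C ≡ true → 2 ≤ b →
              ∀ D → D ∈ W → (∀ P → P ∈ G → ¬ D ∈ᵇ P ≡ true) → FlowerShape t (suc I) G H
  case-many B C B∈ C∈ B≢C gb gc 2≤b D D∈ D∉ = go (m≤n⇒m<n∨m≡n b≤)
    where
    rest′ : count (not ∘ (Z ⊑ᵇ_)) H ≤ t * q′
    rest′ = pair-rest B C B∈ C∈ B≢C gb gc
    H≤ : length H ≤ q + t * q′
    H≤ = countH rest′
    gD : gB D ≡ false
    gD = ≡false λ g → let P , P∈ , h = gB-mem D g in D∉ P P∈ (proj₁ (∧-true {D ∈ᵇ P} h))
    1≤b̄ : 1 ≤ b̄
    1≤b̄ = count-pos (not ∘ gB) D∈ (cong not gD)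
    b≤ : b ≤ 2 + i
    b≤ = +-cancelʳ-≤ 1 b (2 + i) (≤-trans (+-monoʳ-≤ b 1≤b̄) (≤-reflexive (trans b+b̄ (+-comm 1 (2 + i)))))
    go : b < 2 + i ⊎ b ≡ 2 + i → FlowerShape t (suc I) G H
    -- At least two blocks are petals, so at most I = 1 + i are not.
    go (inj₁ (s≤s b≤I)) = ⊥-elim (mid-⊥ I p q (I * ((3 + i) * p′)) (t * q′) N opt𝒜
      (*-mono-≤ (≤-trans countG (+-mono-≤ (*-monoˡ-≤ p b≤I) (*-monoˡ-≤ ((3 + i) * p′) b̄≤))) H≤)
      (≤-trans (*-monoʳ-≤ 4 (≤-trans (*-monoˡ-≤ ((3 + i) * p′) (n≤1+n I)) (≤-reflexive (sym (*-assoc (2 + i) (3 + i) p′))))) pEp) rest≤ 1≤pq)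
      where b̄≤ : b̄ ≤ I
            b̄≤ = +-cancelˡ-≤ 2 b̄ I (≤-trans (+-monoˡ-≤ b̄ 2≤b) (≤-reflexive b+b̄))
    go (inj₂ b≡) = conclude (singles? (Z ++ L))
      where
      L = filterᵇ gB W
      uL : Unique L
      uL = Unique-filterᵇ gB Unique-W
      L⁻ : ∀ {B} → B ∈ L → B ∈ W × gB B ≡ true
      L⁻ = ∈-filterᵇ⁻ gB {W}
      uZL : Unique (Z ++ L)
      uZL = Uniqueₚ.++⁺ uZ uL (λ (a , l) → proj₂ (W⊆ (proj₁ (L⁻ l))) a)
      inhL : ∀ {B} → B ∈ L → ∃ λ i → B ∋ i
      inhL {B} B∈ = let P , P∈ , h = gB-mem B (proj₂ (L⁻ B∈)) in ⊑-inh FG P P∈ {B ∷ Z} h (here refl)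
      -- With 2 + i petals, `D` is the only other block of `W`; no member of G contains it, so each
      -- member contains a petal.
      only : ∀ {B} → B ∈ W → gB B ≡ false → ¬ B ≡ D → ⊥
      only {B} B∈ g ne = <⇒≱ (≤-reflexive (cong suc b̄≡1)) (Unique-⊆⇒length≤ {xs = B ∷ D ∷ []} {filterᵇ (not ∘ gB) W} ((ne ∷ []) ∷ [] ∷ [])
        λ { _ (here refl) → ∈-filterᵇ⁺ (not ∘ gB) B∈ (cong not g) ; _ (there (here refl)) → ∈-filterᵇ⁺ (not ∘ gB) D∈ (cong not gD) })
        where b̄≡1 : b̄ ≡ 1
              b̄≡1 = +-cancelˡ-≡ (2 + i) _ _ (trans (cong (_+ b̄) (sym b≡)) (trans b+b̄ (+-comm 1 (2 + i))))
      hit : ∀ P → P ∈ G → ∃ λ B → B ∈ L × B ∈ᵇ P ≡ true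
      hit P P∈ with B , B∈ , e ← G-hit P P∈ = B , ∈-filterᵇ⁺ gB B∈ (good′ (gB B) refl) , e
        where good′ : ∀ b → gB B ≡ b → b ≡ true
              good′ true _ = refl
              good′ false g = ⊥-elim (only B∈ g λ { refl → D∉ P P∈ e })
      countL : ∀ (w : Block n → ℕ) → (∀ B → B ∈ L → count ((B ∷ Z) ⊑ᵇ_) G ≤ w B) → length G ≤ ∑ L w
      countL w h = ≤-trans (count-true G (λ P P∈ → cZ P P∈)) (union-bound (Z ⊑ᵇ_) (λ B P → (B ∷ Z) ⊑ᵇ P) L w G
        (λ P P∈ z → let B , B∈ , e = hit P P∈ in B , B∈ , ∧-intro e z) h)
      L≤p : ∀ B → B ∈ L → count ((B ∷ Z) ⊑ᵇ_) G ≤ p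
      L≤p B B∈ = GH.count-plus1 (B ∷ Z) (uB∷Z (proj₁ (L⁻ B∈))) (trans (cong suc lZ) (+-comm 1 t))
      inZ : ∀ {C} → C ∈ Z → ¬ size C ≡ 1 → ⊥
      inZ C∈ ne = core-⊥ I p q q″ (t * q′) N opt𝒜
        (*-mono-≤ (≤-trans (countL (λ _ → p) L≤p) (≤-reflexive (trans (∑-const L p) (cong (_* p) b≡))))
          (≤-trans (≤-reflexive (sym (count-not (Z ⊑ᵇ_) H))) (+-mono-≤ (CH.count-A⁻ c₂ Z (suc i) uZ (trans (cong (_+ suc (suc i)) lZ) (+-suc t (suc i))) en₂
            (usize> Z inhZ C∈ ne)) rest′))) 2q″≤q rest≤ 1≤pq
      inL : ∀ {C} → C ∈ L → ¬ size C ≡ 1 → ⊥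
      inL {C₁} C₁∈ ne = petal-⊥ I p q p″ (t * q′) N opt𝒜 (*-mono-≤ G≤ H≤) 2p″≤p rest≤ 1≤pq
        where
        single? : Block n → Bool
        single? B = size B ≡ᵇ 1
        w : Bool → ℕ
        w true = p
        w false = p″
        wb : ∀ B → B ∈ L → count ((B ∷ Z) ⊑ᵇ_) G ≤ w (single? B)
        wb B B∈ = go′ (single? B) refl
          where
          go′ : ∀ b → single? B ≡ b → count ((B ∷ Z) ⊑ᵇ_) G ≤ w b
          go′ true _ = L≤p B B∈
          go′ false e = CG.count-A⁻ c₁ (B ∷ Z) (suc m) (uB∷Z (proj₁ (L⁻ B∈))) (cong (λ l → suc l + suc (suc m)) lZ) en₁
            (usize> (B ∷ Z) (λ { (here refl) → inhL B∈ ; (there h) → inhZ h }) (here refl) (λ s → contradiction (trans (sym e) (cong (_≡ᵇ 1) s)) (λ ())))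
        -- The summand p on the left stands for the replacement of one p by p″ without subtraction.
        ∑w : ∀ M {C} → C ∈ M → ¬ size C ≡ 1 → p + ∑ M (w ∘ single?) ≤ length M * p + p″
        ∑w (B ∷ M) (here refl) ne with single? B in e
        ... | true = contradiction (≡ᵇ-true {size B} e) ne
        ... | false = ≤-trans (≤-reflexive (lem p p″ (∑ M (w ∘ single?)))) (+-monoˡ-≤ p″ (+-monoʳ-≤ p (≤-trans (∑-mono M (λ B _ → w≤ (single? B))) (≤-reflexive (∑-const M p)))))
          where lem : ∀ a b c → a + (b + c) ≡ a + c + b
                lem = solve-∀
                w≤ : ∀ b → w b ≤ p
                w≤ true = ≤-refl
                w≤ false = p″≤p
        ∑w (B ∷ M) (there C∈) ne = ≤-trans (≤-reflexive (lem p (w (single? B)) (∑ M (w ∘ single?)))) (≤-trans (+-mono-≤ (w≤ (single? B)) (∑w M C∈ ne)) (≤-reflexive (sym (+-assoc p (length M * p) p″))))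
          where lem : ∀ a b c → a + (b + c) ≡ b + (a + c)
                lem = solve-∀
                w≤ : ∀ b → w b ≤ p
                w≤ true = ≤-refl
                w≤ false = p″≤p
        G≤ : length G ≤ I * p + p″
        G≤ = ≤-trans (countL (w ∘ single?) wb) (+-cancelˡ-≤ p _ _ (≤-trans (∑w L C₁∈ ne) (≤-reflexive (trans (cong (λ l → l * p + p″) b≡) (+-assoc p (I * p) p″)))))
      conclude : _ → FlowerShape t (suc I) G H
      conclude (inj₂ (C , C∈ , ne)) with ∈-++⁻ Z C∈
      ... | inj₁ h = ⊥-elim (inZ h ne)
      ... | inj₂ h = ⊥-elim (inL h ne)
      conclude (inj₁ s) = Z , L , uZL , lZ , b≡ , s , (λ P P∈ → cZ P P∈ , hit P P∈) , λ Q Q∈ → q⁻ Q Q∈ (Z ⊑ᵇ Q) refl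
        where
        q⁻ : ∀ Q → Q ∈ H → ∀ b → Z ⊑ᵇ Q ≡ b → Z ⊑ᵇ Q ≡ true ⊎ (L ⊑ᵇ Q ≡ true × t ≤ suc (count (_∈ᵇ Q) Z))
        q⁻ Q Q∈ true e = inj₁ e
        q⁻ Q Q∈ false e = inj₂ (∈-all (_∈ᵇ Q) L (λ {B} B∈ → proj₁ (gB-has B (proj₂ (L⁻ B∈)) Q Q∈ le)) , s≤s (proj₂ (gB-has B gb Q Q∈ le)))
          where le = missing Q (λ h → contradiction (trans (sym h) e) (λ ()))

  shape : KernelShape t G H ⊎ FlowerShape t (suc I) G H
  shape with filterᵇ gB W in eq
  ... | [] = ⊥-elim (case-none (cong length eq))
  ... | B ∷ [] with B∈ , gb ← ∈-filterᵇ⁻ gB {W} (subst (B ∈_) (sym eq) (here refl)) = inj₁ (case-one B B∈ gb (cong length eq))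
  ... | B ∷ C ∷ R with B∈ , gb ← ∈-filterᵇ⁻ gB {W} (subst (B ∈_) (sym eq) (here refl))
                     | C∈ , gc ← ∈-filterᵇ⁻ gB {W} (subst (C ∈_) (sym eq) (there (here refl)))
                     | (ne ∷ _) ∷ _ ← subst Unique eq (Unique-filterᵇ gB Unique-W) =
    let D , D∈ , D∉ = dead (proj₂ (gB-has B gb Q₀ Q₀∈ few)) in
    inj₂ (case-many B C B∈ C∈ ne gb gc (≤-trans (s≤s (s≤s z≤n)) (≤-reflexive (cong length (sym eq)))) D D∈ D∉)

-- Pairs of families of (t + 2)-partitions.

2S₂≤ : ∀ r → 2 * S r 2 ≤ 2 ^ r
2S₂≤ zero    = z≤n
2S₂≤ (suc r) = ≤-trans (m≤m+n _ 2) (go r)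
  where
  go : ∀ r → 2 * S (suc r) 2 + 2 ≤ 2 ^ suc r
  go zero    = ≤-refl
  go (suc r) rewrite S-one r = ≤-trans (≤-reflexive (lem (S (suc r) 2))) (*-monoʳ-≤ 2 (go r))
    where lem : ∀ a → 2 * (2 * a + 1) + 2 ≡ 2 * (2 * a + 2)
          lem = solve-∀

usize-blocks : ∀ (P : Part n) → IsPartition P → usize (blocks P) ≡ n
usize-blocks {n} P isP with n ∸ usize (blocks P) in e | cnt-exact n (#blocks P) (blocks P) (n ∸ usize (blocks P)) 0 w
    (m+[n∸m]≡n le) (+-identityʳ _)
  where
  ⊑P : blocks P ⊑ᵇ P ≡ true
  ⊑P = ∈-all (_∈ᵇ P) (blocks P) (∈-blocks⁻ P)
  w = ⊑-WF P isP (Unique-blocks P) ⊑P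
  le = usize≤ n (blocks P) w
... | zero  | _ = ≤-antisym le (m∸n≡0⇒m≤n e)
  where
  w = ⊑-WF P isP (Unique-blocks P) (∈-all (_∈ᵇ P) (blocks P) (∈-blocks⁻ P))
  le = usize≤ n (blocks P) w
... | suc r | c = ⊥-elim (1≰0 (≤-trans (count-pos (λ Q → (#blocks Q ≡ᵇ #blocks P) ∧ (blocks P ⊑ᵇ Q)) (enum-complete n P isP)
    (∧-intro (≡ᵇ-refl (#blocks P)) (∈-all (_∈ᵇ P) (blocks P) (∈-blocks⁻ P))))
    (≤-reflexive (trans (count-∑ _ (enum n)) c))))

largest : ∀ (T : List (Block n)) → 1 ≤ length T → ∃ λ R → R ∈ T × (∀ B → B ∈ T → size B ≤ size R)
largest (B ∷ [])        _ = B , here refl , λ { _ (here refl) → ≤-refl }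
largest (B ∷ T@(_ ∷ _)) _ with R , R∈ , h ← largest T (s≤s z≤n) with ≤-total (size B) (size R)
... | inj₁ le = R , there R∈ , λ { _ (here refl) → le ; C (there C∈) → h C C∈ }
... | inj₂ ge = B , here refl , λ { _ (here refl) → ≤-refl ; C (there C∈) → ≤-trans (h C C∈) ge }

usize-⊆ : ∀ {Y T : List (Block n)} h → (∀ B → B ∈ T → size B ≤ h) → Y ⊆ T → ∀ d → length T ≡ length Y + d →
          usize Y ≤ usize T × usize T ≤ usize Y + d * h
usize-⊆ h b [] d e = z≤n , z≤n
usize-⊆ {Y = Y} h b (B ∷ʳ s) zero e = contradiction (≤-trans (≤-reflexive e) (≤-trans (≤-reflexive (+-identityʳ _)) (⊆-length s))) (<⇒≱ ≤-refl)
  where ⊆-length : ∀ {X : Set} {xs ys : List X} → xs ⊆ ys → length xs ≤ length ys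
        ⊆-length []         = z≤n
        ⊆-length (_ ∷ʳ s)   = m≤n⇒m≤1+n (⊆-length s)
        ⊆-length (refl ∷ s) = s≤s (⊆-length s)
usize-⊆ {Y = Y} h b (B ∷ʳ s) (suc d) e with l , u ← usize-⊆ h (λ C C∈ → b C (there C∈)) s d (suc-injective (trans e (+-suc _ d))) =
  ≤-trans l (m≤n+m _ (size B)) , ≤-trans (+-mono-≤ (b B (here refl)) u) (≤-reflexive (lem h (usize Y) (d * h)))
  where lem : ∀ a b c → a + (b + c) ≡ b + (a + c)
        lem = solve-∀
usize-⊆ h b (_∷_ {x = B} refl s) d e with l , u ← usize-⊆ h (λ C C∈ → b C (there C∈)) s d (suc-injective e) =
  +-monoʳ-≤ (size B) l , ≤-trans (+-monoʳ-≤ (size B) u) (≤-reflexive (sym (+-assoc (size B) _ _)))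

two-members : ∀ {k} {p : Part n → Bool} {G : Family n} {P P′} → FamilyIn k G → P ∈ G → P′ ∈ G → ¬ P ≡ P′ → p P ≡ true → p P′ ≡ true → 2 ≤ count p G
two-members {p = p} {G} {P} {P′} FG P∈ P′∈ ne h h′ = Unique-⊆⇒length≤ {xs = P ∷ P′ ∷ []} {filterᵇ p G} ((ne ∷ []) ∷ [] ∷ [])
  λ { _ (here refl) → ∈-filterᵇ⁺ p P∈ h ; _ (there (here refl)) → ∈-filterᵇ⁺ p P′∈ h′ }

-- The case k = ℓ = t + 2, where t + 1 blocks determine a partition.
module Tight {n t″ c} (C : Crossing n (suc t″) 0 0 c c) (X : ℕ) (g : Good X c 1) (hX : (3 + t″) * 3 ≤ X)
    (opt : (16 * (2 + t″) + 15) * (A c 0 * A c 1) ≤ 16 * (length (Crossing.G C) * length (Crossing.H C))) where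
  open Crossing C
  private
    t t′ qq : ℕ
    t = 2 + t″
    t′ = suc t″
    qq = A c 1

  9≤X : 9 ≤ X
  9≤X = ≤-trans (*-monoˡ-≤ 3 (m≤m+n 3 t″)) hX

  2≤X : 2 ≤ X
  2≤X = ≤-trans (m≤m+n 2 7) 9≤X

  q-big : 27 * (3 + t″) ≤ qq
  q-big = ≤-trans (≤-reflexive (lem t″)) (≤-trans (*-mono-≤ 9≤X hX) (≤-trans (≤-reflexive (cong (X *_) (sym (*-identityʳ X)))) (X^6≤ g 2≤X 2 (m≤m+n 2 3))))
    where lem : ∀ t → 27 * (3 + t) ≡ 9 * ((3 + t) * 3)
          lem = solve-∀

  opt′ : (16 * t + 15) * qq ≤ 16 * (length G * length H)
  opt′ = subst (λ z → (16 * t + 15) * z ≤ 16 * (length G * length H)) (trans (cong (_* qq) (A-zero c)) (*-identityˡ qq)) opt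

  -- Suppose G has two members. Then G has at most 2 members and |H| is at most q + 4t, about 2q in
  -- all against (t + 15/16)q. This is a contradiction because t ≥ 2 here.
  module Several (K : Kernel C) (P′ : Part n) (P′∈ : P′ ∈ G) (P≢P′ : ¬ Kernel.P₀ K ≡ P′) where
    open Kernel K renaming (P₀ to P; P₀∈ to P∈)
    open Core C K hiding (t)

    memZ : Block n → Bool
    memZ C = memᵇ C Z

    out : Part n → List (Block n)
    out P = filterᵇ (not ∘ memZ) (blocks P)

    out⁻ : ∀ P {C} → C ∈ out P → C ∈ᵇ P ≡ true × ¬ C ∈ Z
    out⁻ P {C} h with a , b ← ∈-filterᵇ⁻ (not ∘ memZ) {blocks P} h = ∈-blocks⁻ P a , λ C∈ → not⇒¬ b (∈⇒memᵇ C C∈)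

    out⁺ : ∀ P {C} → C ∈ᵇ P ≡ true → ¬ C ∈ Z → C ∈ out P
    out⁺ P {C} h ne = ∈-filterᵇ⁺ (not ∘ memZ) (∈-blocks⁺ P h) (cong not (∉⇒memᵇ C ne))

    length-out : ∀ P → P ∈ G → length (out P) ≡ 2
    length-out P P∈ = +-cancelˡ-≡ t _ _ (trans (cong (_+ length (out P)) (trans (sym lZ) (sym (count-mem P uZ (cZ P P∈)))))
      (trans (count-not memZ (blocks P)) (trans (proj₂ (All.lookup (proj₂ FG) P∈)) (sym (+-suc t 1)))))

    hits-out : ∀ Q P → Q ∈ H → P ∈ G → t ≤ count (_∈ᵇ Q) Z + count (_∈ᵇ Q) (out P)
    hits-out Q P Q∈ P∈ = ≤-trans (x′ Q P Q∈ P∈) (≤-trans (≤-reflexive (sym (trans (sym (count-++ (_∈ᵇ Q) (filterᵇ memZ (blocks P)) (out P))) (count-partition (_∈ᵇ Q) memZ (blocks P)))))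
      (+-monoˡ-≤ (count (_∈ᵇ Q) (out P)) (Unique-⊆⇒length≤ {ys = filterᵇ (_∈ᵇ Q) Z} (Unique-filterᵇ (_∈ᵇ Q) (Unique-filterᵇ memZ (Unique-blocks P)))
        (λ D D∈ → let a , b = ∈-filterᵇ⁻ (_∈ᵇ Q) {filterᵇ memZ (blocks P)} D∈ in ∈-filterᵇ⁺ (_∈ᵇ Q) (memᵇ⇒∈ D Z (proj₂ (∈-filterᵇ⁻ memZ {blocks P} a))) b))))

    one-hit : ∀ Q P → Q ∈ H → P ∈ G → count (_∈ᵇ Q) Z ≤ t′ → ∃ λ C → C ∈ out P × C ∈ᵇ Q ≡ true
    one-hit Q P Q∈ P∈ le = count-∃ (_∈ᵇ Q) (out P) (+-cancelˡ-≤ t′ 1 _ (≤-trans (≤-reflexive (+-comm t′ 1)) (≤-trans (hits-out Q P Q∈ P∈) (+-monoˡ-≤ _ le))))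

    -- Such a C together with `Z` would be t + 1 common blocks, which determine the partition, so P
    -- and P′ would agree.
    not-shared : ∀ {C} → C ∈ᵇ P ≡ true → C ∈ᵇ P′ ≡ true → ¬ C ∈ Z → ⊥
    not-shared {C} h h′ ne = <⇒≱ (two-members FG P∈ P′∈ P≢P′ (∧-intro h (cZ P P∈)) (∧-intro h′ (cZ P′ P′∈)))
      (≤-trans (GH.count-plus1 (C ∷ Z) (∉⇒All≢ ne ∷ uZ) (trans (cong suc lZ) (+-comm 1 t))) (≤-reflexive (A-zero c)))

    -- Otherwise Q contains both blocks of P outside `Z`, and also some block D of P′ outside `Z`.
    -- The block R of P through a point of D lies outside `Z`, hence in Q, so D = R would be shared
    -- by P and P′.
    exactly : ∀ Q → Q ∈ H → count (_∈ᵇ Q) Z ≤ t′ → t′ ≤ count (_∈ᵇ Q) Z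
    exactly Q Q∈ le with ≤-<-connex (count (_∈ᵇ Q) (out P)) 1
    ... | inj₁ ≤1 = +-cancelʳ-≤ 1 t′ _ (≤-trans (≤-reflexive (+-comm t′ 1)) (≤-trans (hits-out Q P Q∈ P∈) (+-monoʳ-≤ (count (_∈ᵇ Q) Z) ≤1)))
    ... | inj₂ ≥2 with D , D∈ , DQ ← one-hit Q P′ Q∈ P′∈ le with D∈P′ , D∉Z ← out⁻ P′ D∈
        with y , Dy ← block-inhabited P′ (proj₁ (All.lookup (proj₂ FG) P′∈)) D∈P′ =
      ⊥-elim (not-shared (subst (λ B → B ∈ᵇ P ≡ true) (sym D≡E) E∈P) D∈P′ D∉Z)
      where
      isP = proj₁ (All.lookup (proj₂ FG) P∈)
      R = Vec.lookup P y
      E∈P = row∈ᵇ P isP y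
      E∉Z : ¬ R ∈ Z
      E∉Z R∈ = D∉Z (subst (_∈ Z) (sym (block-unique P′ (proj₁ (All.lookup (proj₂ FG) P′∈)) D∈P′ (all-∈ (_∈ᵇ P′) (cZ P′ P′∈) R∈) {y} Dy (row∋ P isP y))) R∈)
      D≡E : D ≡ R
      D≡E = block-unique Q (proj₁ (All.lookup (proj₂ FH) Q∈)) DQ (count-full (_∈ᵇ Q) (out P) (≤-trans (≤-reflexive (length-out P P∈)) ≥2) R (out⁺ P E∈P E∉Z)) {y} Dy (row∋ P isP y)

    -- One of two blocks from P, one of two from P′, different by `not-shared`, and t - 1 blocks of
    -- `Z`: t + 1 blocks, which determine Q, in at most 2 · 2 · t ways.
    rest≤ : count (not ∘ (Z ⊑ᵇ_)) H ≤ 4 * t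
    rest≤ = ≤-trans (union-bound (not ∘ (Z ⊑ᵇ_)) ev₁ (out P) (λ _ → 2 * t) H cov₁ bnd₁)
        (≤-reflexive (trans (∑-const (out P) (2 * t)) (trans (cong (_* (2 * t)) (length-out P P∈)) (sym (*-assoc 2 2 t)))))
      where
      ev₁ : Block n → Part n → Bool
      ev₁ C Q = (C ∈ᵇ Q) ∧ not (Z ⊑ᵇ Q)
      ev₂ : Block n → Block n → Part n → Bool
      ev₂ C D Q = ((C ∈ᵇ Q) ∧ (D ∈ᵇ Q)) ∧ (t′ ≤ᵇ count (_∈ᵇ Q) Z)
      miss : ∀ Q → not (Z ⊑ᵇ Q) ≡ true → count (_∈ᵇ Q) Z ≤ t′
      miss Q m = missing Q (not⇒¬ m)
      cov₁ : ∀ Q → Q ∈ H → not (Z ⊑ᵇ Q) ≡ true → ∃ λ C → C ∈ out P × ev₁ C Q ≡ true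
      cov₁ Q Q∈ m with C , C∈ , e ← one-hit Q P Q∈ P∈ (miss Q m) = C , C∈ , ∧-intro e m
      cov₂ : ∀ C Q → Q ∈ H → ev₁ C Q ≡ true → ∃ λ D → D ∈ out P′ × ev₂ C D Q ≡ true
      cov₂ C Q Q∈ h with CQ , m ← ∧-true {C ∈ᵇ Q} h with D , D∈ , e ← one-hit Q P′ Q∈ P′∈ (miss Q m) =
        D , D∈ , ∧-intro (∧-intro CQ e) (≤⇒≤ᵇ-true (exactly Q Q∈ (miss Q m)))
      bnd₂ : ∀ C D → C ∈ out P → D ∈ out P′ → count (ev₂ C D) H ≤ t
      bnd₂ C D C∈ D∈ = ≤-trans (cover-bound H Z t′ 1 (λ Q → (C ∈ᵇ Q) ∧ (D ∈ᵇ Q)) 1 (trans lZ (+-comm 1 t′)) λ Y Y⊆ lY →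
          ≤-trans (count-mono H (λ Q _ h → let bc , y = ∧-true {(C ∈ᵇ Q) ∧ (D ∈ᵇ Q)} h ; b , c = ∧-true {C ∈ᵇ Q} bc in ∧-intro b (∧-intro c y)))
          (≤-trans (HG.count-plus1 (C ∷ D ∷ Y) (((λ e → not-shared (proj₁ (out⁻ P C∈)) (subst (λ B → B ∈ᵇ P′ ≡ true) (sym e) (proj₁ (out⁻ P′ D∈))) (proj₂ (out⁻ P C∈))) ∷ ∉Y P C∈ Y⊆)
            ∷ ∉Y P′ D∈ Y⊆ ∷ Unique-⊆ Y⊆ uZ) (trans (cong (2 +_) lY) (+-comm 1 t))) (≤-reflexive (A-zero c))))
          (≤-reflexive (trans (*-identityʳ _) (*-identityʳ t)))
        where ∉Y : ∀ P {C Y} → C ∈ out P → Y ⊆ Z → All (λ D → ¬ C ≡ D) Y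
              ∉Y P C∈ Y⊆ = All.tabulate (λ D∈ e → proj₂ (out⁻ P C∈) (subst (_∈ Z) (sym e) (⊆-∈ Y⊆ D∈)))
      bnd₁ : ∀ C → C ∈ out P → count (ev₁ C) H ≤ 2 * t
      bnd₁ C C∈ = ≤-trans (union-bound (ev₁ C) (ev₂ C) (out P′) (λ _ → t) H (cov₂ C) (λ D D∈ → bnd₂ C D C∈ D∈))
        (≤-reflexive (trans (∑-const (out P′) t) (cong (_* t) (length-out P′ P′∈))))

    -- Of the 3 blocks in `W` one is dead, and each of the others determines at most one member of G
    -- together with `Z`.
    G≤2 : length G ≤ 2
    G≤2 = ≤-trans (count-true G (λ P P∈ → cZ P P∈))
        (≤-trans (union-bound (Z ⊑ᵇ_) (λ B P → (B ∷ Z) ⊑ᵇ P) (without D W) (λ _ → 1) G cov bnd)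
        (≤-reflexive (trans (∑-const (without D W) 1) (trans (*-identityʳ _) (suc-injective (trans (sym (length-without Unique-W D∈)) lW))))))
      where
      deadD = dead (exactly Q₀ Q₀∈ few)
      D = proj₁ deadD
      D∈ = proj₁ (proj₂ deadD)
      D∉ = proj₂ (proj₂ deadD)
      cov : ∀ P → P ∈ G → Z ⊑ᵇ P ≡ true → ∃ λ B → B ∈ without D W × (B ∷ Z) ⊑ᵇ P ≡ true
      cov P P∈ z = let B , B∈ , e = G-hit P P∈ in
        B , ∈-filterᵇ⁺ (not ∘ (_==ᵛ D)) B∈ (cong not (≢⇒==ᵛ {B = B} {D} λ B≡D → D∉ P P∈ (subst (λ B → B ∈ᵇ P ≡ true) B≡D e))) , ∧-intro e z
      bnd : ∀ B → B ∈ without D W → count ((B ∷ Z) ⊑ᵇ_) G ≤ 1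
      bnd B B∈ = ≤-trans (GH.count-plus1 (B ∷ Z) (uB∷Z (proj₁ (without-∈ {T = W} B∈))) (trans (cong suc lZ) (+-comm 1 t))) (≤-reflexive (A-zero c))

    absurd : ⊥
    absurd = 1≰0 (≤-cert (16 * (t″ * qq) + 277 * t″ + 958) (+-mono-≤ (+-mono-≤ opt′ (*-monoʳ-≤ 16 (*-mono-≤ G≤2 (countH rest≤)))) (*-monoʳ-≤ 15 q-big))
        (lem t″ qq (length G * length H)))
      where lem : ∀ t q N → 0 + ((16 * (2 + t) + 15) * q + 16 * N + 15 * (27 * (3 + t))) ≡ 1 + (16 * N + 16 * (2 * (q + 4 * (2 + t))) + 15 * q) + (16 * (t * q) + 277 * t + 958)
            lem = solve-∀

  -- G has a single member P. The kernel can only be P without one block; removing a largest block R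
  -- gives the best chance that the other t + 1 blocks are singletons.
  module One (P : Part n) (G≡ : G ≡ P ∷ []) (R : Block n) (R∈ : R ∈ blocks P) (R-max : ∀ B → B ∈ blocks P → size B ≤ size R) where
    P∈ : P ∈ G
    P∈ = subst (P ∈_) (sym G≡) (here refl)
    isP = proj₁ (All.lookup (proj₂ FG) P∈)
    #P : #blocks P ≡ suc (t + 1)
    #P = proj₂ (All.lookup (proj₂ FG) P∈)
    K = without R (blocks P)
    uK : Unique K
    uK = Unique-filterᵇ _ (Unique-blocks P)
    lK : length K ≡ suc t
    lK = trans (suc-injective (trans (sym (length-without (Unique-blocks P) R∈)) #P)) (+-comm t 1)
    K∈ : ∀ {B} → B ∈ K → B ∈ blocks P × ¬ B ≡ R
    K∈ = without-∈ {T = blocks P}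
    K⊑P : K ⊑ᵇ P ≡ true
    K⊑P = ∈-all (_∈ᵇ P) K (λ B∈ → ∈-blocks⁻ P (proj₁ (K∈ B∈)))
    inhK : ∀ {B} → B ∈ K → ∃ λ i → B ∋ i
    inhK B∈ = block-inhabited P isP (∈-blocks⁻ P (proj₁ (K∈ B∈)))
    nR : size R + usize K ≡ n
    nR = trans (sym (usize-without (blocks P) (Unique-blocks P) R∈)) (usize-blocks P isP)
      where
      usize-without : ∀ (T : List (Block n)) {C} → Unique T → C ∈ T → usize T ≡ size C + usize (without C T)
      usize-without (B ∷ T) (a ∷ u) (here refl) rewrite ==ᵛ-refl B = cong (λ L → size B + usize L) (sym (all-stay T (λ C∈ e → All.lookup a C∈ (sym e))))
        where all-stay : ∀ T → (∀ {C} → C ∈ T → ¬ C ≡ B) → without B T ≡ T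
              all-stay [] h = refl
              all-stay (C ∷ T) h rewrite ≢⇒==ᵛ (h (here refl)) = cong (C ∷_) (all-stay T (h ∘ there))
      usize-without (B ∷ T) {C} (a ∷ u) (there C∈) rewrite ≢⇒==ᵛ (All.lookup a C∈) | usize-without T u C∈ = lem (size B) (size C) _
        where lem : ∀ a b c → a + (b + c) ≡ b + (a + c)
              lem = solve-∀

    tot : ∀ Q → Q ∈ H → t ≤ ⟦ R ∈ᵇ Q ⟧ + count (_∈ᵇ Q) K
    tot Q Q∈ = ≤-trans (x′ Q P Q∈ P∈) (≤-reflexive (count-without (_∈ᵇ Q) (Unique-blocks P) R∈))

    uR∷ : ∀ {Y} → (∀ {B} → B ∈ Y → B ∈ K) → Unique Y → Unique (R ∷ Y)
    uR∷ h u = All.tabulate (λ B∈ e → proj₂ (K∈ (h B∈)) (sym e)) ∷ u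

    -- A member Q of H with fewer than t blocks of K would contain R and t - 1 of the singletons.
    -- That leaves two points for two blocks, so Q = P by S 2 2 = 1, yet P contains all of K.
    kernel : (∀ B → B ∈ K → size B ≡ 1) → KernelShape t G H
    kernel s = K , uK , lK , s , (λ P′ P′∈ → subst (λ P → K ⊑ᵇ P ≡ true) (sym (only (subst (P′ ∈_) G≡ P′∈))) K⊑P) , cov
      where
      only : ∀ {P′} → P′ ∈ P ∷ [] → P′ ≡ P
      only (here e) = e
      cov : ∀ Q → Q ∈ H → t ≤ count (_∈ᵇ Q) K
      cov Q Q∈ with ≤-<-connex t (count (_∈ᵇ Q) K)
      ... | inj₁ le = le
      ... | inj₂ lt = contradiction (≤-trans 2≤ c≤) (<⇒≱ ≤-refl)
        where
        RQ : ∀ b → R ∈ᵇ Q ≡ b → b ≡ true × t′ ≤ count (_∈ᵇ Q) K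
        RQ true e = refl , s≤s⁻¹ (≤-trans (tot Q Q∈) (≤-reflexive (cong (λ b → ⟦ b ⟧ + count (_∈ᵇ Q) K) e)))
        RQ false e = contradiction (≤-trans (tot Q Q∈) (≤-reflexive (cong (λ b → ⟦ b ⟧ + count (_∈ᵇ Q) K) e))) (<⇒≱ lt)
        rq : R ∈ᵇ Q ≡ true
        rq = proj₁ (RQ (R ∈ᵇ Q) refl)
        Y = filterᵇ (_∈ᵇ Q) K
        Y∈ : ∀ {B} → B ∈ Y → B ∈ K × B ∈ᵇ Q ≡ true
        Y∈ = ∈-filterᵇ⁻ (_∈ᵇ Q) {K}
        lY : length Y ≡ t′
        lY = ≤-antisym (s≤s⁻¹ lt) (proj₂ (RQ (R ∈ᵇ Q) refl))
        P≢Q : ¬ P ≡ Q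
        P≢Q e = <⇒≱ lt (≤-trans (n≤1+n t) (≤-trans (≤-reflexive (sym lK)) (count-true K (λ B B∈ → subst (λ P → B ∈ᵇ P ≡ true) e (all-∈ (_∈ᵇ P) K⊑P B∈)))))
        F = P ∷ Q ∷ []
        FF : FamilyIn (suc (t + 1)) F
        FF = ((P≢Q ∷ []) ∷ [] ∷ []) , All.lookup (proj₂ FG) P∈ ∷ All.lookup (proj₂ FH) Q∈ ∷ []
        2≤ : 2 ≤ count ((R ∷ Y) ⊑ᵇ_) F
        2≤ = two-members {p = (R ∷ Y) ⊑ᵇ_} FF (here refl) (there (here refl)) P≢Q
          (∧-intro (∈-blocks⁻ P R∈) (∈-all (_∈ᵇ P) Y (λ B∈ → all-∈ (_∈ᵇ P) K⊑P (proj₁ (Y∈ B∈)))))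
          (∧-intro rq (∈-all (_∈ᵇ Q) Y (λ B∈ → proj₂ (Y∈ B∈))))
        c≤ : count ((R ∷ Y) ⊑ᵇ_) F ≤ 1
        c≤ = Count.count-S F FF (R ∷ Y) 2 1 (uR∷ (proj₁ ∘ Y∈) (Unique-filterᵇ _ uK)) (cong suc (trans (cong (_+ 2) lY) (+-suc t′ 1)))
          (λ _ → ≤-reflexive (trans (sym nR) (trans (cong (size R +_) (trans (trans (usize-Singles K s) lK) (trans (+-comm 2 t′)
            (cong (_+ 2) (sym (trans (usize-Singles Y (λ B B∈ → s B (proj₁ (Y∈ B∈)))) lY)))))) (sym (+-assoc (size R) (usize Y) 2)))))

    -- The r points outside R and `Y` are to be split into two blocks. They come from two blocks of
    -- P no larger than R, so r ≤ 2|R|; with |R| + r ≤ c + 3 this gives 3r ≤ 2(c + 3), and S r 2 is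
    -- only of the order of q^(2/3).
    w-bound : ∀ Y → Y ⊆ K → length Y ≡ t′ → X * X * count ((R ∷ Y) ⊑ᵇ_) H ≤ 2 * (qq + 1)
    w-bound Y Y⊆ lY with l , u ← usize-⊆ (size R) (λ B B∈ → R-max B (proj₁ (K∈ B∈))) Y⊆ 2 (trans lK (trans (+-comm 2 t′) (cong (_+ 2) (sym lY)))) =
        ≤-trans (*-monoʳ-≤ (X * X) c≤) (^-cancelˡ-≤ 2 (*-cancelˡ-≤ 8 cube))
      where
      open ≤-Reasoning
      h = size R
      r = usize K ∸ usize Y
      Kr : usize K ≡ usize Y + r
      Kr = sym (m+[n∸m]≡n l)
      c≤ : count ((R ∷ Y) ⊑ᵇ_) H ≤ S r 2
      c≤ = Count.count-S H FH (R ∷ Y) r 1 (uR∷ (⊆-∈ Y⊆) (Unique-⊆ Y⊆ uK)) (cong suc (trans (cong (_+ 2) lY) (+-suc t′ 1)))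
        (λ _ → ≤-reflexive (trans (sym nR) (trans (cong (h +_) Kr) (sym (+-assoc h (usize Y) r)))))
      r≤2h : r ≤ 2 * h
      r≤2h = +-cancelˡ-≤ (usize Y) r _ (≤-trans (≤-reflexive (sym Kr)) u)
      h+r≤ : h + r ≤ c + 3
      h+r≤ = +-cancelʳ-≤ t′ (h + r) (c + 3) (≤-trans (+-monoʳ-≤ (h + r) (≤-trans (≤-reflexive (sym lY)) (length≤usize Y (λ B∈ → inhK (⊆-∈ Y⊆ B∈)))))
        (≤-reflexive (trans (lem h r (usize Y)) (trans (cong (h +_) (sym Kr)) (trans nR (trans en₁ (lem2 c t′)))))))
        where lem : ∀ a b c → a + b + c ≡ a + (c + b)
              lem = solve-∀
              lem2 : ∀ c t → c + suc (suc t + 1) ≡ c + 3 + t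
              lem2 = solve-∀
      3r≤ : r * 3 ≤ 2 * (c + 3)
      3r≤ = ≤-cert 0 (+-mono-≤ r≤2h (*-monoʳ-≤ 2 h+r≤)) (lem r h c)
        where lem : ∀ r h c → 2 * (c + 3) + (r + 2 * (h + r)) ≡ r * 3 + (2 * h + 2 * (c + 3)) + 0
              lem = solve-∀
      Zp : 2 ^ (c + 1) ≤ qq + 1
      Zp = ≤-trans (≤-reflexive (sym (trans (cong (2 ^ (c + 1) *_) (A-zero c)) (*-identityʳ _))))
        (≤-trans (A-ratio c 0 (2 ^ (c + 1)) (≤-reflexive (*-identityʳ _))) (≤-reflexive (cong (qq +_) (A-zero c))))
      q1 = qq + 1
      -- Cubes turn the exponent 2/3 into whole powers: 2^(3r) ≤ 16 (2^(c + 1))². The missing third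
      -- factor q + 1 then absorbs X⁶ through `big`.
      cube3 : (2 * S r 2) ^ 3 ≤ 16 * (q1 * q1)
      cube3 = begin
        (2 * S r 2) ^ 3                        ≤⟨ ^-monoˡ-≤ 3 (2S₂≤ r) ⟩
        (2 ^ r) ^ 3                            ≡⟨ ^-*-assoc 2 r 3 ⟩
        2 ^ (r * 3)                            ≤⟨ ^-monoʳ-≤ 2 3r≤ ⟩
        2 ^ (2 * (c + 3))                      ≡⟨ cong (2 ^_) (lem c) ⟩
        2 ^ (4 + ((c + 1) + (c + 1)))          ≡⟨ trans (^-distribˡ-+-* 2 4 ((c + 1) + (c + 1))) (cong (16 *_) (^-distribˡ-+-* 2 (c + 1) (c + 1))) ⟩
        16 * (2 ^ (c + 1) * 2 ^ (c + 1))       ≤⟨ *-monoʳ-≤ 16 (*-mono-≤ Zp Zp) ⟩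
        16 * (q1 * q1)                         ∎
        where lem : ∀ c → 2 * (c + 3) ≡ 4 + ((c + 1) + (c + 1))
              lem = solve-∀
      cube : 8 * (X * X * S r 2) ^ 3 ≤ 8 * (2 * q1) ^ 3
      cube = begin
        8 * (X * X * S r 2) ^ 3    ≡⟨ lem X (S r 2) ⟩
        X ^ 6 * (2 * S r 2) ^ 3    ≤⟨ *-mono-≤ (Good.big g) cube3 ⟩
        q1 * (16 * (q1 * q1))      ≤⟨ m≤m+n _ (48 * (q1 * q1 * q1)) ⟩
        q1 * (16 * (q1 * q1)) + 48 * (q1 * q1 * q1) ≡⟨ lem2 q1 ⟩
        8 * (2 * q1) ^ 3           ∎
        where
        lem : ∀ X s → 8 * (X * X * s * (X * X * s * (X * X * s * 1))) ≡ X * (X * (X * (X * (X * (X * 1))))) * (2 * s * (2 * s * (2 * s * 1)))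
        lem = solve-∀
        lem2 : ∀ q → q * (16 * (q * q)) + 48 * (q * q * q) ≡ 8 * (2 * q * (2 * q * (2 * q * 1)))
        lem2 = solve-∀

    -- Members with t blocks in K number at most q + t q″ by `kernel-count`; the others contain R
    -- and t - 1 blocks of K, at most t² w of them. In total this is below (1 + t/2)q + 2(q + 1)/9,
    -- short of (t + 15/16)q.
    spread-out : ∀ {C} → C ∈ K → ¬ size C ≡ 1 → ⊥
    spread-out C∈ ne = 1≰0 (≤-cert (30 * qq + 72 * (t″ * qq) + 72 * qq + 15) (+-mono-≤ (+-mono-≤ (*-monoʳ-≤ 9 opt″) (*-monoʳ-≤ 144 H≤)) (+-mono-≤ (+-mono-≤ (*-monoʳ-≤ (72 * t) 2q″≤q) (*-monoʳ-≤ 16 w≤)) 48≤q))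
        (lem t″ qq q″ w (length H)))
      where
      q″ = S (c + 1) 2
      sup : ∃ λ w → (∀ Y → Y ⊆ K → length Y ≡ t′ → count (λ Q → (R ∈ᵇ Q) ∧ (Y ⊑ᵇ Q)) H ≤ w) × X * X * w ≤ 2 * (qq + 1)
      -- The integer quotient gives one bound for all choices of `Y`, as `cover-bound` requires.
      sup = (2 * (qq + 1)) / (X * X) , (λ Y s l → *-cancel-/ (w-bound Y s l)) , ≤-trans (≤-reflexive (*-comm (X * X) _)) (m/n*n≤m (2 * (qq + 1)) (X * X))
        where
        instance nz : NonZero (X * X)
                 nz = >-nonZero (*-mono-≤ (≤-trans (s≤s z≤n) 9≤X) (≤-trans (s≤s z≤n) 9≤X))
        *-cancel-/ : ∀ {a b} → X * X * a ≤ b → a ≤ b / (X * X)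
        *-cancel-/ {a} {b} h = ≤-trans (≤-reflexive (sym (m*n/n≡m a (X * X)))) (/-monoˡ-≤ (X * X) (≤-trans (≤-reflexive (*-comm a (X * X))) h))
      w = proj₁ sup
      w≤ : 9 * (t * t) * w ≤ 2 * (qq + 1)
      w≤ = ≤-trans (*-monoˡ-≤ w (≤-trans (≤-reflexive (lemt t)) (*-mono-≤ ht ht))) (proj₂ (proj₂ sup))
        where lemt : ∀ t → 9 * (t * t) ≡ t * 3 * (t * 3)
              lemt = solve-∀
              ht : t * 3 ≤ X
              ht = ≤-trans (*-monoˡ-≤ 3 (n≤1+n t)) hX
      2q″≤q : 2 * q″ ≤ qq
      2q″≤q = m≤m+n _ _
      48≤q : 48 ≤ qq
      48≤q = ≤-trans (m≤m+n 48 33) (≤-trans (*-monoʳ-≤ 27 (m≤m+n 3 t″)) q-big)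
      opt″ : (16 * t + 15) * qq ≤ 16 * length H
      opt″ = ≤-trans opt′ (≤-reflexive (cong (16 *_) (trans (cong (λ G → length G * length H) G≡) (*-identityˡ _))))
      in𝒟 : Part n → Bool
      in𝒟 Q = t ≤ᵇ count (_∈ᵇ Q) K
      H′ = filterᵇ in𝒟 H
      FH′ : FamilyIn (suc (t + 1)) H′
      FH′ = Unique-filterᵇ in𝒟 (proj₁ FH) , All.tabulate (λ Q∈ → All.lookup (proj₂ FH) (proj₁ (∈-filterᵇ⁻ in𝒟 {H} Q∈)))
      H′≤ : length H′ ≤ qq + t * q″
      H′≤ = kernel-count t′ 0 c H′ FH′ en₁ K uK lK inhK (λ Q Q∈ → ≤ᵇ-true {t} (proj₂ (∈-filterᵇ⁻ in𝒟 {H} Q∈))) C∈ ne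
      H″≤ : count (not ∘ in𝒟) H ≤ t * t * w
      H″≤ = ≤-trans (count-mono H (λ Q Q∈ m → go Q Q∈ (λ le → not⇒¬ m (≤⇒≤ᵇ-true {t} le)) (R ∈ᵇ Q) refl))
        (≤-trans (cover-bound H K t′ 2 (R ∈ᵇ_) w (trans lK (+-comm 2 t′)) (proj₁ (proj₂ sup))) (≤-reflexive (cong (λ z → t * z * w) (*-identityʳ t))))
        where
        go : ∀ Q → Q ∈ H → ¬ t ≤ count (_∈ᵇ Q) K → ∀ b → R ∈ᵇ Q ≡ b → (R ∈ᵇ Q) ∧ (t′ ≤ᵇ count (_∈ᵇ Q) K) ≡ true
        go Q Q∈ ¬le true e = ∧-intro e (≤⇒≤ᵇ-true (s≤s⁻¹ (≤-trans (tot Q Q∈) (≤-reflexive (cong (λ b → ⟦ b ⟧ + count (_∈ᵇ Q) K) e)))))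
        go Q Q∈ ¬le false e = contradiction (≤-trans (tot Q Q∈) (≤-reflexive (cong (λ b → ⟦ b ⟧ + count (_∈ᵇ Q) K) e))) ¬le
      H≤ : length H ≤ qq + t * q″ + t * t * w
      H≤ = ≤-trans (≤-reflexive (sym (count-not in𝒟 H))) (+-mono-≤ H′≤ H″≤)
      lem : ∀ t q q″ w N → 0 + (9 * ((16 * (2 + t) + 15) * q) + 144 * N + (72 * (2 + t) * (2 * q″) + 16 * (9 * ((2 + t) * (2 + t)) * w) + 48))
          ≡ 1 + (9 * (16 * N) + 144 * (q + (2 + t) * q″ + (2 + t) * (2 + t) * w) + (72 * (2 + t) * q + 16 * (2 * (q + 1)) + q)) + (30 * q + 72 * (t * q) + 72 * q + 15)
      lem = solve-∀

    shape : KernelShape t G H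
    shape with singles? K
    ... | inj₁ s = kernel s
    ... | inj₂ (C , C∈ , ne) = ⊥-elim (spread-out C∈ ne)

  tight-shape : Kernel C → KernelShape t G H
  tight-shape K = go G refl
    where
    open Kernel K
    go : ∀ G′ → G ≡ G′ → KernelShape t G H
    go [] e with () ← subst (P₀ ∈_) e P₀∈
    go (P ∷ []) e with R , R∈ , R-max ← largest (blocks P) (≤-trans (s≤s z≤n) (≤-reflexive (sym (proj₂ (All.lookup (proj₂ FG) (subst (P ∈_) (sym e) (here refl))))))) =
      One.shape P e R R∈ R-max
    go (P ∷ P′ ∷ R) e with (ne ∷ _) ∷ _ ← subst Unique e (proj₁ FG) =
      ⊥-elim (Several.absurd (record { Z = Z ; uZ = uZ ; lZ = lZ ; cZ = cZ ; P₀ = P ; Q₀ = Q₀ ; P₀∈ = subst (P ∈_) (sym e) (here refl)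
        ; Q₀∈ = Q₀∈ ; few = few }) P′ (subst (P′ ∈_) (sym e) (there (here refl))) ne)

-- Explicit pairs that bound the maximum from below.

size0⇒zeros : (B : Block n) → size B ≡ 0 → B ≡ zeros
size0⇒zeros []          e = refl
size0⇒zeros (false ∷ B) e = cong (false ∷_) (size0⇒zeros B e)

single-unique : (B C : Block n) → size B ≡ 1 → size C ≡ 1 → ∀ i → B ∋ i → C ∋ i → B ≡ C
single-unique (true ∷ B)  (true ∷ C)  b c zero p q =
  cong (true ∷_) (trans (size0⇒zeros B (suc-injective b)) (sym (size0⇒zeros C (suc-injective c))))
single-unique (false ∷ B) (false ∷ C) b c (suc i) p q = cong (false ∷_) (single-unique B C b c i p q)
single-unique (true ∷ B)  C  b c (suc i) p q = ⊥-elim (zeros∌ {i = i} (subst (_∋ i) (size0⇒zeros B (suc-injective b)) p))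
single-unique B (true ∷ C)  b c (suc i) p q = ⊥-elim (zeros∌ {i = i} (subst (_∋ i) (size0⇒zeros C (suc-injective c)) q))

single-inh : (B : Block n) → size B ≡ 1 → ∃ λ i → B ∋ i
single-inh {n} B e with inhabited? B
... | inj₁ h    = h
... | inj₂ refl with () ← trans (sym (size-zeros n)) e

Singles : List (Block n) → Set
Singles T = Unique T × (∀ B → B ∈ T → size B ≡ 1)

Singles-WF : {T : List (Block n)} → Singles T → WF T
Singles-WF (u , s) = record { uniq = u
  ; disj = λ {B} {C} b c {i} p q → single-unique B C (s B b) (s C c) i p q
  ; inh = λ {B} b → single-inh B (s B b) }

FamilyIn-famWith : ∀ n k T → FamilyIn k (famWith n k T)
FamilyIn-famWith n k T = Unique-famWith n k T , All.tabulate (λ {P} P∈ → proj₁ (∈-famWith⁻ {k = k} {T} P P∈))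

FamilyIn-filter : ∀ {k} (p : Part n → Bool) {F} → FamilyIn k F → FamilyIn k (filterᵇ p F)
FamilyIn-filter p {F} (u , a) = Unique-filterᵇ p u , All.tabulate (λ P∈ → All.lookup a (proj₁ (∈-filterᵇ⁻ p {F} P∈)))

commonAll⁻ : ∀ (F₁ F₂ : Family n) B → nonempty B ∧ all (λ P → B ∈ᵇ P) F₁ ∧ all (λ P → B ∈ᵇ P) F₂ ≡ true →
             (∀ P → P ∈ F₁ → B ∈ᵇ P ≡ true) × (∀ P → P ∈ F₂ → B ∈ᵇ P ≡ true)
commonAll⁻ F₁ F₂ B h with _ , g ← ∧-true {nonempty B} h with a , b ← ∧-true {all (λ P → B ∈ᵇ P) F₁} g =
  (λ P → all-∈ (λ P → B ∈ᵇ P) a) , (λ P → all-∈ (λ P → B ∈ᵇ P) b)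

commonAll< : ∀ {t} (F₁ F₂ : Family n) (L : List (Block n)) → length L < t →
             (∀ B → (∀ P → P ∈ F₁ → B ∈ᵇ P ≡ true) → (∀ P → P ∈ F₂ → B ∈ᵇ P ≡ true) → B ∈ L) → NonTrivial t F₁ F₂
commonAll< {n} F₁ F₂ L lt h = ≤-trans (s≤s (Unique-⊆⇒length≤ {ys = L} (Unique-filterᵇ com (Unique-allSubsets n))
    (λ B B∈ → let a , b = commonAll⁻ F₁ F₂ B (proj₂ (∈-filterᵇ⁻ com {allSubsets n} B∈)) in h B a b))) lt
  where com : Block n → Bool
        com B = nonempty B ∧ all (λ P → B ∈ᵇ P) F₁ ∧ all (λ P → B ∈ᵇ P) F₂

-- If a block outside `T` lay in all these partitions, prescribing it as well would not lower their
-- number, against A c i < A c (i + 1).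
common-famWith : ∀ {c t′ i} → n ≡ c + suc (suc t′ + suc i) → A c i < A c (suc i) → ∀ {T : List (Block n)} → Singles T → length T ≡ suc t′ →
                 ∀ B → (∀ P → P ∈ famWith n (suc (suc t′ + suc i)) T → B ∈ᵇ P ≡ true) → B ∈ T
common-famWith {n} {c} {t′} {i} en q′<q {T} sT lT B h = go (memᵇ B T) refl
  where
  k = suc (suc t′ + suc i)
  go : ∀ b → memᵇ B T ≡ b → B ∈ T
  go true  e = memᵇ⇒∈ B T e
  go false e = contradiction q′<q (≤⇒≯ (begin
      A c (suc i)                           ≡⟨ famWith-singletons c T (suc i) (Singles-WF sT) (usize-Singles T (proj₂ sT)) (trans (cong (_+ suc (suc i)) lT) (+-suc (suc t′) (suc i))) en ⟨
      length (famWith n k T)                ≤⟨ count-true (famWith n k T) (λ P P∈ → ∧-intro (h P P∈) (proj₂ (∈-famWith⁻ {k = k} {T} P P∈))) ⟩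
      count ((B ∷ T) ⊑ᵇ_) (famWith n k T)   ≤⟨ Count.count-A (famWith n k T) (FamilyIn-famWith n k T) c (B ∷ T) i
                                                 (All.tabulate (λ C∈ B≡C → contradiction (trans (sym (∈⇒memᵇ B (subst (_∈ T) (sym B≡C) C∈))) e) (λ ())) ∷ proj₁ sT)
                                                 (cong suc (cong (_+ suc i) lT)) en ⟩
      A c i                                 ∎))
    where open ≤-Reasoning

famWith-≤count : ∀ {k} {T Z : List (Block n)} (p : Part n → Bool) → (∀ P → T ⊑ᵇ P ≡ true → Z ⊑ᵇ P ≡ true × p P ≡ true) →
                 length (famWith n k T) ≤ count p (famWith n k Z)
famWith-≤count {n} {k} {T} {Z} p h = Unique-⊆⇒length≤ {ys = filterᵇ p (famWith n k Z)} (Unique-famWith n k T)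
  (λ P P∈ → let isk , e = ∈-famWith⁻ {k = k} {T} P P∈ ; a , b = h P e in ∈-filterᵇ⁺ p (∈-famWith⁺ {k = k} {Z} P isk a) b)

ntCross : ∀ k ℓ t (F₁ F₂ : Family n) → FamilyIn k F₁ → FamilyIn ℓ F₂ → CrossInt t F₁ F₂ → NonTrivial t F₁ F₂ → NTCross n k ℓ t F₁ F₂
ntCross k ℓ t F₁ F₂ a b c d = a , b , c , d

-- The pair (𝒞(T), 𝒟(T)) for a set T of t + 1 singletons.
module Opt𝒟 {n} (t′ j i c₁ c₂ : ℕ) (en₁ : n ≡ c₁ + suc (suc t′ + suc j)) (en₂ : n ≡ c₂ + suc (suc t′ + suc i))
    (q′<q : A c₂ i < A c₂ (suc i)) (K : List (Block n)) (sK : Singles K) (lK : length K ≡ suc (suc t′)) where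
  private
    t k ℓ : ℕ
    t = suc t′
    k = suc (t + suc j)
    ℓ = suc (t + suc i)
    uK = proj₁ sK
  in𝒟 : Part n → Bool
  in𝒟 P = t ≤ᵇ count (_∈ᵇ P) K
  𝒞f 𝒟f Πℓ : Family n
  𝒞f = famWith n k K
  Πℓ = famWith n ℓ []
  𝒟f = filterᵇ in𝒟 Πℓ

  length-𝒞f : length 𝒞f ≡ A c₁ j
  length-𝒞f = famWith-singletons c₁ K j (Singles-WF sK) (usize-Singles K (proj₂ sK)) (cong (_+ suc j) (trans lK refl)) en₁

  sub : ∀ {C} → C ∈ K → Singles (without C K) × length (without C K) ≡ t
  sub C∈ = (Unique-filterᵇ _ uK , λ B B∈ → proj₂ sK B (proj₁ (without-∈ {T = K} B∈))) , suc-injective (trans (sym (length-without uK C∈)) lK)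

  without⊑⇒ : ∀ {C} P → C ∈ K → without C K ⊑ᵇ P ≡ true → t ≤ count (_∈ᵇ P) K
  without⊑⇒ {C} P C∈ h = ≤-trans (≤-reflexive (sym (proj₂ (sub C∈)))) (≤-trans (count-true (without C K) (λ B B∈ → all-∈ (_∈ᵇ P) h B∈))
    (≤-trans (m≤n+m _ ⟦ C ∈ᵇ P ⟧) (≤-reflexive (sym (count-without (_∈ᵇ P) uK C∈)))))

  -- Bonferroni over the t + 1 events of containing K without C. Two such events together force all
  -- of K, so each pair overlaps in at most A c₂ i partitions.
  length-𝒟f : suc t * A c₂ (suc i) ≤ length 𝒟f + tri (suc t) * A c₂ i
  length-𝒟f = subst (λ l → l * A c₂ (suc i) ≤ length 𝒟f + tri l * A c₂ i) lK
      (≤-trans (bonferroni (λ C P → without C K ⊑ᵇ P) K (A c₂ (suc i)) (A c₂ i) Πℓ lo (pairs (λ h → h) uK))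
        (+-monoˡ-≤ _ (count-mono Πℓ (λ P _ h → let C , C∈ , e = any-∈ (λ C → without C K ⊑ᵇ P) K h in ≤⇒≤ᵇ-true (without⊑⇒ P C∈ e)))))
    where
    lo : ∀ C → C ∈ K → A c₂ (suc i) ≤ count (λ P → without C K ⊑ᵇ P) Πℓ
    lo C C∈ = ≤-trans (≤-reflexive (sym (famWith-singletons c₂ (without C K) (suc i) (Singles-WF (proj₁ (sub C∈))) (usize-Singles (without C K) (proj₂ (proj₁ (sub C∈))))
        (trans (cong (_+ suc (suc i)) (proj₂ (sub C∈))) (+-suc t (suc i))) en₂)))
      (famWith-≤count {k = ℓ} {without C K} {[]} (without C K ⊑ᵇ_) (λ P h → refl , h))
    pairs : ∀ {M} → (∀ {B} → B ∈ M → B ∈ K) → Unique M → AllPairs (λ C D → count (λ P → (without C K ⊑ᵇ P) ∧ (without D K ⊑ᵇ P)) Πℓ ≤ A c₂ i) M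
    pairs h [] = []
    pairs h (a ∷ u) = All.tabulate (λ D∈ → bnd (All.lookup a D∈)) ∷ pairs (h ∘ there) u
      where
      bnd : ∀ {C D} → ¬ C ≡ D → count (λ P → (without C K ⊑ᵇ P) ∧ (without D K ⊑ᵇ P)) Πℓ ≤ A c₂ i
      bnd {C} {D} ne = ≤-trans (count-mono Πℓ (λ P _ h → let a , b = ∧-true {without C K ⊑ᵇ P} h in ∈-all (_∈ᵇ P) K (λ {B} B∈ → mem P a b B B∈)))
          (Count.count-A Πℓ (FamilyIn-famWith n ℓ []) c₂ K i uK (cong (_+ suc i) lK) en₂)
        where
        mem : ∀ P → without C K ⊑ᵇ P ≡ true → without D K ⊑ᵇ P ≡ true → ∀ B → B ∈ K → B ∈ᵇ P ≡ true
        mem P a b B B∈ with B ==ᵛ C in e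
        ... | false = all-∈ (_∈ᵇ P) a (∈-filterᵇ⁺ (not ∘ (_==ᵛ C)) B∈ (cong not e))
        ... | true  = all-∈ (_∈ᵇ P) b (∈-filterᵇ⁺ (not ∘ (_==ᵛ D)) B∈ (cong not (≢⇒==ᵛ {B = B} {D} λ B≡D → ne (trans (sym (==ᵛ⇒≡ B C e)) B≡D))))

  cross : CrossInt t 𝒞f 𝒟f
  cross P Q P∈ Q∈ = ≤-trans (≤ᵇ-true {t} (proj₂ (∈-filterᵇ⁻ in𝒟 {Πℓ} Q∈)))
    (common≥ P Q (filterᵇ (_∈ᵇ Q) K) (Unique-filterᵇ (_∈ᵇ Q) uK) (λ B∈ → let a , b = ∈-filterᵇ⁻ (_∈ᵇ Q) {K} B∈ in
      all-∈ (_∈ᵇ P) (proj₂ (∈-famWith⁻ {k = k} {K} P P∈)) a , b))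
  -- For each C in K the family `𝒟f` has all ℓ-partitions that contain K without C, so a common
  -- block must itself lie in K without C; no block does so for every C.
  none : ∀ B → (∀ P → P ∈ 𝒞f → B ∈ᵇ P ≡ true) → (∀ P → P ∈ 𝒟f → B ∈ᵇ P ≡ true) → B ∈ []
  none B _ h = ⊥-elim (fin K refl)
    where
    in-without : ∀ {C} → C ∈ K → B ∈ without C K
    in-without {C} C∈ = common-famWith {t′ = t′} en₂ q′<q (proj₁ (sub C∈)) (proj₂ (sub C∈)) B
      (λ P P∈ → let isk , e = ∈-famWith⁻ {k = ℓ} {without C K} P P∈ in h P (∈-filterᵇ⁺ in𝒟 {Πℓ} (∈-famWith⁺ {k = ℓ} {[]} P isk refl) (≤⇒≤ᵇ-true {t} (without⊑⇒ P C∈ e))))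
    fin : ∀ M → M ≡ K → ⊥
    fin []      e with () ← trans (cong length e) lK
    fin (C ∷ M) e = proj₂ (without-∈ {T = K} (in-without B∈)) refl
      where B∈ = proj₁ (without-∈ {T = K} (in-without {C} (subst (C ∈_) e (here refl))))

  𝒞f-in : FamilyIn k 𝒞f
  𝒞f-in = FamilyIn-famWith n k K

  𝒟f-in : FamilyIn ℓ 𝒟f
  𝒟f-in = FamilyIn-filter in𝒟 {Πℓ} (FamilyIn-famWith n ℓ [])

  spread-t : NonTrivial t 𝒞f 𝒟f
  spread-t = commonAll< {t = t} 𝒞f 𝒟f [] (s≤s z≤n) none

  nt : NTCross n k ℓ t 𝒞f 𝒟f
  nt = ntCross k ℓ t 𝒞f 𝒟f 𝒞f-in 𝒟f-in cross spread-t

-- Two points are related when the same members of K contain them. For disjoint non-empty blocks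
-- with a non-empty remainder, this is the partition into K and the remainder.
partOf : List (Block n) → Part n
partOf K = Vec.tabulate λ i → Vec.tabulate λ j → all (λ B → not (Vec.lookup B i xor Vec.lookup B j)) K

rel-partOf : ∀ (K : List (Block n)) i j → rel (partOf K) i j ≡ all (λ B → not (Vec.lookup B i xor Vec.lookup B j)) K
rel-partOf K i j = trans (cong (λ v → Vec.lookup v j) (lookup∘tabulate _ i)) (lookup∘tabulate _ j)

xor-≡ : ∀ a b → not (a xor b) ≡ true → a ≡ b
xor-≡ true true h = refl
xor-≡ false false h = refl

≡-xor : ∀ a → not (a xor a) ≡ true
≡-xor true = refl
≡-xor false = refl

related⇒ : ∀ (K : List (Block n)) {i j} → rel (partOf K) i j ≡ true → ∀ {B} → B ∈ K → Vec.lookup B i ≡ Vec.lookup B j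
related⇒ K {i} {j} h B∈ = xor-≡ _ _ (all-∈ (λ B → not (Vec.lookup B i xor Vec.lookup B j)) (trans (sym (rel-partOf K i j)) h) B∈)

⇒related : ∀ (K : List (Block n)) {i j} → (∀ {B} → B ∈ K → Vec.lookup B i ≡ Vec.lookup B j) → rel (partOf K) i j ≡ true
⇒related K {i} {j} h = trans (rel-partOf K i j) (∈-all (λ B → not (Vec.lookup B i xor Vec.lookup B j)) K
  (λ {B} B∈ → trans (cong (λ b → not (Vec.lookup B i xor b)) (sym (h B∈))) (≡-xor (Vec.lookup B i))))

partOf-isPartition : (K : List (Block n)) → IsPartition (partOf K)
partOf-isPartition K = (λ i → ⇒related K (λ _ → refl)) ,
  (λ i j → bool-ext (λ h → ⇒related K (sym ∘ related⇒ K h)) (λ h → ⇒related K (sym ∘ related⇒ K h))) ,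
  (λ i j l a b → ⇒related K (λ B∈ → trans (related⇒ K a B∈) (related⇒ K b B∈)))

remainder : List (Block n) → Block n
remainder K = Vec.tabulate (λ i → not (any (λ B → Vec.lookup B i) K))

module PartOf (K : List (Block n)) (wK : WF K) where
  remainder∌ : ∀ {i} → remainder K ∋ i → ∀ {B} → B ∈ K → ¬ B ∋ i
  remainder∌ {i} h B∈ b = contradiction (trans (sym (trans (sym (lookup∘tabulate _ i)) h)) (cong not (∈-any (λ B → Vec.lookup B i) B∈ b))) (λ ())

  remainder∋ : ∀ {i} → (∀ {B} → B ∈ K → ¬ B ∋ i) → remainder K ∋ i
  remainder∋ {i} h = trans (lookup∘tabulate _ i) (cong not (≡false λ e → let B , B∈ , b = any-∈ (λ B → Vec.lookup B i) K e in h B∈ b))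

  row-in : ∀ {i B} → B ∈ K → B ∋ i → Vec.lookup (partOf K) i ≡ B
  row-in {i} {B} B∈ b = vec-ext λ j → bool-ext (λ h → trans (sym (related⇒ K h B∈)) b)
    (λ b′ → ⇒related K (λ {C} C∈ → bool-ext (λ c → subst (_∋ j) (WF.disj wK B∈ C∈ b c) b′) (λ c → subst (_∋ i) (WF.disj wK B∈ C∈ b′ c) b)))

  row-out : ∀ {i} → remainder K ∋ i → Vec.lookup (partOf K) i ≡ remainder K
  row-out {i} r = vec-ext λ j → bool-ext (λ h → remainder∋ (λ B∈ b → remainder∌ r B∈ (trans (related⇒ K h B∈) b)))
    (λ r′ → ⇒related K (λ B∈ → trans (≡false (remainder∌ r B∈)) (sym (≡false (remainder∌ r′ B∈)))))

  K⊑ : K ⊑ᵇ partOf K ≡ true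
  K⊑ = ∈-all (_∈ᵇ partOf K) K (λ B∈ → let i , b = WF.inh wK B∈ in row⇒∈ᵇ (partOf K) i (row-in B∈ b))

  #blocks-partOf : ∀ {z} → remainder K ∋ z → #blocks (partOf K) ≡ suc (length K)
  #blocks-partOf {z} r = ≤-antisym (Unique-⊆⇒length≤ {ys = remainder K ∷ K} (Unique-blocks (partOf K)) to)
      (Unique-⊆⇒length≤ {xs = remainder K ∷ K} {blocks (partOf K)} (All.tabulate (λ B∈ e → remainder∌ r B∈ (subst (_∋ z) e r)) ∷ WF.uniq wK) from)
    where
    to : ∀ B → B ∈ blocks (partOf K) → B ∈ remainder K ∷ K
    to B B∈ with i , refl ← ∈ᵇ⇒row (partOf K) (∈-blocks⁻ (partOf K) B∈) = go (any (λ B → Vec.lookup B i) K) refl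
      where
      go : ∀ b → any (λ B → Vec.lookup B i) K ≡ b → Vec.lookup (partOf K) i ∈ remainder K ∷ K
      go true  e with C , C∈ , c ← any-∈ (λ B → Vec.lookup B i) K e = there (subst (_∈ K) (sym (row-in C∈ c)) C∈)
      go false e = here (row-out (trans (lookup∘tabulate _ i) (cong not e)))
    from : ∀ B → B ∈ remainder K ∷ K → B ∈ blocks (partOf K)
    from B (here refl) = ∈-blocks⁺ (partOf K) (row⇒∈ᵇ (partOf K) z (row-out r))
    from B (there B∈)  = ∈-blocks⁺ (partOf K) (all-∈ (_∈ᵇ partOf K) K⊑ B∈)

Unique-++ˡ : ∀ {X : Set} (xs {ys} : List X) → Unique (xs ++ ys) → Unique xs
Unique-++ˡ []       _       = []
Unique-++ˡ (x ∷ xs) (a ∷ u) = All.tabulate (λ y∈ → All.lookup a (∈-++⁺ˡ y∈)) ∷ Unique-++ˡ xs u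

Unique-++ʳ : ∀ {X : Set} (xs {ys} : List X) → Unique (xs ++ ys) → Unique ys
Unique-++ʳ []       u       = u
Unique-++ʳ (x ∷ xs) (_ ∷ u) = Unique-++ʳ xs u

Unique-++-∉ : ∀ {X : Set} (xs {ys} : List X) → Unique (xs ++ ys) → ∀ {y} → y ∈ ys → ¬ y ∈ xs
Unique-++-∉ (x ∷ xs) (a ∷ u) y∈ (here refl) = All.lookup a (∈-++⁺ʳ xs y∈) refl
Unique-++-∉ (x ∷ xs) (a ∷ u) y∈ (there h)   = Unique-++-∉ xs u y∈ h

-- The pair 𝒜(Z, Z ∪ L) and ℱ[Z] together with one of the exceptional members of ℬ(Z, Z ∪ L).
module Opt𝒜 {n} (t′ m i c₁ c₂ : ℕ) (en₁ : n ≡ c₁ + suc (suc t′ + suc (suc m))) (en₂ : n ≡ c₂ + suc (suc t′ + suc i))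
    (q′<q : A c₂ i < A c₂ (suc i)) (1≤c₂ : 1 ≤ c₂) (Z₀ : Block n) (Z′ L : List (Block n))
    (sM : Singles (Z₀ ∷ Z′ ++ L)) (lZ : length Z′ ≡ t′) (lL : length L ≡ 2 + i) where
  private
    t k ℓ : ℕ
    t = suc t′
    k = suc (t + suc (suc m))
    ℓ = suc (t + suc i)
    Z = Z₀ ∷ Z′
    K = Z′ ++ L
    wM = Singles-WF sM
    inK : ∀ {B} → B ∈ K → B ∈ Z₀ ∷ K
    inK = there
    sub : ∀ {T} → Unique T → (∀ {B} → B ∈ T → B ∈ Z₀ ∷ K) → Singles T
    sub u h = u , λ B B∈ → proj₂ sM B (h B∈)
    uK : Unique K
    uK = AllPairs.tail (proj₁ sM)
    uZ′ : Unique Z′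
    uZ′ = Unique-++ˡ Z′ uK
    uL : Unique L
    uL = Unique-++ʳ Z′ uK
    uZ : Unique Z
    uZ = Unique-++ˡ Z (proj₁ sM)
    Z⊆ : ∀ {B} → B ∈ Z → B ∈ Z₀ ∷ K
    Z⊆ (here e)  = here e
    Z⊆ (there h) = there (∈-++⁺ˡ h)
    L⊆ : ∀ {B} → B ∈ L → B ∈ Z₀ ∷ K
    L⊆ h = there (∈-++⁺ʳ Z′ h)
    uB∷Z : ∀ {B} → B ∈ L → Unique (B ∷ Z)
    uB∷Z B∈ = ∉⇒All≢ (Unique-++-∉ Z (proj₁ sM) B∈) ∷ uZ

  in𝒜 : Part n → Bool
  in𝒜 P = any (_∈ᵇ P) L
  𝒜f ℬf : Family n
  𝒜f = filterᵇ in𝒜 (famWith n k Z)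
  P₁ : Part n
  P₁ = partOf K
  -- `P₁` is present because it misses `Z₀`; otherwise all t blocks of `Z` would be common to both
  -- families.
  ℬf = P₁ ∷ famWith n ℓ Z

  length-𝒜f : (2 + i) * A c₁ (suc m) ≤ length 𝒜f + tri (2 + i) * A c₁ m
  length-𝒜f = subst (λ l → l * A c₁ (suc m) ≤ length 𝒜f + tri l * A c₁ m) lL
      (bonferroni (λ B P → B ∈ᵇ P) L (A c₁ (suc m)) (A c₁ m) (famWith n k Z) lo (pairs (λ h → h) uL))
    where
    lo : ∀ B → B ∈ L → A c₁ (suc m) ≤ count (λ P → B ∈ᵇ P) (famWith n k Z)
    lo B B∈ = ≤-trans (≤-reflexive (sym (famWith-singletons c₁ (B ∷ Z) (suc m) (Singles-WF s) (usize-Singles (B ∷ Z) (proj₂ s)) (cong (λ l → suc (suc l + suc (suc m))) lZ) en₁)))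
        (famWith-≤count {k = k} {B ∷ Z} {Z} (λ P → B ∈ᵇ P) (λ P h → let a , b = ∧-true {B ∈ᵇ P} h in b , a))
      where s = sub (uB∷Z B∈) λ { (here refl) → L⊆ B∈ ; (there h) → Z⊆ h }
    pairs : ∀ {M} → (∀ {B} → B ∈ M → B ∈ L) → Unique M → AllPairs (λ B C → count (λ P → (B ∈ᵇ P) ∧ (C ∈ᵇ P)) (famWith n k Z) ≤ A c₁ m) M
    pairs h [] = []
    pairs h (a ∷ u) = All.tabulate (λ C∈ → bnd (h (here refl)) (h (there C∈)) (All.lookup a C∈)) ∷ pairs (h ∘ there) u
      where
      bnd : ∀ {B C} → B ∈ L → C ∈ L → ¬ B ≡ C → count (λ P → (B ∈ᵇ P) ∧ (C ∈ᵇ P)) (famWith n k Z) ≤ A c₁ m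
      bnd {B} {C} B∈ C∈ ne = ≤-trans (count-mono (famWith n k Z) (λ P P∈ h → let a , b = ∧-true {B ∈ᵇ P} h in ∧-intro a (∧-intro b (proj₂ (∈-famWith⁻ {k = k} {Z} P P∈)))))
        (Count.count-A (famWith n k Z) (FamilyIn-famWith n k Z) c₁ (B ∷ C ∷ Z) m
          ((ne ∷ ∉⇒All≢ (Unique-++-∉ Z (proj₁ sM) B∈)) ∷ uB∷Z C∈)
          (trans (cong (λ l → suc (suc (suc l + suc m))) lZ) (cong (2 +_) (sym (+-suc t′ (suc m))))) en₁)

  length-ℬf : A c₂ (suc i) ≤ length ℬf
  length-ℬf = ≤-trans (≤-reflexive (sym (famWith-singletons c₂ Z (suc i) (Singles-WF sZ) (usize-Singles Z (proj₂ sZ))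
      (trans (cong (λ l → suc l + suc (suc i)) lZ) (cong suc (+-suc t′ (suc i)))) en₂))) (n≤1+n _)
    where sZ = sub uZ Z⊆

  private
    wK : WF K
    wK = Singles-WF (sub uK inK)
    module PK = PartOf K wK
    lK : length K ≡ t + suc i
    lK = trans (length-++ Z′) (trans (cong₂ _+_ lZ lL) (+-suc t′ (suc i)))
    z = proj₁ (single-inh Z₀ (proj₂ sM Z₀ (here refl)))
    Z₀z : Z₀ ∋ z
    Z₀z = proj₂ (single-inh Z₀ (proj₂ sM Z₀ (here refl)))
    r∋z : remainder K ∋ z
    r∋z = PK.remainder∋ (λ {B} B∈ Bz → go B∈ (WF.disj wM (here refl) (there B∈) Z₀z Bz))
      where go : ∀ {B} → B ∈ K → Z₀ ≡ B → ⊥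
            go B∈ e = All.lookup (AllPairs.head (proj₁ sM)) B∈ e
    isk : IsKPartition ℓ P₁
    isk = partOf-isPartition K , trans (PK.#blocks-partOf r∋z) (cong suc lK)
    -- Otherwise the ℓ singletons Z₀ ∷ K would be all the blocks of `P₁`, while c₂ ≥ 1 points remain
    -- uncovered: `S c₂ 0` is 0.
    Z₀∉ : ¬ Z₀ ∈ᵇ P₁ ≡ true
    Z₀∉ h = 1≰0 (≤-trans (count-pos (λ P → (#blocks P ≡ᵇ ℓ) ∧ ((Z₀ ∷ K) ⊑ᵇ P)) (enum-complete n P₁ (proj₁ isk))
        (∧-intro (trans (cong (_≡ᵇ ℓ) (proj₂ isk)) (≡ᵇ-refl ℓ)) (∧-intro h PK.K⊑)))
        (≤-reflexive (trans (count-∑ _ (enum n)) (trans (cnt-exact n ℓ (Z₀ ∷ K) c₂ 0 wM eu (trans (+-identityʳ _) (cong suc lK))) (S0 c₂ 1≤c₂)))))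
      where
      S0 : ∀ c → 1 ≤ c → S c 0 ≡ 0
      S0 (suc c) _ = refl
      eu : usize (Z₀ ∷ K) + c₂ ≡ n
      eu = trans (cong (_+ c₂) (trans (usize-Singles (Z₀ ∷ K) (proj₂ sM)) (cong suc lK))) (trans (+-comm ℓ c₂) (sym en₂))

  cross : CrossInt t 𝒜f ℬf
  cross P Q P∈ Q∈ = go Q∈
    where
    P∈′ = proj₁ (∈-filterᵇ⁻ in𝒜 {famWith n k Z} P∈)
    hit = any-∈ (_∈ᵇ P) L (proj₂ (∈-filterᵇ⁻ in𝒜 {famWith n k Z} P∈))
    B = proj₁ hit
    ZP : Z ⊑ᵇ P ≡ true
    ZP = proj₂ (∈-famWith⁻ {k = k} {Z} P P∈′)
    petal : ∀ {C} → C ∈ B ∷ Z′ → C ∈ᵇ P ≡ true × C ∈ᵇ P₁ ≡ true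
    petal (here refl) = proj₂ (proj₂ hit) , all-∈ (_∈ᵇ P₁) PK.K⊑ (∈-++⁺ʳ Z′ (proj₁ (proj₂ hit)))
    petal (there C∈)  = all-∈ (_∈ᵇ P) {Z} ZP (there C∈) , all-∈ (_∈ᵇ P₁) PK.K⊑ (∈-++⁺ˡ C∈)
    go : ∀ {Q} → Q ∈ ℬf → t ≤ #common P Q
    go (here refl)    = ≤-trans (≤-reflexive (cong suc (sym lZ))) (common≥ P P₁ (B ∷ Z′)
      (∉⇒All≢ (Unique-++-∉ Z′ uK (proj₁ (proj₂ hit))) ∷ uZ′) petal)
    go {Q} (there Q∈) = ≤-trans (≤-reflexive (cong suc (sym lZ))) (common≥ P Q Z uZ λ C∈ →
      all-∈ (_∈ᵇ P) ZP C∈ , all-∈ (_∈ᵇ Q) (proj₂ (∈-famWith⁻ {k = ℓ} {Z} Q Q∈)) C∈)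
  com : ∀ B → (∀ P → P ∈ 𝒜f → B ∈ᵇ P ≡ true) → (∀ P → P ∈ ℬf → B ∈ᵇ P ≡ true) → B ∈ Z′
  com B _ h = go (common-famWith {t′ = t′} en₂ q′<q (sub uZ Z⊆) (cong suc lZ) B (λ P P∈ → h P (there P∈)))
    where go : B ∈ Z → B ∈ Z′
          go (here e)   = ⊥-elim (Z₀∉ (subst (λ C → C ∈ᵇ P₁ ≡ true) e (h P₁ (here refl))))
          go (there B∈) = B∈

  𝒜f-in : FamilyIn k 𝒜f
  𝒜f-in = FamilyIn-filter in𝒜 {famWith n k Z} (FamilyIn-famWith n k Z)

  ℬf-in : FamilyIn ℓ ℬf
  ℬf-in = All.tabulate (λ {P} P∈ e → Z₀∉ (subst (λ Q → Z₀ ∈ᵇ Q ≡ true) (sym e) (proj₁ (∧-true {Z₀ ∈ᵇ P} (proj₂ (∈-famWith⁻ {k = ℓ} {Z} P P∈))))))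
        ∷ Unique-famWith n ℓ Z , isk ∷ proj₂ (FamilyIn-famWith n ℓ Z)

  spread-t : NonTrivial t 𝒜f ℬf
  spread-t = commonAll< {t = t} 𝒜f ℬf Z′ (≤-reflexive (cong suc lZ)) com

  nt : NTCross n k ℓ t 𝒜f ℬf
  nt = ntCross k ℓ t 𝒜f ℬf 𝒜f-in ℬf-in cross spread-t

-- Relabelling singletons to standard position.

module Relabel {n} (σ : Permutation′ n) where

  φ : Block n → Block n
  φ B = Vec.tabulate (λ i → Vec.lookup B (σ ⟨$⟩ʳ i))

  lookup-φ : ∀ B i → Vec.lookup (φ B) i ≡ Vec.lookup B (σ ⟨$⟩ʳ i)
  lookup-φ B i = lookup∘tabulate _ i

  φ-injective : ∀ {B C} → φ B ≡ φ C → B ≡ C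
  φ-injective {B} {C} e = vec-ext λ j → trans (at B j) (trans (cong (λ D → Vec.lookup D (σ ⟨$⟩ˡ j)) e) (sym (at C j)))
    where at : ∀ B j → Vec.lookup B j ≡ Vec.lookup (φ B) (σ ⟨$⟩ˡ j)
          at B j = sym (trans (lookup-φ B (σ ⟨$⟩ˡ j)) (cong (Vec.lookup B) (inverseʳ σ)))

  row-act : ∀ (P : Part n) i → Vec.lookup (act σ P) i ≡ φ (Vec.lookup P (σ ⟨$⟩ʳ i))
  row-act P i = lookup∘tabulate _ i

  ∈-act : ∀ (P : Part n) B → φ B ∈ᵇ act σ P ≡ B ∈ᵇ P
  ∈-act P B = bool-ext to from
    where
    to : φ B ∈ᵇ act σ P ≡ true → B ∈ᵇ P ≡ true
    to h with i , e ← ∈ᵇ⇒row (act σ P) h = row⇒∈ᵇ P (σ ⟨$⟩ʳ i) (φ-injective (trans (sym (row-act P i)) e))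
    from : B ∈ᵇ P ≡ true → φ B ∈ᵇ act σ P ≡ true
    from h with j , e ← ∈ᵇ⇒row P h = row⇒∈ᵇ (act σ P) (σ ⟨$⟩ˡ j)
      (trans (row-act P (σ ⟨$⟩ˡ j)) (cong φ (trans (cong (Vec.lookup P) (inverseʳ σ)) e)))

  rel-act : ∀ P i j → rel (act σ P) i j ≡ rel P (σ ⟨$⟩ʳ i) (σ ⟨$⟩ʳ j)
  rel-act P i j = trans (cong (λ v → Vec.lookup v j) (row-act P i)) (lookup-φ (Vec.lookup P (σ ⟨$⟩ʳ i)) j)

  act-isPartition : ∀ P → IsPartition P → IsPartition (act σ P)
  act-isPartition P (rf , sm , tr) = (λ i → trans (rel-act P i i) (rf _)) ,
    (λ i j → trans (rel-act P i j) (trans (sm _ _) (sym (rel-act P j i)))) ,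
    (λ i j l a b → trans (rel-act P i l) (tr _ _ _ (trans (sym (rel-act P i j)) a) (trans (sym (rel-act P j l)) b)))

  unact-isPartition : ∀ P → IsPartition (act σ P) → IsPartition P
  unact-isPartition P (rf , sm , tr) = (λ i → trans (at i i) (rf _)) , (λ i j → trans (at i j) (trans (sm _ _) (sym (at j i)))) ,
      (λ i j l a b → trans (at i l) (tr _ _ _ (trans (sym (at i j)) a) (trans (sym (at j l)) b)))
    where at : ∀ i j → rel P i j ≡ rel (act σ P) (σ ⟨$⟩ˡ i) (σ ⟨$⟩ˡ j)
          at i j = sym (trans (rel-act P _ _) (cong₂ (rel P) (inverseʳ σ) (inverseʳ σ)))

  #blocks-act : ∀ P → #blocks (act σ P) ≡ #blocks P
  #blocks-act P = ≤-antisym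
      (≤-trans (Unique-⊆⇒length≤ {ys = map φ (blocks P)} (Unique-blocks (act σ P)) to) (≤-reflexive (length-map φ (blocks P))))
      (≤-trans (≤-reflexive (sym (length-map φ (blocks P)))) (Unique-⊆⇒length≤ {ys = blocks (act σ P)} (Uniqueₚ.map⁺ φ-injective (Unique-blocks P)) from))
    where
    to : ∀ C → C ∈ blocks (act σ P) → C ∈ map φ (blocks P)
    to C C∈ with i , refl ← ∈ᵇ⇒row (act σ P) (∈-blocks⁻ (act σ P) C∈) =
      subst (_∈ map φ (blocks P)) (sym (row-act P i)) (∈-map⁺ φ (∈-blocks⁺ P (row⇒∈ᵇ P (σ ⟨$⟩ʳ i) refl)))
    from : ∀ C → C ∈ map φ (blocks P) → C ∈ blocks (act σ P)
    from C C∈ with B , B∈ , refl ← ∈-map⁻ φ C∈ = ∈-blocks⁺ (act σ P) (trans (∈-act P B) (∈-blocks⁻ P B∈))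

  act-k : ∀ {k} P → IsKPartition k P → IsKPartition k (act σ P)
  act-k P (a , b) = act-isPartition P a , trans (#blocks-act P) b

  unact-k : ∀ {k} P → IsKPartition k (act σ P) → IsKPartition k P
  unact-k P (a , b) = unact-isPartition P a , trans (sym (#blocks-act P)) b

  count-act : ∀ P T → count (_∈ᵇ act σ P) (map φ T) ≡ count (_∈ᵇ P) T
  count-act P T = trans (count-map (_∈ᵇ act σ P) φ T) (count-cong T (λ B _ → ∈-act P B))

  ⊑-act : ∀ P T → map φ T ⊑ᵇ act σ P ≡ T ⊑ᵇ P
  ⊑-act P []      = refl
  ⊑-act P (B ∷ T) = cong₂ _∧_ (∈-act P B) (⊑-act P T)

range : ℕ → ℕ → List ℕ
range s zero    = []
range s (suc m) = s ∷ range (suc s) m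

upTo≡range : ∀ m → upTo m ≡ range 0 m
upTo≡range m = go (λ i → i) 0 m (λ i → refl)
  where
  go : ∀ f s m → (∀ i → f i ≡ s + i) → applyUpTo f m ≡ range s m
  go f s zero    h = refl
  go f s (suc m) h = cong₂ _∷_ (trans (h 0) (+-identityʳ s)) (go (f ∘ suc) (suc s) m (λ i → trans (h (suc i)) (+-suc s i)))

[[]]≡ : ∀ m → [[_]] {n} m ≡ map single (range 0 m)
[[]]≡ m = cong (map single) (upTo≡range m)

≡ᵇ-sym-true : ∀ {a b} → a ≡ b → (a ≡ᵇ b) ≡ true
≡ᵇ-sym-true {a} refl = ≡ᵇ-refl a

single-∋ : ∀ j (i : Fin n) → toℕ i ≡ j → single j ∋ i
single-∋ j i e = trans (lookup∘tabulate _ i) (≡ᵇ-sym-true e)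

∋-single : ∀ j (i : Fin n) → single j ∋ i → toℕ i ≡ j
∋-single j i h = ≡ᵇ-true (trans (sym (lookup∘tabulate (λ i → toℕ i ≡ᵇ j) i)) h)

size-single : ∀ n j → j < n → size (single {n} j) ≡ 1
size-single (suc n) zero    _       = cong suc (none n)
  where none : ∀ n → size (Vec.tabulate {n = n} (λ _ → false)) ≡ 0
        none zero    = refl
        none (suc n) = none n
size-single (suc n) (suc j) (s≤s h) = size-single n j h

∈-range : ∀ s m {x} → x ∈ range s m → s ≤ x × x < s + m
∈-range s (suc m) (here refl) = ≤-refl , ≤-trans (s≤s (m≤m+n s m)) (≤-reflexive (sym (+-suc s m)))
∈-range s (suc m) (there h) with a , b ← ∈-range (suc s) m h = ≤-trans (n≤1+n s) a , ≤-trans b (≤-reflexive (sym (+-suc s m)))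

singles-range : ∀ s m → s + m ≤ n → Singles (map (single {n}) (range s m))
singles-range {n} s m le = uniq s m le , λ B B∈ → let j , j∈ , e = ∈-map⁻ single B∈ in
    trans (cong size e) (size-single n j (≤-trans (proj₂ (∈-range s m j∈)) le))
  where
  uniq : ∀ s m → s + m ≤ n → Unique (map (single {n}) (range s m))
  uniq s zero    le = []
  uniq s (suc m) le = All.tabulate ne ∷ uniq (suc s) m (≤-trans (≤-reflexive (sym (+-suc s m))) le)
    where
    s<n : s < n
    s<n = ≤-trans (≤-trans (s≤s (m≤m+n s m)) (≤-reflexive (sym (+-suc s m)))) le
    ne : ∀ {B} → B ∈ map single (range (suc s) m) → ¬ single s ≡ B
    ne B∈ e with j , j∈ , e′ ← ∈-map⁻ single B∈ = <-irrefl {s}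
      (trans (sym (toℕ-fromℕ< s<n)) (∋-single j (fromℕ< s<n) (subst (_∋ fromℕ< s<n) (trans e e′) (single-∋ s (fromℕ< s<n) (toℕ-fromℕ< s<n)))))
      (proj₁ (∈-range (suc s) m j∈))

[[]]-singles : ∀ m → m ≤ n → Singles ([[_]] {n} m)
[[]]-singles {n} m le = subst Singles (sym ([[]]≡ m)) (singles-range 0 m le)

length-[[]] : ∀ m → length ([[_]] {n} m) ≡ m
length-[[]] m = trans (length-map single (upTo m)) (length-upTo m)

size1-∋ : (B : Block n) → size B ≡ 1 → ∀ i j → B ∋ i → B ∋ j → i ≡ j
size1-∋ (true ∷ B)  b zero    zero    p q = refl
size1-∋ (true ∷ B)  b zero    (suc j) p q = ⊥-elim (zeros∌ {i = j} (subst (_∋ j) (size0⇒zeros B (suc-injective b)) q))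
size1-∋ (true ∷ B)  b (suc i) j       p q = ⊥-elim (zeros∌ {i = i} (subst (_∋ i) (size0⇒zeros B (suc-injective b)) p))
size1-∋ (false ∷ B) b (suc i) (suc j) p q = cong suc (size1-∋ B b i j p q)

swap-at : ∀ (a b : Fin n) → Perm.transpose a b ⟨$⟩ʳ a ≡ b
swap-at a b with a ≟ᶠ a
... | yes _ = refl
... | no ne = ⊥-elim (ne refl)

swap-off : ∀ (a b c : Fin n) → ¬ c ≡ a → ¬ c ≡ b → Perm.transpose a b ⟨$⟩ʳ c ≡ c
swap-off a b c ca cb with c ≟ᶠ a
... | yes e = ⊥-elim (ca e)
... | no _ with c ≟ᶠ b
...   | yes e = ⊥-elim (cb e)
...   | no _  = refl

perm-injective : ∀ (σ : Permutation′ n) {i j} → σ ⟨$⟩ʳ i ≡ σ ⟨$⟩ʳ j → i ≡ j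
perm-injective σ {i} {j} e = trans (sym (inverseˡ σ)) (trans (cong (σ ⟨$⟩ˡ_) e) (inverseˡ σ))

-- Distinct singletons can be moved to {s}, {s + 1}, … by transpositions fixing what was placed earlier.
place : ∀ (M : List (Block n)) s → Singles M → s + length M ≤ n → (σ : Permutation′ n) →
        (∀ i → toℕ i < s → ∀ {B} → B ∈ M → ¬ B ∋ σ ⟨$⟩ʳ i) →
        ∃ λ σ′ → (∀ i → toℕ i < s → σ′ ⟨$⟩ʳ i ≡ σ ⟨$⟩ʳ i) × map (Relabel.φ σ′) M ≡ map single (range s (length M))
place [] s sM le σ av = σ , (λ i _ → refl) , refl
place {n} (B ∷ M) s (a ∷ u , sz) le σ av = σ′ , (λ i lt → trans (keep i (m<n⇒m<1+n lt)) (keep₁ i lt)) , cong₂ _∷_ φB (proj₂ (proj₂ rec))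
  where
  s<n : s < n
  s<n = ≤-trans (≤-trans (s≤s (m≤m+n s (length M))) (≤-reflexive (sym (+-suc s (length M))))) le
  iₛ : Fin n
  iₛ = fromℕ< s<n
  e : Fin n
  e = proj₁ (single-inh B (sz B (here refl)))
  Be : B ∋ e
  Be = proj₂ (single-inh B (sz B (here refl)))
  σ₁ : Permutation′ n
  σ₁ = σ ∘ₚ Perm.transpose (σ ⟨$⟩ʳ iₛ) e
  keep₁ : ∀ i → toℕ i < s → σ₁ ⟨$⟩ʳ i ≡ σ ⟨$⟩ʳ i
  keep₁ i lt = swap-off (σ ⟨$⟩ʳ iₛ) e (σ ⟨$⟩ʳ i)
    (λ q → <-irrefl (trans (cong toℕ (perm-injective σ q)) (toℕ-fromℕ< s<n)) lt) (λ q → av i lt (here refl) (subst (B ∋_) (sym q) Be))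
  at₁ : σ₁ ⟨$⟩ʳ iₛ ≡ e
  at₁ = swap-at (σ ⟨$⟩ʳ iₛ) e
  av₁ : ∀ i → toℕ i < suc s → ∀ {C} → C ∈ M → ¬ C ∋ σ₁ ⟨$⟩ʳ i
  av₁ i (s≤s lt) {C} C∈ c with m≤n⇒m<n∨m≡n lt
  ... | inj₁ lt′ = av i lt′ (there C∈) (subst (C ∋_) (keep₁ i lt′) c)
  ... | inj₂ eq  = All.lookup a C∈ (single-unique B C (sz B (here refl)) (sz C (there C∈)) e Be
                     (subst (C ∋_) (trans (cong (σ₁ ⟨$⟩ʳ_) (toℕ-injective (trans eq (sym (toℕ-fromℕ< s<n))))) at₁) c))
  rec = place M (suc s) (u , λ C C∈ → sz C (there C∈)) (≤-trans (≤-reflexive (sym (+-suc s (length M)))) le) σ₁ av₁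
  σ′ = proj₁ rec
  keep : ∀ i → toℕ i < suc s → σ′ ⟨$⟩ʳ i ≡ σ₁ ⟨$⟩ʳ i
  keep = proj₁ (proj₂ rec)
  at : σ′ ⟨$⟩ʳ iₛ ≡ e
  at = trans (keep iₛ (s≤s (≤-reflexive (toℕ-fromℕ< s<n)))) at₁
  φB : Relabel.φ σ′ B ≡ single s
  φB = vec-ext λ i → bool-ext
    (λ h → single-∋ s i (trans (cong toℕ (perm-injective σ′ (trans (size1-∋ B (sz B (here refl)) _ e (trans (sym (Relabel.lookup-φ σ′ B i)) h) Be) (sym at)))) (toℕ-fromℕ< s<n)))
    (λ h → trans (Relabel.lookup-φ σ′ B i) (subst (B ∋_) (sym (trans (cong (σ′ ⟨$⟩ʳ_) (toℕ-injective (trans (∋-single s i h) (sym (toℕ-fromℕ< s<n))))) at)) Be))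

standardise : ∀ (M : List (Block n)) → Singles M → ∃ λ (σ : Permutation′ n) → map (Relabel.φ σ) M ≡ [[ length M ]]
standardise {n} M sM with σ , _ , e ← place M 0 sM (≤-trans (≤-reflexive (sym (usize-Singles M (proj₂ sM)))) (usize≤ n M (Singles-WF sM))) Perm.id (λ _ ())
  = σ , trans e (sym ([[]]≡ (length M)))

-- `standardise` keeps the order of the list, so one permutation handles both the kernel and the
-- whole flower.
[[]]-prefix : ∀ (f : Block n → Block n) Z L → map f (Z ++ L) ≡ [[ length (Z ++ L) ]] → map f Z ≡ [[ length Z ]]
[[]]-prefix f Z L e = trans (go Z 0 (trans e ([[]]≡ (length (Z ++ L))))) (sym ([[]]≡ (length Z)))
  where
  go : ∀ Z s → map f (Z ++ L) ≡ map single (range s (length (Z ++ L))) → map f Z ≡ map single (range s (length Z))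
  go []      s e = refl
  go (B ∷ Z) s e with a , b ← ∷-injective e = cong₂ _∷_ a (go Z (suc s) b)

-- Saturation, and from shapes to isomorphism.

common-sym : (P Q : Part n) → #common P Q ≡ #common Q P
common-sym {n} P Q = count-cong (allSubsets n) (λ B _ → bool-ext
  (λ h → let a , b = ∧-true {B ∈ᵇ P} h in ∧-intro b a) (λ h → let a , b = ∧-true {B ∈ᵇ Q} h in ∧-intro b a))

crossInt⇒Cross : ∀ {t} {G H : Family n} → CrossInt t G H → Cross t G H
crossInt⇒Cross x P Q P∈ Q∈ = ≤-trans (x P Q P∈ Q∈) (≤-reflexive (common-blocks P Q))

NTCross-swap : ∀ {k ℓ t} {G H : Family n} → NTCross n k ℓ t G H → NTCross n ℓ k t H G
NTCross-swap {n} {G = G} {H} (a , b , x , nt) = b , a , (λ Q P Q∈ P∈ → ≤-trans (x P Q P∈ Q∈) (≤-reflexive (common-sym P Q))) ,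
  ≤-trans (s≤s (count-mono (allSubsets n) (λ B _ h → let e , f = ∧-true {nonempty B} h ; g , k = ∧-true {all (λ P → B ∈ᵇ P) H} f in ∧-intro e (∧-intro k g)))) nt

∈-part? : (P : Part n) (F : Family n) → P ∈ F ⊎ ¬ P ∈ F
∈-part? P [] = inj₂ λ ()
∈-part? P (Q ∷ F) with ≡-dec (≡-dec _≟ᵇ_) P Q
... | yes e = inj₁ (here e)
... | no ne with ∈-part? P F
...   | inj₁ h = inj₁ (there h)
...   | inj₂ h = inj₂ λ { (here e) → ne e ; (there h′) → h h′ }

Saturated : ℕ → ℕ → Family n → Family n → Set
Saturated k t G H = ∀ P → IsKPartition k P → (∀ Q → Q ∈ H → t ≤ #common P Q) → P ∈ G

-- Adding a compatible partition keeps the pair crossing and can only remove common blocks, so it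
-- would enlarge the product. This turns the one-sided inclusions in `KernelShape` and `FlowerShape`
-- into equalities.
saturated : ∀ {k ℓ t} {G H : Family n} → NTCross n k ℓ t G H → (∀ G′ → NTCross n k ℓ t G′ H → length G′ * length H ≤ length G * length H) →
            1 ≤ length H → Saturated k t G H
saturated {n} {k} {ℓ} {t} {G} {H} ((uG , aG) , fH , x , nt) mx pos P isk h with ∈-part? P G
... | inj₁ P∈ = P∈
... | inj₂ P∉ = contradiction (mx (P ∷ G) ((∉⇒All≢ P∉ ∷ uG , isk ∷ aG) , fH ,
      (λ { P′ Q (here refl) Q∈ → h Q Q∈ ; P′ Q (there P′∈) Q∈ → x P′ Q P′∈ Q∈ }) ,
      ≤-trans (s≤s (count-mono (allSubsets n) shrink)) nt)) (<⇒≱ (+-monoˡ-≤ (length G * length H) pos))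
  where
  shrink : ∀ B → B ∈ allSubsets n → nonempty B ∧ all (λ P → B ∈ᵇ P) (P ∷ G) ∧ all (λ P → B ∈ᵇ P) H ≡ true →
           nonempty B ∧ all (λ P → B ∈ᵇ P) G ∧ all (λ P → B ∈ᵇ P) H ≡ true
  shrink B _ e with a , f ← ∧-true {nonempty B} e with g , c ← ∧-true {all (λ P → B ∈ᵇ P) (P ∷ G)} f =
    ∧-intro a (∧-intro (proj₂ (∧-true {B ∈ᵇ P} g)) c)

common-kernel : ∀ (K : List (Block n)) P Q → Unique K → K ⊑ᵇ P ≡ true → count (_∈ᵇ Q) K ≤ #common P Q
common-kernel K P Q u h = common≥ P Q (filterᵇ (_∈ᵇ Q) K) (Unique-filterᵇ (_∈ᵇ Q) u)
  (λ B∈ → let a , b = ∈-filterᵇ⁻ (_∈ᵇ Q) {K} B∈ in all-∈ (_∈ᵇ P) h a , b)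

IsoPair-swap : ∀ {F₁ F₂ : Family n} {G₁ G₂} → IsoPair F₁ F₂ G₁ G₂ → IsoPair F₂ F₁ G₂ G₁
IsoPair-swap (σ , a , b) = σ , b , a

map-φ-all : ∀ (σ : Permutation′ n) P T → T ⊑ᵇ P ≡ true → All (λ B → B ∈ᵇ act σ P ≡ true) (map (Relabel.φ σ) T)
map-φ-all σ P T h = All.tabulate (λ C∈ → all-∈ (_∈ᵇ act σ P) {map (Relabel.φ σ) T} (trans (Relabel.⊑-act σ P T) h) C∈)

all-map-φ : ∀ (σ : Permutation′ n) P T → All (λ B → B ∈ᵇ act σ P ≡ true) (map (Relabel.φ σ) T) → T ⊑ᵇ P ≡ true
all-map-φ σ P T h = trans (sym (Relabel.⊑-act σ P T)) (∈-all (_∈ᵇ act σ P) (map (Relabel.φ σ) T) (All.lookup h))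

kernel-iso : ∀ {k ℓ t} {G H : Family n} → FamilyIn k G → FamilyIn ℓ H → Saturated k t G H → Saturated ℓ t H G → KernelShape t G H →
             IsoPair G H (𝒞std n k t) (𝒟std n ℓ t)
kernel-iso {n} {k} {ℓ} {t} {G} {H} FG FH satG satH (K , uK , lK , sK , cG , cH) with standardise K (uK , sK)
... | σ , e = σ , (λ P → mk⇔ (toG P) (fromG P)) , (λ Q → mk⇔ (toH Q) (fromH Q))
  where
  open Relabel σ
  eK : map φ K ≡ [[ t + 1 ]]
  eK = trans e (cong (λ m → [[ m ]]) (trans lK (+-comm 1 t)))
  toG : ∀ P → P ∈ G → 𝒞 k [[ t + 1 ]] (act σ P)
  toG P P∈ = act-k P (All.lookup (proj₂ FG) P∈) , subst (All _) eK (map-φ-all σ P K (cG P P∈))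
  fromG : ∀ P → 𝒞 k [[ t + 1 ]] (act σ P) → P ∈ G
  fromG P (isk , a) = satG P (unact-k P isk) (λ Q Q∈ → ≤-trans (cH Q Q∈) (common-kernel K P Q uK (all-map-φ σ P K (subst (All _) (sym eK) a))))
  toH : ∀ Q → Q ∈ H → 𝒟 ℓ t [[ t + 1 ]] (act σ Q)
  toH Q Q∈ = act-k Q (All.lookup (proj₂ FH) Q∈) , subst (λ M → t ≤ count (_∈ᵇ act σ Q) M) eK (≤-trans (cH Q Q∈) (≤-reflexive (sym (count-act Q K))))
  fromH : ∀ Q → 𝒟 ℓ t [[ t + 1 ]] (act σ Q) → Q ∈ H
  fromH Q (isk , le) = satH Q (unact-k Q isk) (λ P P∈ → ≤-trans (subst (λ M → t ≤ count (_∈ᵇ act σ Q) M) (sym eK) le)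
    (≤-trans (≤-reflexive (count-act Q K)) (≤-trans (common-kernel K P Q uK (cG P P∈)) (≤-reflexive (common-sym P Q)))))

⋃∋ : ∀ (M : List (Block n)) {i} → ⋃ M ∋ i → ∃ λ B → B ∈ M × B ∋ i
⋃∋ [] {i} h = ⊥-elim (zeros∌ {i = i} h)
⋃∋ (B ∷ M) {i} h with ∨-true (trans (sym (lookup-zipWith _∨_ i B (⋃ M))) h)
... | inj₁ b = B , here refl , b
... | inj₂ m with C , C∈ , c ← ⋃∋ M m = C , there C∈ , c

∋⋃ : ∀ {M : List (Block n)} {B i} → B ∈ M → B ∋ i → ⋃ M ∋ i
∋⋃ {M = B ∷ M} {i = i} (here refl) b = trans (lookup-zipWith _∨_ i B (⋃ M)) (cong (_∨ Vec.lookup (⋃ M) i) b)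
∋⋃ {M = C ∷ M} {i = i} (there B∈)  b = trans (lookup-zipWith _∨_ i C (⋃ M)) (trans (cong (Vec.lookup C i ∨_) (∋⋃ B∈ b)) (∨-zeroʳ (Vec.lookup C i)))

-- The exceptional members of ℬ(ℓ, Z, Z ∪ L): those containing L and all blocks of Z but one.
module Exceptional (Z L : List (Block n)) (sM : Singles (Z ++ L)) where
  private
    M : List (Block n)
    M = Z ++ L
    wM = Singles-WF sM
    uM = proj₁ sM

  enlarged : Block n → Block n
  enlarged B = B ∪ᵇ compl (⋃ M)

  enlarged⁻ : ∀ {B i} → enlarged B ∋ i → B ∋ i ⊎ (∀ {C} → C ∈ M → ¬ C ∋ i)
  enlarged⁻ {B} {i} h with ∨-true (trans (sym (lookup-zipWith _∨_ i B (compl (⋃ M)))) h)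
  ... | inj₁ b = inj₁ b
  ... | inj₂ c = inj₂ λ C∈ b → contradiction (trans (sym c) (trans (lookup-map i not (⋃ M)) (cong not (∋⋃ C∈ b)))) (λ ())

  enlarged⁺ : ∀ {B i} → B ∋ i → enlarged B ∋ i
  enlarged⁺ {B} {i} b = trans (lookup-zipWith _∨_ i B (compl (⋃ M))) (cong (_∨ Vec.lookup (compl (⋃ M)) i) b)

  enlarged⁺′ : ∀ {B i} → (∀ {C} → C ∈ M → ¬ C ∋ i) → enlarged B ∋ i
  enlarged⁺′ {B} {i} h = trans (lookup-zipWith _∨_ i B (compl (⋃ M))) (trans (cong (Vec.lookup B i ∨_)
      (trans (lookup-map i not (⋃ M)) (cong not (≡false λ e → let C , C∈ , c = ⋃∋ M e in h C∈ c)))) (∨-zeroʳ (Vec.lookup B i)))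

  -- Q contains M without B₀, which is all but one of its blocks. Its last block D is therefore the
  -- complement of their union: B₀ together with every point outside ∪M.
  missing-one : ∀ Q → IsKPartition (length M) Q → L ⊑ᵇ Q ≡ true → length Z ≤ suc (count (_∈ᵇ Q) Z) →
                ∀ B₀ → B₀ ∈ Z → B₀ ∈ᵇ Q ≡ false → HasBlocks Q (enlarged B₀ ∷ remove B₀ M)
  missing-one Q (isQ , #Q) LQ le B₀ B₀∈ B₀∉Q = isQ , λ C → mk⇔ (to C) (from C)
    where
    K = remove B₀ M
    K⁻ : ∀ {C} → C ∈ K → C ∈ M × ¬ C ≡ B₀
    K⁻ = without-∈ {T = M}
    KQ : ∀ {C} → C ∈ K → C ∈ᵇ Q ≡ true
    KQ {C} C∈ with ∈-++⁻ Z (proj₁ (K⁻ C∈))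
    ... | inj₂ l = all-∈ (_∈ᵇ Q) LQ l
    ... | inj₁ z = count-full (_∈ᵇ Q) (without B₀ Z) (s≤s⁻¹ (≤-trans (≤-reflexive (sym (length-without uZ B₀∈)))
          (≤-trans le (s≤s (≤-reflexive (trans (count-without (_∈ᵇ Q) uZ B₀∈) (cong (λ b → ⟦ b ⟧ + count (_∈ᵇ Q) (without B₀ Z)) B₀∉Q)))))))
          C (∈-filterᵇ⁺ (not ∘ (_==ᵛ B₀)) z (cong not (≢⇒==ᵛ {B = C} {B₀} (proj₂ (K⁻ C∈)))))
      where uZ = Unique-++ˡ Z uM
    B₀M : B₀ ∈ M
    B₀M = ∈-++⁺ˡ B₀∈
    x = proj₁ (WF.inh wM B₀M)
    B₀x : B₀ ∋ x
    B₀x = proj₂ (WF.inh wM B₀M)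
    D : Block n
    D = Vec.lookup Q x
    D∉K : ¬ D ∈ K
    D∉K h = proj₂ (K⁻ h) (WF.disj wM (proj₁ (K⁻ h)) B₀M {x} (row∋ Q isQ x) B₀x)
    DK⊑ : (D ∷ K) ⊑ᵇ Q ≡ true
    DK⊑ = ∧-intro (row∈ᵇ Q isQ x) (∈-all (_∈ᵇ Q) K KQ)
    uDK : Unique (D ∷ K)
    uDK = ∉⇒All≢ D∉K ∷ Unique-filterᵇ _ uM
    only : ∀ {C} → C ∈ᵇ Q ≡ true → C ∈ D ∷ K
    only {C} h = memᵇ⇒∈ C (D ∷ K) (count-full (λ B → memᵇ B (D ∷ K)) (blocks Q)
      (≤-reflexive (trans #Q (trans (length-without uM B₀M) (sym (count-mem Q uDK DK⊑))))) C (∈-blocks⁺ Q h))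
    D≡ : D ≡ enlarged B₀
    D≡ = vec-ext λ i → bool-ext (λ d → goD i d (any (λ C → Vec.lookup C i) M) refl) (λ r → goR i r (only (row∈ᵇ Q isQ i)))
      where
      goD : ∀ i → D ∋ i → ∀ b → any (λ C → Vec.lookup C i) M ≡ b → enlarged B₀ ∋ i
      goD i d false e = enlarged⁺′ {B₀} (λ C∈ c → contradiction (trans (sym (∈-any (λ C → Vec.lookup C i) C∈ c)) e) (λ ()))
      goD i d true e with C , C∈ , c ← any-∈ (λ C → Vec.lookup C i) M e with C ==ᵛ B₀ in eC
      ... | true  = enlarged⁺ {B₀} (subst (_∋ i) (==ᵛ⇒≡ C B₀ eC) c)
      ... | false = ⊥-elim (D∉K (subst (_∈ K) (sym (block-unique Q isQ (row∈ᵇ Q isQ x) (KQ C∈K) {i} d c)) C∈K))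
        where C∈K = ∈-filterᵇ⁺ (not ∘ (_==ᵛ B₀)) C∈ (cong not eC)
      goR : ∀ i → enlarged B₀ ∋ i → Vec.lookup Q i ∈ D ∷ K → D ∋ i
      goR i r (here e)   = subst (_∋ i) e (row∋ Q isQ i)
      goR i r (there C∈) with enlarged⁻ {B₀} r
      ... | inj₁ b = ⊥-elim (proj₂ (K⁻ C∈) (WF.disj wM (proj₁ (K⁻ C∈)) B₀M {i} (row∋ Q isQ i) b))
      ... | inj₂ h = ⊥-elim (h (proj₁ (K⁻ C∈)) (row∋ Q isQ i))
    to : ∀ C → C ∈ᵇ Q ≡ true → C ∈ enlarged B₀ ∷ K
    to C h = subst (λ D → C ∈ D ∷ K) D≡ (only h)
    from : ∀ C → C ∈ enlarged B₀ ∷ K → C ∈ᵇ Q ≡ true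
    from C (here refl) = subst (λ D → D ∈ᵇ Q ≡ true) D≡ (row∈ᵇ Q isQ x)
    from C (there C∈)  = KQ C∈

  exceptional⁺ : ∀ Q → IsKPartition (length M) Q → L ⊑ᵇ Q ≡ true → length Z ≤ suc (count (_∈ᵇ Q) Z) → ¬ Z ⊑ᵇ Q ≡ true →
                 Any (λ B → HasBlocks Q (enlarged B ∷ remove B M)) Z
  exceptional⁺ Q isk LQ le ¬ZQ with ≤-<-connex (length Z) (count (_∈ᵇ Q) Z)
  ... | inj₁ ge = contradiction (∈-all (_∈ᵇ Q) Z (λ {B} B∈ → count-full (_∈ᵇ Q) Z ge B B∈)) ¬ZQ
  ... | inj₂ lt with B₀ , B₀∈ , h ← count-∃ (not ∘ (_∈ᵇ Q)) Z (+-cancelˡ-≤ (count (_∈ᵇ Q) Z) 1 _ (≤-trans (≤-reflexive (+-comm (count (_∈ᵇ Q) Z) 1))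
      (≤-trans lt (≤-reflexive (sym (count-not (_∈ᵇ Q) Z)))))) =
    lose B₀∈ (missing-one Q isk LQ le B₀ B₀∈ (≡false (not⇒¬ h)))

  exceptional⁻ : ∀ Q → Any (λ B → HasBlocks Q (enlarged B ∷ remove B M)) Z →
                 IsKPartition (length M) Q × L ⊑ᵇ Q ≡ true × length Z ≤ suc (count (_∈ᵇ Q) Z)
  exceptional⁻ Q h = (isQ , #Q) , ∈-all (_∈ᵇ Q) L LQ , le
    where
    B₀ = proj₁ (find h)
    B₀∈ : B₀ ∈ Z
    B₀∈ = proj₁ (proj₂ (find h))
    hb : HasBlocks Q (enlarged B₀ ∷ remove B₀ M)
    hb = proj₂ (proj₂ (find h))
    isQ = proj₁ hb
    K = remove B₀ M
    in-Q : ∀ {C} → C ∈ enlarged B₀ ∷ K → C ∈ᵇ Q ≡ true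
    in-Q {C} = Equivalence.from (proj₂ hb C)
    uZ = Unique-++ˡ Z uM
    B₀M : B₀ ∈ M
    B₀M = ∈-++⁺ˡ B₀∈
    x = proj₁ (WF.inh wM B₀M)
    B₀x : B₀ ∋ x
    B₀x = proj₂ (WF.inh wM B₀M)
    keep : ∀ {C} → C ∈ M → ¬ C ≡ B₀ → C ∈ K
    keep {C} C∈ ne = ∈-filterᵇ⁺ (not ∘ (_==ᵛ B₀)) C∈ (cong not (≢⇒==ᵛ {B = C} {B₀} ne))
    LQ : ∀ {C} → C ∈ L → C ∈ᵇ Q ≡ true
    LQ {C} C∈ = in-Q (there (keep (∈-++⁺ʳ Z C∈) (λ e → Unique-++-∉ Z uM C∈ (subst (_∈ Z) (sym e) B₀∈))))
    le : length Z ≤ suc (count (_∈ᵇ Q) Z)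
    le = ≤-trans (≤-reflexive (length-without uZ B₀∈)) (s≤s (≤-trans (count-true (without B₀ Z) (λ C C∈ → let a , b = without-∈ {T = Z} C∈ in in-Q (there (keep (∈-++⁺ˡ a) b))))
      (≤-trans (m≤n+m _ ⟦ B₀ ∈ᵇ Q ⟧) (≤-reflexive (sym (count-without (_∈ᵇ Q) uZ B₀∈))))))
    uR : Unique (enlarged B₀ ∷ K)
    uR = All.tabulate (λ {C} C∈ e → let a , b = without-∈ {T = M} C∈ in b (WF.disj wM a B₀M {x} (subst (_∋ x) e (enlarged⁺ {B₀} B₀x)) B₀x)) ∷ Unique-filterᵇ _ uM
    #Q : #blocks Q ≡ length M
    #Q = trans (≤-antisym
      (Unique-⊆⇒length≤ {ys = enlarged B₀ ∷ K} (Unique-blocks Q) (λ C C∈ → Equivalence.to (proj₂ hb C) (∈-blocks⁻ Q C∈)))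
      (Unique-⊆⇒length≤ {xs = enlarged B₀ ∷ K} {blocks Q} uR (λ C C∈ → ∈-blocks⁺ Q (in-Q C∈)))) (sym (length-without uM B₀M))

common-flower : ∀ (Z L : List (Block n)) P Q → Unique (Z ++ L) → Z ⊑ᵇ P ≡ true → (∃ λ B → B ∈ L × B ∈ᵇ P ≡ true) →
                Z ⊑ᵇ Q ≡ true ⊎ (L ⊑ᵇ Q ≡ true × length Z ≤ suc (count (_∈ᵇ Q) Z)) → length Z ≤ #common P Q
common-flower Z L P Q u ZP _ (inj₁ ZQ) = ≤-trans (count-true Z (λ B B∈ → all-∈ (_∈ᵇ Q) ZQ B∈)) (common-kernel Z P Q (Unique-++ˡ Z u) ZP)
common-flower Z L P Q u ZP (B , B∈ , BP) (inj₂ (LQ , le)) = ≤-trans le (common≥ P Q (B ∷ Y)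
    (All.tabulate (λ C∈ e → Unique-++-∉ Z u B∈ (subst (_∈ Z) (sym e) (proj₁ (Y⁻ C∈)))) ∷ Unique-filterᵇ (_∈ᵇ Q) (Unique-++ˡ Z u))
    λ { (here refl) → BP , all-∈ (_∈ᵇ Q) LQ B∈ ; (there C∈) → all-∈ (_∈ᵇ P) ZP (proj₁ (Y⁻ C∈)) , proj₂ (Y⁻ C∈) })
  where
  Y = filterᵇ (_∈ᵇ Q) Z
  Y⁻ : ∀ {C} → C ∈ Y → C ∈ Z × C ∈ᵇ Q ≡ true
  Y⁻ = ∈-filterᵇ⁻ (_∈ᵇ Q) {Z}

flower-iso : ∀ {k ℓ t b} {G H : Family n} → ℓ ≡ t + b → ℓ ≤ n → FamilyIn k G → FamilyIn ℓ H → Saturated k t G H → Saturated ℓ t H G → FlowerShape t b G H →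
             IsoPair G H (𝒜std n k ℓ t) (ℬstd n ℓ t)
flower-iso {n} {k} {ℓ} {t} {b} {G} {H} eℓ ℓ≤n FG FH satG satH (Z , L , uM , lZ , lL , s , cG , cH) with standardise (Z ++ L) (uM , s)
... | σ , e = σ , (λ P → mk⇔ (toG P) (fromG P)) , (λ Q → mk⇔ (toH Q) (fromH Q))
  where
  open Relabel σ
  lM : length (Z ++ L) ≡ ℓ
  lM = trans (length-++ Z) (trans (cong₂ _+_ lZ lL) (sym eℓ))
  eM : map φ (Z ++ L) ≡ [[ ℓ ]]
  eM = trans e (cong (λ m → [[ m ]]) lM)
  eZ : map φ Z ≡ [[ t ]]
  eZ = trans ([[]]-prefix φ Z L e) (cong (λ m → [[ m ]]) lZ)
  eM′ : map φ Z ++ map φ L ≡ [[ ℓ ]]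
  eM′ = trans (sym (map-++ φ Z L)) eM
  open Exceptional (map φ Z) (map φ L) (subst Singles (sym eM′) ([[]]-singles ℓ ℓ≤n))
  lM′ : length (map φ Z ++ map φ L) ≡ ℓ
  lM′ = trans (cong length eM′) (length-[[]] {n} ℓ)
  toG : ∀ P → P ∈ G → 𝒜 k [[ t ]] [[ ℓ ]] (act σ P)
  toG P P∈ with ZP , B , B∈ , BP ← cG P P∈ = subst₂ (λ X M → 𝒜 k X M (act σ P)) eZ eM
    (act-k P (All.lookup (proj₂ FG) P∈) , map-φ-all σ P Z ZP , lose (∈-map⁺ φ (∈-++⁺ʳ Z B∈)) (trans (∈-act P B) BP ,
      λ h → let C , C∈ , e′ = ∈-map⁻ φ h in Unique-++-∉ Z uM B∈ (subst (_∈ Z) (sym (φ-injective e′)) C∈)))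
  fromG : ∀ P → 𝒜 k [[ t ]] [[ ℓ ]] (act σ P) → P ∈ G
  fromG P h with isk , ZP , a ← subst₂ (λ X M → 𝒜 k X M (act σ P)) (sym eZ) (sym eM) h with C , C∈ , CP , C∉ ← find a with B , B∈ , refl ← ∈-map⁻ φ C∈ =
    satG P (unact-k P isk) (λ Q Q∈ → subst (_≤ #common P Q) lZ (common-flower Z L P Q uM (all-map-φ σ P Z ZP) (petal (∈-++⁻ Z B∈))
      (subst (λ t → Z ⊑ᵇ Q ≡ true ⊎ (L ⊑ᵇ Q ≡ true × t ≤ suc (count (_∈ᵇ Q) Z))) (sym lZ) (cH Q Q∈))))
    where
    petal : B ∈ Z ⊎ B ∈ L → ∃ λ B → B ∈ L × B ∈ᵇ P ≡ true
    petal (inj₁ z) = ⊥-elim (C∉ (∈-map⁺ φ z))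
    petal (inj₂ l) = B , l , trans (sym (∈-act P B)) CP
  ℬ-eq : ∀ Q → ℬ ℓ (map φ Z) (map φ Z ++ map φ L) Q ≡ ℬ ℓ [[ t ]] [[ ℓ ]] Q
  ℬ-eq Q = cong₂ (λ X M → ℬ ℓ X M Q) eZ eM′
  lφZ : length (map φ Z) ≡ t
  lφZ = trans (length-map φ Z) lZ
  toH : ∀ Q → Q ∈ H → ℬ ℓ [[ t ]] [[ ℓ ]] (act σ Q)
  toH Q Q∈ = subst (λ X → X) (ℬ-eq (act σ Q)) (go (Z ⊑ᵇ Q) refl (cH Q Q∈))
    where
    isk : IsKPartition ℓ (act σ Q)
    isk = act-k Q (All.lookup (proj₂ FH) Q∈)
    go : ∀ b → Z ⊑ᵇ Q ≡ b → Z ⊑ᵇ Q ≡ true ⊎ (L ⊑ᵇ Q ≡ true × t ≤ suc (count (_∈ᵇ Q) Z)) → ℬ ℓ (map φ Z) (map φ Z ++ map φ L) (act σ Q)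
    go true  e′ _ = inj₁ (isk , map-φ-all σ Q Z e′)
    go false e′ (inj₁ ZQ) with () ← trans (sym ZQ) e′
    go false e′ (inj₂ (LQ , le)) = inj₂ (exceptional⁺ (act σ Q) (subst (λ m → IsKPartition m (act σ Q)) (sym lM′) isk) (trans (⊑-act Q L) LQ)
      (≤-trans (≤-reflexive lφZ) (≤-trans le (s≤s (≤-reflexive (sym (count-act Q Z)))))) (λ h → contradiction (trans (sym h) (trans (⊑-act Q Z) e′)) (λ ())))
  fromH : ∀ Q → ℬ ℓ [[ t ]] [[ ℓ ]] (act σ Q) → Q ∈ H
  fromH Q h = go (subst (λ X → X) (sym (ℬ-eq (act σ Q))) h)
    where
    fin : IsKPartition ℓ (act σ Q) → Z ⊑ᵇ Q ≡ true ⊎ (L ⊑ᵇ Q ≡ true × length Z ≤ suc (count (_∈ᵇ Q) Z)) → Q ∈ H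
    fin isk alt = satH Q (unact-k Q isk) (λ P P∈ → ≤-trans (≤-reflexive (sym lZ)) (≤-trans (common-flower Z L P Q uM (proj₁ (cG P P∈)) (proj₂ (cG P P∈)) alt) (≤-reflexive (common-sym P Q))))
    go : ℬ ℓ (map φ Z) (map φ Z ++ map φ L) (act σ Q) → Q ∈ H
    go (inj₁ (isk , a)) = fin isk (inj₁ (all-map-φ σ Q Z a))
    go (inj₂ ex) with isk , LQ , le ← exceptional⁻ (act σ Q) ex = fin (subst (λ m → IsKPartition m (act σ Q)) lM′ isk)
      (inj₂ (trans (sym (⊑-act Q L)) LQ , ≤-trans (≤-reflexive (sym (length-map φ Z))) (≤-trans le (s≤s (≤-reflexive (count-act Q Z))))))

-- Lower bounds for the maximum.

2tri≤ : ∀ r → 2 * tri r ≤ r * r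
2tri≤ zero    = z≤n
2tri≤ (suc r) = ≤-cert 1 (2tri≤ r) (lem (tri r) r)
  where lem : ∀ x r → suc r * suc r + 2 * x ≡ 2 * (x + r) + r * r + 1
        lem = solve-∀

-- The product is at least p((t + 1)q - tri(t + 1) q′). The correction is at most q/16, since 16
-- tri(t + 1) + 1 ≤ 9(t + 1)² ≤ X²; hence the constant 16t + 15.
optimal𝒟 : ∀ {X} t′ j i c₁ c₂ N → n ≡ c₁ + suc (suc t′ + suc j) → n ≡ c₂ + suc (suc t′ + suc i) →
           Good X c₂ (suc i) → (2 + t′) * 3 ≤ X → A c₂ i < A c₂ (suc i) →
           (∀ G H → NTCross n (suc (suc t′ + suc j)) (suc (suc t′ + suc i)) (suc t′) G H → length G * length H ≤ N) →
           (16 * suc t′ + 15) * (A c₁ j * A c₂ (suc i)) ≤ 16 * N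
optimal𝒟 {n} {X} t′ j i c₁ c₂ N en₁ en₂ g h q′<q mx = ≤-cert 0
    (+-mono-≤ (*-monoʳ-≤ 16 (≤-trans (≤-reflexive (cong (_* length 𝒟f) (sym length-𝒞f))) (mx 𝒞f 𝒟f nt)))
      (+-mono-≤ (*-monoʳ-≤ (16 * p) length-𝒟f) (*-monoʳ-≤ p small)))
    (lem t′ p q q′ (tri (2 + t′)) (length 𝒟f) N)
  where
  2+t′≤n : 2 + t′ ≤ n
  2+t′≤n = ≤-trans (≤-trans (s≤s (s≤s (m≤m+n t′ (suc j)))) (m≤n+m _ c₁)) (≤-reflexive (sym en₁))
  open Opt𝒟 t′ j i c₁ c₂ en₁ en₂ q′<q [[ 2 + t′ ]] ([[]]-singles (2 + t′) 2+t′≤n) (length-[[]] {n} (2 + t′))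
  p q q′ : ℕ
  p = A c₁ j
  q = A c₂ (suc i)
  q′ = A c₂ i
  small : 16 * tri (2 + t′) * q′ ≤ q
  small = absorb {X * X} {16 * tri (2 + t′)} (≤-trans (≤-cert (t′ * t′ + 4 * t′ + 3) (*-monoʳ-≤ 8 (2tri≤ (2 + t′))) (lem2 t′ (tri (2 + t′)))) (*-mono-≤ h h)) (Good.ratio g i ≤-refl)
    where lem2 : ∀ t x → (2 + t) * 3 * ((2 + t) * 3) + 8 * (2 * x) ≡ 16 * x + 1 + 8 * ((2 + t) * (2 + t)) + (t * t + 4 * t + 3)
          lem2 = solve-∀
  lem : ∀ t p q q′ r D N → 16 * N + (16 * (p * D) + (16 * p * (suc (suc t) * q) + p * (16 * r * q′)))
      ≡ (16 * suc t + 15) * (p * q) + (16 * N + (16 * p * (D + r * q′) + p * q)) + 0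
  lem = solve-∀

-- With r = ℓ - t = 2 + i petals the product is at least (r p - tri(r) p′)q. The correction is at
-- most p/8, since 8 tri(r) + 1 ≤ 4(3 + i)² ≤ X²; hence 8(i + 1) + 7 in units of 1/8.
optimal𝒜 : ∀ {X} t′ m i c₁ c₂ N → n ≡ c₁ + suc (suc t′ + suc (suc m)) → n ≡ c₂ + suc (suc t′ + suc i) →
           Good X c₁ (2 + m) → (2 + t′) * (3 + i) ≤ X → A c₂ i < A c₂ (suc i) → 1 ≤ c₂ →
           (∀ G H → NTCross n (suc (suc t′ + suc (suc m))) (suc (suc t′ + suc i)) (suc t′) G H → length G * length H ≤ N) →
           (8 * suc i + 7) * (A c₁ (suc m) * A c₂ (suc i)) ≤ 8 * N
optimal𝒜 {n} {X} t′ m i c₁ c₂ N en₁ en₂ g h q′<q 1≤c₂ mx = ≤-cert 0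
    (+-mono-≤ (*-monoʳ-≤ 8 (≤-trans (*-monoʳ-≤ (length 𝒜f) length-ℬf) (mx 𝒜f ℬf nt)))
      (+-mono-≤ (*-monoʳ-≤ (8 * q) length-𝒜f) (*-monoʳ-≤ q small)))
    (lem i p q p′ (tri (2 + i)) (length 𝒜f) N)
  where
  ℓ : ℕ
  ℓ = suc (suc t′ + suc i)
  ℓ≤n : ℓ ≤ n
  ℓ≤n = ≤-trans (m≤n+m _ c₂) (≤-reflexive (sym en₂))
  M′ Z′ L : List (Block n)
  M′ = map single (range 1 (suc t′ + suc i))
  Z′ = take t′ M′
  L = drop t′ M′
  lM′ : length M′ ≡ suc t′ + suc i
  lM′ = trans (length-map single (range 1 (suc t′ + suc i))) (length-range 1 (suc t′ + suc i))
    where length-range : ∀ s m → length (range s m) ≡ m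
          length-range s zero    = refl
          length-range s (suc m) = cong suc (length-range (suc s) m)
  lZ′ : length Z′ ≡ t′
  lZ′ = trans (length-take t′ M′) (trans (cong (t′ ⊓_) lM′) (m≤n⇒m⊓n≡m (≤-trans (n≤1+n t′) (m≤m+n (suc t′) (suc i)))))
  lL : length L ≡ 2 + i
  lL = trans (length-drop t′ M′) (trans (cong (_∸ t′) (trans lM′ (lem t′ i))) (m+n∸m≡n t′ (2 + i)))
    where lem : ∀ t i → suc t + suc i ≡ t + (2 + i)
          lem = solve-∀
  sM : Singles (single 0 ∷ Z′ ++ L)
  sM = subst (λ M → Singles (single 0 ∷ M)) (sym (take++drop≡id t′ M′)) (singles-range 0 ℓ ℓ≤n)
  open Opt𝒜 t′ m i c₁ c₂ en₁ en₂ q′<q 1≤c₂ (single 0) Z′ L sM lZ′ lL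
  p q p′ : ℕ
  p = A c₁ (suc m)
  q = A c₂ (suc i)
  p′ = A c₁ m
  small : 8 * tri (2 + i) * p′ ≤ p
  small = absorb {X * X} {8 * tri (2 + i)} (≤-trans (≤-cert (19 + 8 * i) (*-monoʳ-≤ 4 (2tri≤ (2 + i))) (lem2 i (tri (2 + i)))) (*-mono-≤ h2 h2)) (Good.ratio g m (n≤1+n _))
    where h2 : 2 * (3 + i) ≤ X
          h2 = ≤-trans (*-monoˡ-≤ (3 + i) (m≤m+n 2 t′)) h
          lem2 : ∀ i x → 2 * (3 + i) * (2 * (3 + i)) + 4 * (2 * x) ≡ 8 * x + 1 + 4 * ((2 + i) * (2 + i)) + (19 + 8 * i)
          lem2 = solve-∀
  lem : ∀ i p q p′ r a N → 8 * N + (8 * (a * q) + (8 * q * ((2 + i) * p) + q * (8 * r * p′)))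
      ≡ (8 * suc i + 7) * (p * q) + (8 * N + (8 * q * (a + r * p′) + q * p)) + 0
  lem = solve-∀

-- The case distinction on common blocks, and the theorem.

allCommon : Family n → List (Block n)
allCommon {n} F = filterᵇ (λ B → all (λ P → B ∈ᵇ P) F) (allSubsets n)

-- A t-cover by exactly t blocks lies inside every member, so it exists if and only if at least t
-- blocks are common to all; that can be counted.
covOfSize? : ∀ t (F : Family n) → CovOfSize t F t ⊎ ¬ CovOfSize t F t
covOfSize? {n} t F with ≤-<-connex t (length (allCommon F))
... | inj₁ le = inj₁ (K , Unique-take t (Unique-filterᵇ _ (Unique-allSubsets n)) , lT , ⊑⇒cov K lT
      (λ Q Q∈ → ∈-all (_∈ᵇ Q) K (λ {B} B∈ → all-∈ (λ P → B ∈ᵇ P) (proj₂ (∈-filterᵇ⁻ (λ B → all (λ P → B ∈ᵇ P) F) {allSubsets n} (∈-take t B∈))) Q∈)))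
  where
  K = take t (allCommon F)
  lT : length K ≡ t
  lT = trans (length-take t (allCommon F)) (m≤n⇒m⊓n≡m le)
  ∈-take : ∀ {X : Set} m {xs : List X} {x} → x ∈ take m xs → x ∈ xs
  ∈-take (suc m) {_ ∷ _} (here e)  = here e
  ∈-take (suc m) {_ ∷ _} (there h) = there (∈-take m h)
  Unique-take : ∀ {X : Set} m {xs : List X} → Unique xs → Unique (take m xs)
  Unique-take zero    _        = []
  Unique-take (suc m) []       = []
  Unique-take (suc m) (a ∷ u) = All.tabulate (λ y∈ → All.lookup a (∈-take m y∈)) ∷ Unique-take m u
... | inj₂ lt = inj₂ λ (K , u , lT , c) → <⇒≱ lt (≤-trans (≤-reflexive (sym lT)) (Unique-⊆⇒length≤ {ys = allCommon F} u
      (λ B B∈ → ∈-filterᵇ⁺ _ (∈-allSubsets B) (∈-all (λ P → B ∈ᵇ P) F (λ {P} P∈ → all-∈ (_∈ᵇ P) (cov⇒⊑ K lT c P P∈) B∈)))))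

nonempty-true : ∀ (B : Block n) i → B ∋ i → nonempty B ≡ true
nonempty-true (true ∷ B)  i       h = refl
nonempty-true (false ∷ B) (suc i) h = nonempty-true B i h

not-both : ∀ {t} {F₁ F₂ : Family n} → NonTrivial t F₁ F₂ → ∀ {k} → FamilyIn k F₁ → ∀ P → P ∈ F₁ →
           ∀ T → Unique T → length T ≡ t → Cov t T F₁ → ¬ Cov t T F₂
not-both {n} {t} {F₁} {F₂} nt FG P P∈ T u lT c₁ c₂ = <⇒≱ nt (≤-trans (≤-reflexive (sym lT))
  (Unique-⊆⇒length≤ {ys = filterᵇ com (allSubsets n)} u (λ B B∈ → ∈-filterᵇ⁺ com (∈-allSubsets B) (∧-intro
    (let i , b = ⊑-inh FG P P∈ {T} (cov⇒⊑ T lT c₁ P P∈) B∈ in nonempty-true B i b)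
    (∧-intro (∈-all (λ P → B ∈ᵇ P) F₁ (λ {Q} Q∈ → all-∈ (_∈ᵇ Q) (cov⇒⊑ T lT c₁ Q Q∈) B∈))
             (∈-all (λ P → B ∈ᵇ P) F₂ (λ {Q} Q∈ → all-∈ (_∈ᵇ Q) (cov⇒⊑ T lT c₂ Q Q∈) B∈)))))))
  where com : Block n → Bool
        com B = nonempty B ∧ all (λ P → B ∈ᵇ P) F₁ ∧ all (λ P → B ∈ᵇ P) F₂

Good⇒1≤c : ∀ {X c J} → 2 ≤ X → Good X c J → 1 ≤ c
Good⇒1≤c {X} {zero}  h g = contradiction (≤-trans (^-monoˡ-≤ 6 h) (Good.big g)) (<⇒≱ (s≤s (s≤s (s≤s z≤n))))
Good⇒1≤c {X} {suc c} h g = s≤s z≤n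

factor≥1 : ∀ a b → 1 ≤ a * b → 1 ≤ a
factor≥1 (suc a) b h = s≤s z≤n

record Maximal (n t′ i j c₁ c₂ : ℕ) : Set where
  field
    i≤j : i ≤ j
    en₁ : n ≡ c₁ + suc (suc t′ + suc j)
    en₂ : n ≡ c₂ + suc (suc t′ + suc i)
    ¬33 : ¬ (t′ ≡ 0 × j ≡ 0)
    large : ((2 + t′) * (3 + j)) ^ (2 * suc j + 4) ≤ 2 ^ (c₁ + suc j)
    F₁ F₂ : Family n
    nt : NTCross n (suc (suc t′ + suc j)) (suc (suc t′ + suc i)) (suc t′) F₁ F₂
    mx : ∀ G₁ G₂ → NTCross n (suc (suc t′ + suc j)) (suc (suc t′ + suc i)) (suc t′) G₁ G₂ → length G₁ * length G₂ ≤ length F₁ * length F₂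

module Main {n} (t′ i j c₁ c₂ : ℕ) (maximal : Maximal n t′ i j c₁ c₂) where
  open Maximal maximal public
  t k₁ k₂ X N₁ N₂ : ℕ
  t = suc t′
  k₁ = suc (t + suc j)
  k₂ = suc (t + suc i)
  X = (2 + t′) * (3 + j)
  N₁ = length F₁ * length F₂
  N₂ = length F₂ * length F₁

  hI : (2 + t′) * (3 + i) ≤ X
  hI = *-monoʳ-≤ (2 + t′) (+-monoʳ-≤ 3 i≤j)

  6≤X : 6 ≤ X
  6≤X = *-mono-≤ {2} {2 + t′} {3} {3 + j} (m≤m+n 2 t′) (m≤m+n 3 j)

  2≤X : 2 ≤ X
  2≤X = ≤-trans (m≤m+n 2 4) 6≤X

  -- Both sides are n - t - 1. The power of two in `large` is thus the same for both families, and
  -- the smaller exponent on the left makes the bound pass to i ≤ j.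
  c₁+J≡ : c₁ + suc j ≡ c₂ + suc i
  c₁+J≡ = +-cancelʳ-≡ (suc t) _ _ (trans (lem c₁ j t′) (trans (trans (sym en₁) en₂) (sym (lem c₂ i t′))))
    where lem : ∀ c j t → c + suc j + suc (suc t) ≡ c + suc (suc t + suc j)
          lem = solve-∀

  g₁ : Good X c₁ (suc j)
  g₁ = good c₁ (suc j) 2≤X (s≤s z≤n) large

  g₂ : Good X c₂ (suc i)
  g₂ = good c₂ (suc i) 2≤X (s≤s z≤n) (≤-trans (^-monoʳ-≤ X ⦃ >-nonZero (≤-trans (s≤s z≤n) 2≤X) ⦄ (+-monoˡ-≤ 4 (*-monoʳ-≤ 2 (s≤s i≤j))))
    (≤-trans large (≤-reflexive (cong (2 ^_) c₁+J≡))))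

  half : ∀ {c J} → Good X c (suc J) → 2 * A c J ≤ A c (suc J)
  half {c} {J} g = absorb {X * X} {2} (≤-trans (m≤m+n 3 33) (*-mono-≤ 6≤X 6≤X)) (Good.ratio g J ≤-refl)

  below : ∀ {c J} → Good X c (suc J) → A c J < A c (suc J)
  below {c} {J} g = ≤-trans (+-monoˡ-≤ (A c J) (A-pos c J)) (≤-trans (≤-reflexive (cong (A c J +_) (sym (+-identityʳ _)))) (half g))

  opt₁ : (16 * t + 15) * (A c₁ j * A c₂ (suc i)) ≤ 16 * N₁
  opt₁ = optimal𝒟 t′ j i c₁ c₂ N₁ en₁ en₂ g₂ (≤-trans (*-monoʳ-≤ (2 + t′) (m≤m+n 3 j)) ≤-refl) (below g₂) mx

  mx′ : ∀ G₂ G₁ → NTCross n k₂ k₁ t G₂ G₁ → length G₂ * length G₁ ≤ N₂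
  mx′ G₂ G₁ h = ≤-trans (≤-reflexive (*-comm (length G₂) _)) (≤-trans (mx G₁ G₂ (NTCross-swap {G = G₂} {G₁} h)) (≤-reflexive (*-comm (length F₁) _)))

  opt₂ : (16 * t + 15) * (A c₂ i * A c₁ (suc j)) ≤ 16 * N₂
  opt₂ = optimal𝒟 t′ i j c₂ c₁ N₂ en₂ en₁ g₁ (*-monoʳ-≤ (2 + t′) (m≤m+n 3 j)) (below g₁) mx′

  FG : FamilyIn k₁ F₁
  FG = proj₁ nt
  FH : FamilyIn k₂ F₂
  FH = proj₁ (proj₂ nt)
  x₁ : Cross t F₁ F₂
  x₁ = crossInt⇒Cross (proj₁ (proj₂ (proj₂ nt)))
  nt′ : NTCross n k₂ k₁ t F₂ F₁
  nt′ = NTCross-swap {G = F₁} {F₂} nt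
  x₂ : Cross t F₂ F₁
  x₂ = crossInt⇒Cross (proj₁ (proj₂ (proj₂ nt′)))

  crossing : Crossing n t′ j i c₁ c₂
  crossing = record { G = F₁ ; H = F₂ ; en₁ = en₁ ; en₂ = en₂ ; FG = FG ; FH = FH ; x = x₁ ; x′ = x₂ }

  bounds : Bounds crossing
  bounds = record { X = X ; 2≤X = 2≤X ; g₁ = g₁ ; g₂ = g₂ ; hI = hI ; hJ = ≤-refl }

  bounds′ : Bounds (flip crossing)
  bounds′ = record { X = X ; 2≤X = 2≤X ; g₁ = g₂ ; g₂ = g₁ ; hI = ≤-refl ; hJ = hI }

  1≤pq : 1 ≤ A c₂ (suc i) * A c₁ j
  1≤pq = *-mono-≤ (A-pos c₂ (suc i)) (A-pos c₁ j)

  1≤N₁ : 1 ≤ N₁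
  1≤N₁ = *-cancelˡ-< 16 0 N₁ (≤-trans (*-mono-≤ {1} {16 * t + 15} (≤-trans (m≤m+n 1 14) (m≤n+m 15 (16 * t))) (*-mono-≤ (A-pos c₁ j) (A-pos c₂ (suc i)))) opt₁)

  member : ∀ (F : Family n) → 1 ≤ length F → ∃ λ P → P ∈ F
  member (P ∷ F) _ = P , here refl

  1≤F₁ : 1 ≤ length F₁
  1≤F₁ = factor≥1 (length F₁) (length F₂) 1≤N₁

  1≤F₂ : 1 ≤ length F₂
  1≤F₂ = factor≥1 (length F₂) (length F₁) (≤-trans 1≤N₁ (≤-reflexive (*-comm (length F₁) (length F₂))))

  P₀ Q₀ : Part n
  P₀ = proj₁ (member F₁ 1≤F₁)
  Q₀ = proj₁ (member F₂ 1≤F₂)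
  P₀∈ : P₀ ∈ F₁
  P₀∈ = proj₂ (member F₁ 1≤F₁)
  Q₀∈ : Q₀ ∈ F₂
  Q₀∈ = proj₂ (member F₂ 1≤F₂)

  sat₁ : Saturated k₁ t F₁ F₂
  sat₁ = saturated {G = F₁} {F₂} nt (λ G′ h → mx G′ F₂ h) 1≤F₂
  sat₂ : Saturated k₂ t F₂ F₁
  sat₂ = saturated {G = F₂} {F₁} nt′ (λ G′ h → mx′ G′ F₁ h) 1≤F₁

  k₁≤n : k₁ ≤ n
  k₁≤n = ≤-trans (m≤n+m _ c₁) (≤-reflexive (sym en₁))
  k₂≤n : k₂ ≤ n
  k₂≤n = ≤-trans (m≤n+m _ c₂) (≤-reflexive (sym en₂))

  too-small : N₁ ≤ A c₁ j * (A c₂ (suc i) + A c₂ i) → ⊥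
  too-small h = few-covers-⊥ t′ (A c₂ (suc i)) (A c₂ i) (A c₁ j) N₁
    (≤-trans (≤-reflexive (cong ((16 * t + 15) *_) (*-comm (A c₂ (suc i)) (A c₁ j)))) opt₁) h (half g₂) 1≤pq

  Goal : Set
  Goal = IsoPair F₁ F₂ (𝒜std n k₁ k₂ t) (ℬstd n k₂ t) ⊎ IsoPair F₁ F₂ (ℬstd n k₁ t) (𝒜std n k₂ k₁ t) ⊎
         IsoPair F₁ F₂ (𝒞std n k₁ t) (𝒟std n k₂ t) ⊎ IsoPair F₁ F₂ (𝒟std n k₁ t) (𝒞std n k₂ t)

  kernel₁ : KernelShape t F₁ F₂ → Goal
  kernel₁ h = inj₂ (inj₂ (inj₁ (kernel-iso FG FH sat₁ sat₂ h)))

  kernel₂ : KernelShape t F₂ F₁ → Goal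
  kernel₂ h = inj₂ (inj₂ (inj₂ (IsoPair-swap {F₁ = F₂} {F₁} {𝒞std n k₂ t} {𝒟std n k₁ t} (kernel-iso FH FG sat₂ sat₁ h))))

  flower₁ : FlowerShape t (suc (suc i)) F₁ F₂ → Goal
  flower₁ h = inj₁ (flower-iso (sym (+-suc t (suc i))) k₂≤n FG FH sat₁ sat₂ h)

  flower₂ : FlowerShape t (suc (suc j)) F₂ F₁ → Goal
  flower₂ h = inj₂ (inj₁ (IsoPair-swap {F₁ = F₂} {F₁} {𝒜std n k₂ k₁ t} {ℬstd n k₁ t} (flower-iso (sym (+-suc t (suc j))) k₁≤n FH FG sat₂ sat₁ h)))

first-concentrated : ∀ t′ i j c₁ c₂ (m : Maximal n t′ i j c₁ c₂) → CovOfSize (suc t′) (Maximal.F₁ m) (suc t′) → ¬ CovOfSize (suc t′) (Maximal.F₂ m) (suc t′) →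
                     Main.Goal t′ i j c₁ c₂ m
first-concentrated {n} t′ i (suc m) c₁ c₂ mxl (Z , uZ , lZ , cZ) no₂ = go (cov? (suc t′) Z F₂)
  where
  open Main t′ i (suc m) c₁ c₂ mxl
  conclude : KernelShape t F₁ F₂ ⊎ FlowerShape t (suc (suc i)) F₁ F₂ → Goal
  conclude (inj₁ h) = kernel₁ h
  conclude (inj₂ h) = flower₁ h
  go : Cov t Z F₂ ⊎ (∃ λ Q → Q ∈ F₂ × count (_∈ᵇ Q) Z < t) → Goal
  go (inj₁ c) = ⊥-elim (no₂ (Z , uZ , lZ , c))
  go (inj₂ (Q , Q∈ , s≤s few)) = conclude (Large.shape crossing bounds
    (record { Z = Z ; uZ = uZ ; lZ = lZ ; cZ = cov⇒⊑ Z lZ cZ ; P₀ = P₀ ; Q₀ = Q ; P₀∈ = P₀∈ ; Q₀∈ = Q∈ ; few = few }) no₂ opt₁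
    (optimal𝒜 t′ m i c₁ c₂ N₁ en₁ en₂ g₁ hI (below g₂) (Good⇒1≤c 2≤X g₂) mx))
first-concentrated zero zero zero c₁ c₂ mxl _ _ = ⊥-elim (Maximal.¬33 mxl (refl , refl))
first-concentrated {n} (suc t″) zero zero c₁ c₂ mxl (Z , uZ , lZ , cZ) no₂ = go (cov? (2 + t″) Z F₂)
  where
  open Main (suc t″) zero zero c₁ c₂ mxl
  go : Cov t Z F₂ ⊎ (∃ λ Q → Q ∈ F₂ × count (_∈ᵇ Q) Z < t) → Goal
  go (inj₁ c) = ⊥-elim (no₂ (Z , uZ , lZ , c))
  go (inj₂ (Q , Q∈ , s≤s few)) = kernel₁ (Tight.tight-shape
    (record { G = F₁ ; H = F₂ ; en₁ = en₁ ; en₂ = en₁ ; FG = FG ; FH = FH ; x = x₁ ; x′ = x₂ }) X g₁ ≤-refl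
    (subst (λ c → (16 * (2 + t″) + 15) * (A c₁ 0 * A c 1) ≤ 16 * N₁) (sym (+-cancelʳ-≡ 1 c₁ c₂ c₁+J≡)) opt₁)
    (record { Z = Z ; uZ = uZ ; lZ = lZ ; cZ = cov⇒⊑ Z lZ cZ ; P₀ = P₀ ; Q₀ = Q ; P₀∈ = P₀∈ ; Q₀∈ = Q∈ ; few = few }))
first-concentrated t′ (suc i) zero c₁ c₂ mxl _ _ = ⊥-elim (1≰0 (≤-trans (s≤s z≤n) (Maximal.i≤j mxl)))

second-concentrated : ∀ t′ i j c₁ c₂ (m : Maximal n t′ i j c₁ c₂) → CovOfSize (suc t′) (Maximal.F₂ m) (suc t′) → ¬ CovOfSize (suc t′) (Maximal.F₁ m) (suc t′) →
                      Main.Goal t′ i j c₁ c₂ m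
second-concentrated {n} t′ (suc m) j c₁ c₂ mxl (Z , uZ , lZ , cZ) no₁ = go (cov? (suc t′) Z F₁)
  where
  open Main t′ (suc m) j c₁ c₂ mxl
  conclude : KernelShape t F₂ F₁ ⊎ FlowerShape t (suc (suc j)) F₂ F₁ → Goal
  conclude (inj₁ h) = kernel₂ h
  conclude (inj₂ h) = flower₂ h
  go : Cov t Z F₁ ⊎ (∃ λ Q → Q ∈ F₁ × count (_∈ᵇ Q) Z < t) → Goal
  go (inj₁ c) = ⊥-elim (no₁ (Z , uZ , lZ , c))
  go (inj₂ (Q , Q∈ , s≤s few)) = conclude (Large.shape (flip crossing) bounds′
    (record { Z = Z ; uZ = uZ ; lZ = lZ ; cZ = cov⇒⊑ Z lZ cZ ; P₀ = Q₀ ; Q₀ = Q ; P₀∈ = Q₀∈ ; Q₀∈ = Q∈ ; few = few }) no₁ opt₂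
    (optimal𝒜 t′ m j c₂ c₁ N₂ en₂ en₁ g₂ ≤-refl (below g₁) (Good⇒1≤c 2≤X g₁) mx′))
second-concentrated zero zero zero c₁ c₂ mxl _ _ = ⊥-elim (Maximal.¬33 mxl (refl , refl))
second-concentrated {n} (suc t″) zero zero c₁ c₂ mxl (Z , uZ , lZ , cZ) no₁ = go (cov? (2 + t″) Z F₁)
  where
  open Main (suc t″) zero zero c₁ c₂ mxl
  go : Cov t Z F₁ ⊎ (∃ λ Q → Q ∈ F₁ × count (_∈ᵇ Q) Z < t) → Goal
  go (inj₁ c) = ⊥-elim (no₁ (Z , uZ , lZ , c))
  go (inj₂ (Q , Q∈ , s≤s few)) = kernel₂ (Tight.tight-shape
    (record { G = F₂ ; H = F₁ ; en₁ = en₂ ; en₂ = en₂ ; FG = FH ; FH = FG ; x = x₂ ; x′ = x₁ }) X g₂ ≤-refl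
    (subst (λ c → (16 * (2 + t″) + 15) * (A c₂ 0 * A c 1) ≤ 16 * N₂) (+-cancelʳ-≡ 1 c₁ c₂ c₁+J≡) opt₂)
    (record { Z = Z ; uZ = uZ ; lZ = lZ ; cZ = cov⇒⊑ Z lZ cZ ; P₀ = Q₀ ; Q₀ = Q ; P₀∈ = Q₀∈ ; Q₀∈ = Q∈ ; few = few }))
-- Members of F₂ have t + 2 blocks and F₂ has t common ones, while F₁ consists of larger partitions.
-- A least cover of F₁ has t + d blocks with d at most 2, so |F₂| ≤ (4 + r)^d and the product is at
-- most X² A c₁ (j + 1). By `A-upper` this is at most pq, which is too small.
second-concentrated {n} t′ zero (suc r) c₁ c₂ mxl (Z , uZ , lZ , cZ) no₁ =
  ⊥-elim (minimal (λ d → CovOfSize t F₁ (t + d)) 2 (subst (CovOfSize t F₁) (sym (+-suc t 1)) (members-cover x₁ FH Q₀ Q₀∈)) go)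
  where
  open Main t′ zero (suc r) c₁ c₂ mxl
  module P₁₂ = Pair crossing
  module P₂₁ = Pair (flip crossing)
  q≥ : 2 ^ (c₁ + suc (suc r)) ≤ A c₂ 1 + 1
  q≥ = ≤-trans (≤-reflexive (trans (cong (2 ^_) c₁+J≡) (sym (trans (cong (2 ^ (c₂ + 1) *_) (A-zero c₂)) (*-identityʳ _)))))
    (≤-trans (A-ratio c₂ 0 (2 ^ (c₂ + 1)) (≤-reflexive (*-identityʳ _))) (≤-reflexive (cong (A c₂ 1 +_) (A-zero c₂))))
  upper : X * X * A c₁ (suc (suc r)) ≤ A c₁ (suc r) * A c₂ 1
  upper = A-upper c₁ (suc r) (A c₂ 1) (*-mono-≤ {2} {2 + t′} {4} {4 + r} (m≤m+n 2 t′) (m≤m+n 4 r))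
    (≤-trans (n≤1+n (3 + r)) (m≤m+n (4 + r) _)) (s≤s z≤n) large q≥
  go : ∀ d → d ≤ 2 → CovOfSize t F₁ (t + d) → (∀ e → e < d → ¬ CovOfSize t F₁ (t + e)) → ⊥
  go zero d≤ cv _ = no₁ (subst (CovOfSize t F₁) (+-identityʳ t) cv)
  go d@(suc d′) d≤ cv@(Y , uY , lY , cY) min = too-small (begin
    N₁                                                           ≤⟨ *-mono-≤
        (P₁₂.cover-extend d 0 Y lY uY cY z≤n (λ T u ge lt → contradiction ge (<⇒≱ (≤-trans lt (≤-reflexive (+-identityʳ t))))))
        (P₂₁.cover-extend 0 d Z (trans lZ (sym (+-identityʳ t))) uZ cZ d≤ (no-small d min)) ⟩
    (2 + t′) ^ d * (1 * a) * (1 * ((4 + r) ^ d * A c₂ (1 ∸ d)))  ≡⟨ cong (λ z → (2 + t′) ^ d * (1 * a) * (1 * ((4 + r) ^ d * z)))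
                                                                      (trans (cong (A c₂) (m≤n⇒m∸n≡0 {1} {d} (s≤s z≤n))) (A-zero c₂)) ⟩
    (2 + t′) ^ d * (1 * a) * (1 * ((4 + r) ^ d * 1))             ≡⟨ lem ((2 + t′) ^ d) ((4 + r) ^ d) a ⟩
    (2 + t′) ^ d * (4 + r) ^ d * a                               ≤⟨ *-monoˡ-≤ a (≤-trans ([mn]^≤ {2 + t′} {4 + r} {X} d ≤-refl)
                                                                      (^-monoʳ-≤ X ⦃ >-nonZero (≤-trans (s≤s z≤n) 2≤X) ⦄ d≤)) ⟩
    X ^ 2 * a                                                    ≡⟨ cong (λ z → X * z * a) (*-identityʳ X) ⟩
    X * X * a                                                    ≤⟨ upper ⟩
    A c₁ (suc r) * A c₂ 1                                        ≤⟨ *-monoʳ-≤ (A c₁ (suc r)) (m≤m+n (A c₂ 1) (A c₂ 0)) ⟩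
    A c₁ (suc r) * (A c₂ 1 + A c₂ 0)                             ∎)
    where
    open ≤-Reasoning
    a : ℕ
    a = A c₁ (suc (suc r))
    lem : ∀ x y a → x * (1 * a) * (1 * (y * 1)) ≡ x * y * a
    lem = solve-∀

main : ∀ t′ i j c₁ c₂ (m : Maximal n t′ i j c₁ c₂) → Main.Goal t′ i j c₁ c₂ m
main t′ i j c₁ c₂ m = go (covOfSize? t F₁) (covOfSize? t F₂)
  where
  open Main t′ i j c₁ c₂ m
  module Both = BothSpread crossing bounds i≤j
  go : CovOfSize t F₁ t ⊎ ¬ CovOfSize t F₁ t → CovOfSize t F₂ t ⊎ ¬ CovOfSize t F₂ t → Goal
  go (inj₂ no₁) (inj₂ no₂) = ⊥-elim (Both.spread P₀ Q₀ P₀∈ Q₀∈ no₁ no₂ too-small)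
  go (inj₁ (Y , uY , lY , cY)) (inj₁ (Z , uZ , lZ , cZ)) = ⊥-elim (too-small (Both.concentrated Y Z uY uZ lY lZ cY cZ
    (not-both (proj₂ (proj₂ (proj₂ nt))) FG P₀ P₀∈ Y uY lY cY) (not-both (proj₂ (proj₂ (proj₂ nt′))) FH Q₀ Q₀∈ Z uZ lZ cZ)))
  go (inj₁ yes₁) (inj₂ no₂) = first-concentrated t′ i j c₁ c₂ m yes₁ no₂
  go (inj₂ no₁) (inj₁ yes₂) = second-concentrated t′ i j c₁ c₂ m yes₂ no₁

-- The bound n ≥ 2L(k₁, t) is stated without logarithms: n - 2(t + 1) ≥ 2(k₁ - t + 1) log₂ X is
-- exponentiated, and 2(t + 1) ≤ n, itself a consequence of the bound, keeps the subtraction from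
-- being truncated.
theorem1p4 : (n t k₁ k₂ : ℕ) → 1 ≤ t → k₂ ≤ k₁ → t + 2 ≤ k₂ →
    ¬ ((k₁ ≡ 3) × (k₂ ≡ 3)) →
    2 * (t + 1) ≤ n →
    ((t + 1) * (k₁ ∸ t + 1)) ^ (2 * (k₁ ∸ t + 1)) ≤ 2 ^ (n ∸ 2 * (t + 1)) →
    (F₁ F₂ : Family n) → NTCross n k₁ k₂ t F₁ F₂ →
    (∀ (G₁ G₂ : Family n) → NTCross n k₁ k₂ t G₁ G₂ →
    length G₁ * length G₂ ≤ length F₁ * length F₂) →
    IsoPair F₁ F₂ (𝒜std n k₁ k₂ t) (ℬstd n k₂ t) ⊎
    IsoPair F₁ F₂ (ℬstd n k₁ t) (𝒜std n k₂ k₁ t) ⊎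
    IsoPair F₁ F₂ (𝒞std n k₁ t) (𝒟std n k₂ t) ⊎
    IsoPair F₁ F₂ (𝒟std n k₁ t) (𝒞std n k₂ t)
theorem1p4 n (suc t′) k₁ k₂ _ k₂≤k₁ t+2≤k₂ ¬33 2t≤n large F₁ F₂ nt mx
  with i , refl ← m≤n⇒∃[o]m+o≡n t+2≤k₂ with d , refl ← m≤n⇒∃[o]m+o≡n k₂≤k₁ =
  go (eqk t′ i) (trans (cong (_+ d) (eqk t′ i)) (eqd t′ i d)) ¬33 large nt mx
  where
  eqk : ∀ t i → suc t + 2 + i ≡ suc (suc t + suc i)
  eqk = solve-∀
  eqd : ∀ t i d → suc (suc t + suc i) + d ≡ suc (suc t + suc (i + d))
  eqd = solve-∀
  t : ℕ
  t = suc t′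
  go : ∀ {k₁ k₂} → k₂ ≡ suc (t + suc i) → k₁ ≡ suc (t + suc (i + d)) → ¬ ((k₁ ≡ 3) × (k₂ ≡ 3)) →
       ((t + 1) * (k₁ ∸ t + 1)) ^ (2 * (k₁ ∸ t + 1)) ≤ 2 ^ (n ∸ 2 * (t + 1)) → NTCross n k₁ k₂ t F₁ F₂ →
       (∀ (G₁ G₂ : Family n) → NTCross n k₁ k₂ t G₁ G₂ → length G₁ * length G₂ ≤ length F₁ * length F₂) →
       IsoPair F₁ F₂ (𝒜std n k₁ k₂ t) (ℬstd n k₂ t) ⊎ IsoPair F₁ F₂ (ℬstd n k₁ t) (𝒜std n k₂ k₁ t) ⊎
       IsoPair F₁ F₂ (𝒞std n k₁ t) (𝒟std n k₂ t) ⊎ IsoPair F₁ F₂ (𝒟std n k₁ t) (𝒞std n k₂ t)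
  go refl refl ¬33 large nt mx = main t′ i j (n ∸ κ₁) (n ∸ κ₂) record
      { i≤j = m≤m+n i d ; en₁ = sym (m∸n+n≡m κ₁≤n) ; en₂ = sym (m∸n+n≡m κ₂≤n) ; ¬33 = excluded
      ; large = large′ ; F₁ = F₁ ; F₂ = F₂ ; nt = nt ; mx = mx }
    where
    j X κ₁ κ₂ : ℕ
    j = i + d
    κ₁ = suc (t + suc j)
    κ₂ = suc (t + suc i)
    X = (2 + t′) * (3 + j)
    κ₁∸t : κ₁ ∸ t + 1 ≡ 3 + j
    κ₁∸t = trans (cong (λ k → k ∸ t + 1) (sym (+-suc t (suc j)))) (trans (cong (_+ 1) (m+n∸m≡n t (2 + j))) (+-comm (2 + j) 1))
    large₀ : X ^ (2 * suc j + 4) ≤ 2 ^ (n ∸ 2 * (t + 1))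
    large₀ = subst (_≤ 2 ^ (n ∸ 2 * (t + 1))) (trans (cong (λ y → ((t + 1) * y) ^ (2 * y)) κ₁∸t)
      (cong₂ _^_ (cong (_* (3 + j)) (+-comm t 1)) (lem j))) large
      where lem : ∀ j → 2 * (3 + j) ≡ 2 * suc j + 4
            lem = solve-∀
    2≤X : 2 ≤ X
    2≤X = ≤-trans (m≤m+n 2 t′) (m≤m*n (2 + t′) (3 + j))
    -- As X ≥ 2, comparing powers of two bounds the exponent 2(k₁ - t + 1) by n - 2(t + 1). This
    -- yields k₁ ≤ n, so that n - k₁ is a true difference.
    exp≤ : 2 * suc j + 4 ≤ n ∸ 2 * (t + 1)
    exp≤ with ≤-<-connex (2 * suc j + 4) (n ∸ 2 * (t + 1))
    ... | inj₁ le = le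
    ... | inj₂ lt = contradiction (≤-trans (^-monoˡ-≤ (2 * suc j + 4) 2≤X) large₀) (<⇒≱ (^-monoʳ-< 2 (s≤s (s≤s z≤n)) lt))
    n≥ : 2 * suc j + 4 + 2 * (t + 1) ≤ n
    n≥ = m≤o∸n⇒m+n≤o (2 * suc j + 4) 2t≤n exp≤
    κ₁≤n : κ₁ ≤ n
    κ₁≤n = ≤-trans (≤-cert (j + t + 6) (z≤n {0}) (lem j t)) n≥
      where lem : ∀ j t → 2 * suc j + 4 + 2 * (t + 1) + 0 ≡ suc (t + suc j) + 0 + (j + t + 6)
            lem = solve-∀
    κ₂≤n : κ₂ ≤ n
    κ₂≤n = ≤-trans (s≤s (+-monoʳ-≤ t (s≤s (m≤m+n i d)))) κ₁≤n
    -- The new exponent n - k₁ + j + 1 equals n - t - 1, which exceeds n - 2(t + 1) by t + 1.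
    large′ : X ^ (2 * suc j + 4) ≤ 2 ^ (n ∸ κ₁ + suc j)
    large′ = ≤-trans large₀ (^-monoʳ-≤ 2 (+-cancelʳ-≤ (2 * (t + 1)) _ _ (≤-trans (≤-reflexive (m∸n+n≡m 2t≤n))
      (≤-trans (≤-reflexive (sym (m∸n+n≡m κ₁≤n))) (≤-trans (+-monoʳ-≤ (n ∸ κ₁) (≤-cert (t + 1) (z≤n {0}) (lem j t))) (≤-reflexive (sym (+-assoc (n ∸ κ₁) (suc j) _))))))))
      where lem : ∀ j t → suc j + 2 * (t + 1) + 0 ≡ suc (t + suc j) + 0 + (t + 1)
            lem = solve-∀
    excluded : ¬ (t′ ≡ 0 × j ≡ 0)
    excluded (refl , ej) = ¬33 (cong (3 +_) ej , cong (3 +_) (m+n≡0⇒m≡0 i ej))
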